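{- Let $STS(n)$ denote the number of Steiner triple systems on the vertex set $[n]=\{1,\dots,n\}$. Then, as $n\to\infty$, $$ STS(n) \leq \left( (1 + o(1)) \frac{n}{e^2} \right)^{\frac{n^2}{6}} ;$$ that is, there is a function $\varepsilon(n)\to 0$ as $n\to\infty$ such that $STS(n) \le \left((1+\varepsilon(n))\frac{n}{e^2}\right)^{n^2/6}$ for every $n$.
   Context: A Steiner triple system on a vertex set $V$ is a collection $T\subseteq\binom{V}{3}$ of 3-element subsets (triples) such that every pair of distinct vertices of $V$ is contained in exactly one triple of $T$. Such systems exist (for $n\ge 1$) if and only if $n\equiv 1$ or $3 \pmod 6$; for other $n$, $STS(n)=0$. Here $e$ is the base of the natural logarithm. -}

module Defs where

open import Data.Bool using (Bool; true; false; _∧_; _∨_; if_then_else_)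
open import Data.Nat as ℕ using (ℕ; zero; suc; _<ᵇ_; _≡ᵇ_; _!)
open import Data.Nat.Properties using (_!≢0)
open import Data.Fin using (Fin; toℕ)
open import Data.Product using (_×_; _,_)
open import Data.List using (List; []; _∷_; length; map; concatMap; allFin)
open import Data.Integer using (+_)
open import Data.Rational using (ℚ; _/_; 0ℚ; 1ℚ; _+_; _*_)
open import Relation.Nullary.Decidable using (Dec)
open import Data.Bool using (T)
open import Data.Bool.Properties using (T?)

-- A triple {a,b,c} ⊆ [n] is represented uniquely as (a , b , c) with a < b < c.
Triple : ℕ → Set
Triple n = Fin n × Fin n × Fin n

triples : (n : ℕ) → List (Triple n)
triples n =
  concatMap (λ a → concatMap (λ b → concatMap (λ c →
    if (toℕ a <ᵇ toℕ b) ∧ (toℕ b <ᵇ toℕ c) then (a , b , c) ∷ [] else [])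
      (allFin n)) (allFin n)) (allFin n)

boolLists : ℕ → List (List Bool)
boolLists zero    = [] ∷ []
boolLists (suc m) = concatMap (λ bs → (true ∷ bs) ∷ (false ∷ bs) ∷ []) (boolLists m)

select : ∀ {A : Set} → List A → List Bool → List A
select (x ∷ xs) (true  ∷ bs) = x ∷ select xs bs
select (x ∷ xs) (false ∷ bs) = select xs bs
select _        _            = []

_=ᶠ_ : ∀ {n} → Fin n → Fin n → Bool
x =ᶠ y = toℕ x ≡ᵇ toℕ y

_∋ᵗ_ : ∀ {n} → Triple n → Fin n → Bool
(a , b , c) ∋ᵗ x = (x =ᶠ a) ∨ ((x =ᶠ b) ∨ (x =ᶠ c))

countB : ∀ {A : Set} → (A → Bool) → List A → ℕ
countB p []       = zero
countB p (x ∷ xs) = if p x then suc (countB p xs) else countB p xs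

allB : ∀ {A : Set} → (A → Bool) → List A → Bool
allB p []       = true
allB p (x ∷ xs) = p x ∧ allB p xs

isSTS : ∀ {n} → List (Triple n) → Bool
isSTS {n} T =
  allB (λ x → allB (λ y →
    if toℕ x <ᵇ toℕ y
      then countB (λ t → (t ∋ᵗ x) ∧ (t ∋ᵗ y)) T ≡ᵇ 1
      else true) (allFin n)) (allFin n)

STS : ℕ → ℕ
STS n = countB isSTS (map (select (triples n)) (boolLists (length (triples n))))

ℕ→ℚ : ℕ → ℚ
ℕ→ℚ k = (+ k) / 1

_^ℚ_ : ℚ → ℕ → ℚ
q ^ℚ zero  = 1ℚ
q ^ℚ suc k = q * (q ^ℚ k)

invFact : ℕ → ℚ
invFact j = _/_ (+ 1) (j !) {{j !≢0}}

-- Partial sums e_M = Σ_{j=0}^{M} 1/j! ; these increase to e (definition of e).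
eApprox : ℕ → ℚ
eApprox zero    = 1ℚ
eApprox (suc M) = eApprox M + invFact (suc M)

{-# OPTIONS --safe #-}
module Submission where

-- A Steiner triple system is a Steiner quasigroup F (idempotent, commutative, F x (F x y) = y), and
-- each of its triples occupies 6 of the n² cells (x , y). Give every cell an independent uniform
-- level in {1, …, k} and reveal the cells of an unknown system by decreasing level. When (x , y) at
-- level i is the first revealed cell of its triple, w is still a candidate for F x y only if the 12
-- cells of the triples through {x , w} and {y , w} have level at most i, so the expected number of
-- candidates is at most n (i/k)¹² + 3; and the cell is first with probability at most (i/k)⁵. The
-- chain rule for entropy and Jensen's inequality, both in multiplicative form so that only natural
-- numbers occur, bound STS(n) by the product over all cells and all i of
-- (n (i/k)¹² + 3) ^ (i⁵/k⁶). With k ≈ n^(1/13) both the additive 3 and the error of replacing the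
-- sums by integrals are negligible, and ∫₀¹ 6 u⁵ log (n u¹²) du = log n - 2.

-- The exponents 5 and 12 come from disjointness: for `w` off the triple of `(x , y)`, the triples
-- through `{x , y}`, `{x , w}` and `{y , w}` occupy 18 different cells, whose levels are
-- independent. One cell has level i exactly, and 5 + 12 cells lie at or below it. The three points
-- `w` on the triple itself get probability 1, which is the additive 3. Levels are discrete so that
-- an expectation is a sum over a finite list of colorings and an expected logarithm is a product
-- over that list. Every inequality then compares powers of natural numbers, and roots are extracted
-- by cancelling exponents. Two demands on k compete. Replacing the sums by integrals costs a factor
-- of about n ^ (6/k), so k must exceed log n by far; the additive term costs a factor 1 + 3k¹²/n,
-- so k¹² must be small against n. The partial sums of e multiply the side of STS(n), so each of
-- them only has to be bounded from above, by (1 + 1/l) ^ (l + 1); this bound is uniform in `M`, and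
-- hence so is the threshold `N`.

module Counting where

  open import Defs
  open import Data.Bool using (Bool; true; false; if_then_else_; not; _∧_)
  open import Data.Bool.Properties using (T-≡; ∨-zeroʳ)
  open import Data.Empty using (⊥)
  open import Data.Fin using (Fin; toℕ; fromℕ<) renaming (zero to fzero; suc to fsuc; _<_ to _<ᶠ_)
  import Data.Fin.Properties as Fin
  open import Data.List using (List; []; _∷_; length; map; concatMap; _++_; filter; allFin; cartesianProduct)
  open import Data.List.Membership.Propositional using (_∈_; _∉_; find)
  open import Data.List.Membership.Propositional.Properties using (∈-filter⁻; ∈-cartesianProduct⁺; ∈-allFin; ∈-++⁻; ∈-concatMap⁻)
  open import Data.List.Properties using (map-tabulate; length-tabulate; length-++; length-map)
  open import Data.List.Relation.Binary.Permutation.Propositional using (_↭_; refl; prep; swap; trans; ↭-sym)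
  open import Data.List.Relation.Binary.Permutation.Propositional.Properties using (∈-resp-↭)
  open import Data.List.Relation.Unary.All as All using (All; []; _∷_)
  import Data.List.Relation.Unary.All.Properties as AllP
  open import Data.List.Relation.Unary.AllPairs using (AllPairs; []; _∷_)
  import Data.List.Relation.Unary.AllPairs.Properties as AllPairs
  open import Data.List.Relation.Unary.Any using (here; there; satisfied)
  open import Data.List.Relation.Unary.Sorted.TotalOrder.Properties using (Sorted⇒AllPairs)
  open import Data.List.Relation.Unary.Unique.Propositional using (Unique)
  open import Data.List.Relation.Unary.Unique.Propositional.Properties using (concat⁺; allFin⁺)
  import Data.List.Sort as Sort
  open import Data.Nat
  open import Data.Nat.Properties
  open import Data.Nat.Tactic.RingSolver using (solve-∀)
  open import Data.Product using (_×_; _,_; proj₁; proj₂; ∃-syntax)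
  open import Data.Product.Properties using (≡-dec)
  open import Data.Sum using (_⊎_; inj₁; inj₂)
  open import Data.Unit using (⊤; tt)
  open import Function using (_∘_; const; Equivalence; _⟨_⟩_)
  open import Relation.Binary using (DecidableEquality; DecTotalOrder; tri<; tri≈; tri>)
  import Relation.Binary.Construct.Flip.EqAndOrd as Flip
  import Relation.Binary.Construct.On as On
  open import Relation.Binary.PropositionalEquality as ≡ using (_≡_; _≢_; refl; sym; cong; cong₂; subst; subst₂; module ≡-Reasoning)
  open import Relation.Nullary using (Dec; yes; no; ¬_; does; contradiction)
  open import Relation.Nullary.Decidable using (dec-true; dec-false; _⊎-dec_)

  -- Sums and products over lists

  ∑ ∏ : ∀ {A : Set} → List A → (A → ℕ) → ℕ
  ∑ []       f = 0
  ∑ (x ∷ xs) f = f x + ∑ xs f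
  ∏ []       f = 1
  ∏ (x ∷ xs) f = f x * ∏ xs f

  interchange-+ : ∀ a b c d → a + b + (c + d) ≡ a + c + (b + d)
  interchange-+ = solve-∀

  interchange-* : ∀ a b c d → a * b * (c * d) ≡ a * c * (b * d)
  interchange-* = solve-∀

  ∑-cong : ∀ {A : Set} (xs : List A) {f g : A → ℕ} → (∀ x → f x ≡ g x) → ∑ xs f ≡ ∑ xs g
  ∑-cong []       h = refl
  ∑-cong (x ∷ xs) h = cong₂ _+_ (h x) (∑-cong xs h)

  ∑-mono : ∀ {A : Set} (xs : List A) {f g : A → ℕ} → (∀ x → f x ≤ g x) → ∑ xs f ≤ ∑ xs g
  ∑-mono []       h = z≤n
  ∑-mono (x ∷ xs) h = +-mono-≤ (h x) (∑-mono xs h)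

  ∑-distrib-+ : ∀ {A : Set} (xs : List A) (f g : A → ℕ) → ∑ xs (λ x → f x + g x) ≡ ∑ xs f + ∑ xs g
  ∑-distrib-+ []       f g = refl
  ∑-distrib-+ (x ∷ xs) f g =
    ≡.trans (cong (f x + g x +_) (∑-distrib-+ xs f g)) (interchange-+ (f x) (g x) (∑ xs f) (∑ xs g))

  ∑-distribˡ-* : ∀ {A : Set} (xs : List A) a (f : A → ℕ) → ∑ xs (λ x → a * f x) ≡ a * ∑ xs f
  ∑-distribˡ-* []       a f = sym (*-zeroʳ a)
  ∑-distribˡ-* (x ∷ xs) a f =
    ≡.trans (cong (a * f x +_) (∑-distribˡ-* xs a f)) (sym (*-distribˡ-+ a (f x) (∑ xs f)))

  ∑-distribʳ-* : ∀ {A : Set} (xs : List A) a (f : A → ℕ) → ∑ xs (λ x → f x * a) ≡ ∑ xs f * a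
  ∑-distribʳ-* xs a f =
    ≡.trans (∑-cong xs (λ x → *-comm (f x) a)) (≡.trans (∑-distribˡ-* xs a f) (*-comm a (∑ xs f)))

  ∑-const : ∀ {A : Set} (xs : List A) a → ∑ xs (const a) ≡ length xs * a
  ∑-const []       a = refl
  ∑-const (x ∷ xs) a = cong (a +_) (∑-const xs a)

  ∑-swap : ∀ {A B : Set} (xs : List A) (ys : List B) (f : A → B → ℕ) →
           ∑ xs (λ x → ∑ ys (f x)) ≡ ∑ ys (λ y → ∑ xs (λ x → f x y))
  ∑-swap []       ys f = sym (≡.trans (∑-const ys 0) (*-zeroʳ (length ys)))
  ∑-swap (x ∷ xs) ys f =
    ≡.trans (cong (∑ ys (f x) +_) (∑-swap xs ys f)) (sym (∑-distrib-+ ys (f x) (λ y → ∑ xs (λ x → f x y))))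

  ∑-++ : ∀ {A : Set} (xs ys : List A) (f : A → ℕ) → ∑ (xs ++ ys) f ≡ ∑ xs f + ∑ ys f
  ∑-++ []       ys f = refl
  ∑-++ (x ∷ xs) ys f = ≡.trans (cong (f x +_) (∑-++ xs ys f)) (sym (+-assoc (f x) (∑ xs f) (∑ ys f)))

  ∑-map : ∀ {A B : Set} (g : A → B) (xs : List A) (f : B → ℕ) → ∑ (map g xs) f ≡ ∑ xs (f ∘ g)
  ∑-map g []       f = refl
  ∑-map g (x ∷ xs) f = cong (f (g x) +_) (∑-map g xs f)

  ∑-concatMap : ∀ {A B : Set} (g : A → List B) (xs : List A) (f : B → ℕ) →
                ∑ (concatMap g xs) f ≡ ∑ xs (λ x → ∑ (g x) f)
  ∑-concatMap g []       f = refl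
  ∑-concatMap g (x ∷ xs) f =
    ≡.trans (∑-++ (g x) (concatMap g xs) f) (cong (∑ (g x) f +_) (∑-concatMap g xs f))

  ∑-allFin-suc : ∀ n (f : Fin (suc n) → ℕ) → ∑ (allFin (suc n)) f ≡ f fzero + ∑ (allFin n) (f ∘ fsuc)
  ∑-allFin-suc n f =
    cong (f fzero +_)
      (≡.trans (cong (λ l → ∑ l f) (sym (map-tabulate (λ i → i) fsuc))) (∑-map fsuc (allFin n) f))

  ∏-cong : ∀ {A : Set} (xs : List A) {f g : A → ℕ} → (∀ x → f x ≡ g x) → ∏ xs f ≡ ∏ xs g
  ∏-cong []       h = refl
  ∏-cong (x ∷ xs) h = cong₂ _*_ (h x) (∏-cong xs h)

  ∏-mono : ∀ {A : Set} (xs : List A) {f g : A → ℕ} → (∀ x → f x ≤ g x) → ∏ xs f ≤ ∏ xs g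
  ∏-mono []       h = ≤-refl
  ∏-mono (x ∷ xs) h = *-mono-≤ (h x) (∏-mono xs h)

  ∏-distrib-* : ∀ {A : Set} (xs : List A) (f g : A → ℕ) → ∏ xs (λ x → f x * g x) ≡ ∏ xs f * ∏ xs g
  ∏-distrib-* []       f g = refl
  ∏-distrib-* (x ∷ xs) f g =
    ≡.trans (cong (f x * g x *_) (∏-distrib-* xs f g)) (interchange-* (f x) (g x) (∏ xs f) (∏ xs g))

  ∏-const : ∀ {A : Set} (xs : List A) a → ∏ xs (const a) ≡ a ^ length xs
  ∏-const []       a = refl
  ∏-const (x ∷ xs) a = cong (a *_) (∏-const xs a)

  ∏-swap : ∀ {A B : Set} (xs : List A) (ys : List B) (f : A → B → ℕ) →
           ∏ xs (λ x → ∏ ys (f x)) ≡ ∏ ys (λ y → ∏ xs (λ x → f x y))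
  ∏-swap []       ys f = sym (≡.trans (∏-const ys 1) (^-zeroˡ (length ys)))
  ∏-swap (x ∷ xs) ys f =
    ≡.trans (cong (∏ ys (f x) *_) (∏-swap xs ys f)) (sym (∏-distrib-* ys (f x) (λ y → ∏ xs (λ x → f x y))))

  ∏-++ : ∀ {A : Set} (xs ys : List A) (f : A → ℕ) → ∏ (xs ++ ys) f ≡ ∏ xs f * ∏ ys f
  ∏-++ []       ys f = sym (+-identityʳ _)
  ∏-++ (x ∷ xs) ys f = ≡.trans (cong (f x *_) (∏-++ xs ys f)) (sym (*-assoc (f x) (∏ xs f) (∏ ys f)))

  ∏-↭ : ∀ {A : Set} {xs ys : List A} (f : A → ℕ) → xs ↭ ys → ∏ xs f ≡ ∏ ys f
  ∏-↭ f refl           = refl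
  ∏-↭ f (prep x p)     = cong (f x *_) (∏-↭ f p)
  ∏-↭ f (swap x y p)   =
    ≡.trans (cong (λ a → f x * (f y * a)) (∏-↭ f p)) (exchange (f x) (f y) _)
    where
    exchange : ∀ a b c → a * (b * c) ≡ b * (a * c)
    exchange = solve-∀
  ∏-↭ f (trans p q)    = ≡.trans (∏-↭ f p) (∏-↭ f q)

  ^-distribʳ-* : ∀ a b m → (a * b) ^ m ≡ a ^ m * b ^ m
  ^-distribʳ-* a b zero    = refl
  ^-distribʳ-* a b (suc m) = ≡.trans (cong (a * b *_) (^-distribʳ-* a b m)) (interchange-* a b (a ^ m) (b ^ m))

  ∏-^ : ∀ {A : Set} (xs : List A) (f : A → ℕ) m → ∏ xs (λ x → f x ^ m) ≡ ∏ xs f ^ m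
  ∏-^ []       f m = sym (^-zeroˡ m)
  ∏-^ (x ∷ xs) f m = ≡.trans (cong (f x ^ m *_) (∏-^ xs f m)) (sym (^-distribʳ-* (f x) (∏ xs f) m))

  ∏-allFin-suc : ∀ n (f : Fin (suc n) → ℕ) → ∏ (allFin (suc n)) f ≡ f fzero * ∏ (allFin n) (f ∘ fsuc)
  ∏-allFin-suc n f =
    cong (f fzero *_)
      (≡.trans (cong (λ l → ∏ l f) (sym (map-tabulate (λ i → i) fsuc))) (lemma (allFin n)))
    where
    lemma : ∀ l → ∏ (map fsuc l) f ≡ ∏ l (f ∘ fsuc)
    lemma []      = refl
    lemma (x ∷ l) = cong (f (fsuc x) *_) (lemma l)

  [_] : Bool → ℕ
  [ b ] = if b then 1 else 0

  ∑-delta : ∀ {n} (j : Fin n) → ∑ (allFin n) (λ i → [ does (j Fin.≟ i) ]) ≡ 1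
  ∑-delta {suc n} fzero    =
    ≡.trans (∑-allFin-suc n (λ i → [ does (fzero Fin.≟ i) ])) (cong suc (≡.trans (∑-const (allFin n) 0) (*-zeroʳ (length (allFin n)))))
  ∑-delta {suc n} (fsuc j) = ≡.trans (∑-allFin-suc n (λ i → [ does (fsuc j Fin.≟ i) ])) (∑-delta j)

  ∏-delta : ∀ {n} (j : Fin n) (f : Fin n → ℕ) → ∏ (allFin n) (λ i → f i ^ [ does (j Fin.≟ i) ]) ≡ f j
  ∏-delta {suc n} fzero    f =
    ≡.trans (∏-allFin-suc n (λ i → f i ^ [ does (fzero Fin.≟ i) ]))
      (≡.trans (cong (f fzero ^ 1 *_) (≡.trans (∏-const (allFin n) 1) (^-zeroˡ (length (allFin n)))))
        (≡.trans (*-identityʳ (f fzero ^ 1)) (^-identityʳ (f fzero))))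
  ∏-delta {suc n} (fsuc j) f =
    ≡.trans (∏-allFin-suc n (λ i → f i ^ [ does (fsuc j Fin.≟ i) ])) (≡.trans (+-identityʳ _) (∏-delta j (f ∘ fsuc)))

  ^-cancelʳ-≤ : ∀ m {a b} .{{_ : NonZero m}} → a ^ m ≤ b ^ m → a ≤ b
  ^-cancelʳ-≤ m {a} {b} p with a ≤? b
  ... | yes a≤b = a≤b
  ... | no  a≰b = contradiction p (<⇒≱ (^-monoˡ-< m (≰⇒> a≰b)))

  -- The inequality of arithmetic and geometric means

  2xy≤x²+y² : ∀ x y → 2 * (x * y) ≤ x * x + y * y
  2xy≤x²+y² zero    y       = z≤n
  2xy≤x²+y² (suc x) zero    = subst (_≤ suc x * suc x + 0) (sym (≡.trans (cong (2 *_) (*-zeroʳ x)) refl)) z≤n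
  2xy≤x²+y² (suc x) (suc y) =
    subst₂ _≤_ (eqˡ x y) (eqʳ x y) (+-monoˡ-≤ (2 + 2 * x + 2 * y) (2xy≤x²+y² x y))
    where
    eqˡ : ∀ x y → 2 * (x * y) + (2 + 2 * x + 2 * y) ≡ 2 * (suc x * suc y)
    eqˡ = solve-∀
    eqʳ : ∀ x y → x * x + y * y + (2 + 2 * x + 2 * y) ≡ suc x * suc x + suc y * suc y
    eqʳ = solve-∀

  -- Bernoulli's inequality for x / y, with denominators cleared.
  bernoulli : ∀ m x y → suc m * (x * y ^ m) ≤ x ^ suc m + m * y ^ suc m
  bernoulli zero    x y = ≤-reflexive (eq x)
    where
    eq : ∀ x → 1 * (x * 1) ≡ x * 1 + 0
    eq = solve-∀
  bernoulli (suc m) x y =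
    +-cancelʳ-≤ (m * (x * (y * Y)) ) _ _
      (begin
        suc (suc m) * (x * (y * Y)) + m * (x * (y * Y))  ≡⟨ eq₁ m x y Y ⟩
        (suc m * Y) * (2 * (x * y))                      ≤⟨ *-monoʳ-≤ (suc m * Y) (2xy≤x²+y² x y) ⟩
        (suc m * Y) * (x * x + y * y)                    ≡⟨ eq₂ m x y Y ⟩
        x * (suc m * (x * Y)) + suc m * (y * (y * Y))    ≤⟨ +-monoˡ-≤ _ (*-monoʳ-≤ x (bernoulli m x y)) ⟩
        x * (x ^ suc m + m * (y * Y)) + suc m * (y * (y * Y)) ≡⟨ eq₃ m x y Y (x ^ suc m) ⟩
        (x * x ^ suc m + suc m * (y * (y * Y))) + m * (x * (y * Y)) ∎)
    where
    open ≤-Reasoning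
    Y = y ^ m
    eq₁ : ∀ m x y Y → suc (suc m) * (x * (y * Y)) + m * (x * (y * Y)) ≡ (suc m * Y) * (2 * (x * y))
    eq₁ = solve-∀
    eq₂ : ∀ m x y Y → (suc m * Y) * (x * x + y * y) ≡ x * (suc m * (x * Y)) + suc m * (y * (y * Y))
    eq₂ = solve-∀
    eq₃ : ∀ m x y Y X → x * (X + m * (y * Y)) + suc m * (y * (y * Y)) ≡ (x * X + suc m * (y * (y * Y))) + m * (x * (y * Y))
    eq₃ = solve-∀

  -- Bernoulli's inequality for the ratio `x / y` of the means after and before `a` joins `m`
  -- numbers with sum `S`. The case `m = 0` is separate because the final cancellation divides by
  -- `m`.
  amgm-step₀ : ∀ m S a → suc m ^ suc m * (a * S ^ m) ≤ (a + S) ^ suc m * m ^ m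
  amgm-step₀ zero      S a = ≤-trans (≤-reflexive (eq a)) (≤-trans (m≤m+n a S) (≤-reflexive (eq′ (a + S))))
    where
    eq : ∀ a → 1 * (a * 1) ≡ a
    eq = solve-∀
    eq′ : ∀ a → a ≡ a * 1 * 1
    eq′ = solve-∀
  amgm-step₀ m@(suc _) S a = *-cancelˡ-≤ m (+-cancelʳ-≤ (m * y ^ suc m) _ _ (begin
      m * (suc m ^ suc m * (a * S ^ m)) + m * y ^ suc m
        ≡⟨ cong (λ z → m * (suc m ^ suc m * (a * S ^ m)) + m * z) (^-distribʳ-* (suc m) S (suc m)) ⟩
      m * (suc m ^ suc m * (a * S ^ m)) + m * (suc m ^ suc m * S ^ suc m)
        ≡⟨ eq₁ m (suc m ^ m) a S (S ^ m) ⟩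
      suc m * (x * (suc m ^ m * S ^ m))
        ≡⟨ cong (λ z → suc m * (x * z)) (^-distribʳ-* (suc m) S m) ⟨
      suc m * (x * y ^ m)
        ≤⟨ bernoulli m x y ⟩
      x ^ suc m + m * y ^ suc m
        ≡⟨ cong (_+ m * y ^ suc m) (^-distribʳ-* m (a + S) (suc m)) ⟩
      m ^ suc m * (a + S) ^ suc m + m * y ^ suc m
        ≡⟨ cong (_+ m * y ^ suc m) (eq₂ m (m ^ m) ((a + S) ^ suc m)) ⟩
      m * ((a + S) ^ suc m * m ^ m) + m * y ^ suc m ∎))
    where
    open ≤-Reasoning
    x = m * (a + S)
    y = suc m * S
    eq₁ : ∀ m P a S Q → m * (suc m * P * (a * Q)) + m * (suc m * P * (S * Q)) ≡ suc m * (m * (a + S) * (P * Q))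
    eq₁ = solve-∀
    eq₂ : ∀ m P Q → m * P * Q ≡ m * (Q * P)
    eq₂ = solve-∀

  -- Thanks to `0 ^ 0 = 1`, a total weight of zero needs no special treatment in `amgm-step` and
  -- `amgm-bound`.
  ^≢0 : ∀ m → NonZero (m ^ m)
  ^≢0 zero      = _
  ^≢0 m@(suc _) = m^n≢0 m m

  amgm-step : ∀ m S P a → m ^ m * P ≤ S ^ m → suc m ^ suc m * (a * P) ≤ (a + S) ^ suc m
  amgm-step m S P a h = *-cancelʳ-≤ _ _ (m ^ m) {{^≢0 m}} (begin
    suc m ^ suc m * (a * P) * m ^ m   ≡⟨ eq (suc m ^ suc m) a P (m ^ m) ⟩
    suc m ^ suc m * (a * (m ^ m * P)) ≤⟨ *-monoʳ-≤ (suc m ^ suc m) (*-monoʳ-≤ a h) ⟩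
    suc m ^ suc m * (a * S ^ m)       ≤⟨ amgm-step₀ m S a ⟩
    (a + S) ^ suc m * m ^ m ∎)
    where
    open ≤-Reasoning
    eq : ∀ A a P M → A * (a * P) * M ≡ A * (a * (M * P))
    eq = solve-∀

  amgm-steps : ∀ w m S P a → m ^ m * P ≤ S ^ m → (w + m) ^ (w + m) * (a ^ w * P) ≤ (w * a + S) ^ (w + m)
  amgm-steps zero    m S P a h = subst (λ z → m ^ m * z ≤ S ^ m) (sym (+-identityʳ P)) h
  amgm-steps (suc w) m S P a h =
    subst₂ (λ u v → suc (w + m) ^ suc (w + m) * u ≤ v ^ suc (w + m))
      (sym (*-assoc a (a ^ w) P)) (sym (+-assoc a (w * a) S))
      (amgm-step (w + m) (w * a + S) (a ^ w * P) a (amgm-steps w m S P a h))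

  amgm : ∀ {A : Set} (xs : List A) (w a : A → ℕ) →
         ∑ xs w ^ ∑ xs w * ∏ xs (λ x → a x ^ w x) ≤ ∑ xs (λ x → w x * a x) ^ ∑ xs w
  amgm []       w a = ≤-refl
  amgm (x ∷ xs) w a = amgm-steps (w x) (∑ xs w) _ _ (a x) (amgm xs w a)

  -- Jensen's inequality for the logarithm in the form used later: if the weighted arithmetic mean
  -- of `a` is at most `p / q`, so is its weighted geometric mean.
  amgm-bound : ∀ {A : Set} (xs : List A) (w a : A → ℕ) p q →
               q * ∑ xs (λ x → w x * a x) ≤ p * ∑ xs w →
               q ^ ∑ xs w * ∏ xs (λ x → a x ^ w x) ≤ p ^ ∑ xs w
  amgm-bound xs w a p q h = *-cancelʳ-≤ _ _ (W ^ W) {{^≢0 W}} (begin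
    q ^ W * P * W ^ W   ≡⟨ eq (q ^ W) P (W ^ W) ⟩
    q ^ W * (W ^ W * P) ≤⟨ *-monoʳ-≤ (q ^ W) (amgm xs w a) ⟩
    q ^ W * Σ ^ W       ≡⟨ ^-distribʳ-* q Σ W ⟨
    (q * Σ) ^ W         ≤⟨ ^-monoˡ-≤ W h ⟩
    (p * W) ^ W         ≡⟨ ^-distribʳ-* p W W ⟩
    p ^ W * W ^ W       ∎)
    where
    open ≤-Reasoning
    W = ∑ xs w
    P = ∏ xs (λ x → a x ^ w x)
    Σ = ∑ xs (λ x → w x * a x)
    eq : ∀ a b c → a * b * c ≡ a * (c * b)
    eq = solve-∀

  -- Splitting a set of size ∑ s into m nonempty parts

  nonzero : ℕ → ℕ
  nonzero zero    = 0
  nonzero (suc _) = 1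

  -- Weighted AM-GM for the two numbers b and m a with weights a and b.
  two-parts : ∀ m a b → .{{NonZero a}} → .{{NonZero b}} →
              (a + b) ^ (a + b) * m ^ b ≤ suc m ^ (a + b) * (a ^ a * b ^ b)
  two-parts m a b = *-cancelʳ-≤ _ _ (b ^ a * a ^ b) {{m*n≢0 (b ^ a) (a ^ b) {{m^n≢0 b a}} {{m^n≢0 a b}}}} (begin
    (a + b) ^ (a + b) * m ^ b * (b ^ a * a ^ b)     ≡⟨ eq₁ ((a + b) ^ (a + b)) (m ^ b) (b ^ a) (a ^ b) ⟩
    (a + b) ^ (a + b) * (b ^ a * (m ^ b * a ^ b * 1)) ≡⟨ cong (λ z → (a + b) ^ (a + b) * (b ^ a * (z * 1))) (^-distribʳ-* m a b) ⟨
    (a + b) ^ (a + b) * (b ^ a * ((m * a) ^ b * 1)) ≡⟨ cong (λ z → (a + z) ^ (a + z) * (b ^ a * ((m * a) ^ b * 1))) (+-identityʳ b) ⟨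
    (a + (b + 0)) ^ (a + (b + 0)) * (b ^ a * ((m * a) ^ b * 1))
      ≤⟨ amgm-steps a (b + 0) _ _ b (amgm-steps b 0 0 1 (m * a) ≤-refl) ⟩
    (a * b + (b * (m * a) + 0)) ^ (a + (b + 0))     ≡⟨ cong₂ _^_ (eq₂ m a b) (cong (a +_) (+-identityʳ b)) ⟩
    (suc m * (a * b)) ^ (a + b)                     ≡⟨ ^-distribʳ-* (suc m) (a * b) (a + b) ⟩
    suc m ^ (a + b) * (a * b) ^ (a + b)             ≡⟨ cong (suc m ^ (a + b) *_) (^-distribʳ-* a b (a + b)) ⟩
    suc m ^ (a + b) * (a ^ (a + b) * b ^ (a + b))
      ≡⟨ cong₂ (λ u v → suc m ^ (a + b) * (u * v)) (^-distribˡ-+-* a a b) (^-distribˡ-+-* b a b) ⟩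
    suc m ^ (a + b) * (a ^ a * a ^ b * (b ^ a * b ^ b)) ≡⟨ eq₃ (suc m ^ (a + b)) (a ^ a) (a ^ b) (b ^ a) (b ^ b) ⟩
    suc m ^ (a + b) * (a ^ a * b ^ b) * (b ^ a * a ^ b) ∎)
    where
    open ≤-Reasoning
    eq₁ : ∀ x y z w → x * y * (z * w) ≡ x * (z * (y * w * 1))
    eq₁ = solve-∀
    eq₂ : ∀ m a b → a * b + (b * (m * a) + 0) ≡ suc m * (a * b)
    eq₂ = solve-∀
    eq₃ : ∀ x y z w v → x * (y * z * (w * v)) ≡ x * (y * v) * (w * z)
    eq₃ = solve-∀

  -- With `N = ∑ ws s`, the quotient of `N ^ N` by the product of all `s w ^ s w` is the exponential
  -- of `N` times the entropy of the distribution `s / N`, and entropy is at most the logarithm of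
  -- the number of values attained. The induction separates one value and treats the others as a
  -- single part in `two-parts`.
  entropy-split : ∀ {A : Set} (ws : List A) (s : A → ℕ) →
    ∑ ws s ^ ∑ ws s ≤ ∑ ws (nonzero ∘ s) ^ ∑ ws s * ∏ ws (λ w → s w ^ s w)
  entropy-split []       s = ≤-refl
  entropy-split (w ∷ ws) s with s w | ∑ ws s | ∑ ws (nonzero ∘ s) | ∑-nonzero ws | entropy-split ws s
    where
    ∑-nonzero : ∀ ws → ∑ ws (nonzero ∘ s) ≡ 0 → ∑ ws s ≡ 0
    ∑-nonzero []       _ = refl
    ∑-nonzero (w ∷ ws) h with s w
    ... | zero = ∑-nonzero ws h
  ... | zero    | b | m | _ | ih = subst (λ z → b ^ b ≤ m ^ b * z) (sym (+-identityʳ _)) ih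
  ... | a@(suc _) | zero | m | _ | ih = begin
    (a + 0) ^ (a + 0)                    ≡⟨ cong₂ _^_ (+-identityʳ a) (+-identityʳ a) ⟩
    a ^ a                                ≤⟨ m≤n*m (a ^ a) (suc m ^ (a + 0)) {{m^n≢0 (suc m) (a + 0)}} ⟩
    suc m ^ (a + 0) * a ^ a              ≡⟨ cong (suc m ^ (a + 0) *_) (*-identityʳ (a ^ a)) ⟨
    suc m ^ (a + 0) * (a ^ a * 1)        ≤⟨ *-monoʳ-≤ (suc m ^ (a + 0)) (*-monoʳ-≤ (a ^ a) (≤-trans ih (≤-reflexive (+-identityʳ _)))) ⟩
    suc m ^ (a + 0) * (a ^ a * ∏ ws (λ w → s w ^ s w)) ∎
    where open ≤-Reasoning
  -- If none of the remaining parts is nonempty, their sum `b` is zero.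
  ... | a@(suc _) | b@(suc _) | zero | h | ih = contradiction (h refl) λ ()
  ... | a@(suc _) | b@(suc _) | m@(suc _) | h | ih = *-cancelʳ-≤ _ _ (m ^ b) {{m^n≢0 m b}} (begin
    (a + b) ^ (a + b) * m ^ b ≤⟨ two-parts m a b ⟩
    suc m ^ (a + b) * (a ^ a * b ^ b) ≤⟨ *-monoʳ-≤ (suc m ^ (a + b)) (*-monoʳ-≤ (a ^ a) ih) ⟩
    suc m ^ (a + b) * (a ^ a * (m ^ b * P)) ≡⟨ eq (suc m ^ (a + b)) (a ^ a) (m ^ b) P ⟩
    suc m ^ (a + b) * (a ^ a * P) * m ^ b ∎)
    where
    open ≤-Reasoning
    P = ∏ ws (λ w → s w ^ s w)
    eq : ∀ x y z w → x * (y * (z * w)) ≡ x * (y * w) * z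
    eq = solve-∀

  -- Chain rule for entropy

  ∏-mono-∈ : ∀ {A : Set} (xs : List A) {f g : A → ℕ} → (∀ {x} → x ∈ xs → f x ≤ g x) → ∏ xs f ≤ ∏ xs g
  ∏-mono-∈ []       h = ≤-refl
  ∏-mono-∈ (x ∷ xs) h = *-mono-≤ (h (here refl)) (∏-mono-∈ xs (h ∘ there))

  allPairs-map : ∀ {A : Set} {P : A → Set} {R R′ : A → A → Set} {xs : List A} →
    (∀ {x y} → P x → P y → R x y → R′ x y) → All P xs → AllPairs R xs → AllPairs R′ xs
  allPairs-map h []       []       = []
  allPairs-map h (p ∷ ps) (r ∷ rs) =
    All.zipWith (λ (py , rxy) → h p py rxy) (ps , r) ∷ allPairs-map h ps rs

  module _ {A : Set} {n} (v : A → Fin n) where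

    class : List A → Fin n → List A
    class S w = filter (λ F → v F Fin.≟ w) S

    -- Membership in a class becomes an exponent 0 or 1 over the whole list, so that the products
    -- over classes and over `S` can be exchanged.
    ∏-class : ∀ S w (g : A → ℕ) → ∏ (class S w) g ≡ ∏ S (λ F → g F ^ [ does (v F Fin.≟ w) ])
    ∏-class []      w g = refl
    ∏-class (F ∷ S) w g with does (v F Fin.≟ w)
    ... | true  = cong₂ _*_ (sym (^-identityʳ (g F))) (∏-class S w g)
    ... | false = ≡.trans (∏-class S w g) (sym (+-identityʳ _))

    length-class : ∀ S w → length (class S w) ≡ ∑ S (λ F → [ does (v F Fin.≟ w) ])
    length-class []      w = refl
    length-class (F ∷ S) w with does (v F Fin.≟ w)
    ... | true  = cong suc (length-class S w)
    ... | false = length-class S w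

    ∏-classes : ∀ S (g : A → ℕ) → ∏ (allFin n) (λ w → ∏ (class S w) g) ≡ ∏ S g
    ∏-classes S g = begin
      ∏ (allFin n) (λ w → ∏ (class S w) g)                               ≡⟨ ∏-cong (allFin n) (λ w → ∏-class S w g) ⟩
      ∏ (allFin n) (λ w → ∏ S (λ F → g F ^ [ does (v F Fin.≟ w) ]))      ≡⟨ ∏-swap (allFin n) S _ ⟩
      ∏ S (λ F → ∏ (allFin n) (λ w → g F ^ [ does (v F Fin.≟ w) ]))      ≡⟨ ∏-cong S (λ F → ∏-delta (v F) (const (g F))) ⟩
      ∏ S g ∎
      where open ≡-Reasoning

    ∑-length-classes : ∀ S → ∑ (allFin n) (length ∘ class S) ≡ length S
    ∑-length-classes S = begin
      ∑ (allFin n) (length ∘ class S)                             ≡⟨ ∑-cong (allFin n) (length-class S) ⟩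
      ∑ (allFin n) (λ w → ∑ S (λ F → [ does (v F Fin.≟ w) ]))     ≡⟨ ∑-swap (allFin n) S _ ⟩
      ∑ S (λ F → ∑ (allFin n) (λ w → [ does (v F Fin.≟ w) ]))     ≡⟨ ∑-cong S (λ F → ∑-delta (v F)) ⟩
      ∑ S (const 1)                                               ≡⟨ ∑-const S 1 ⟩
      length S * 1                                                ≡⟨ *-identityʳ (length S) ⟩
      length S ∎
      where open ≡-Reasoning

  -- A multiplicative form of the chain rule for entropy: the cells of a random element of S are
  -- revealed in the order o, and Q F e holds of every value that e can still take once the values
  -- of F at the earlier cells are known.
  entropy : ∀ {A C : Set} {n} (val : A → C → Fin n) (Q : A → C → Fin n → Bool) (o : List C) (S : List A) →
    AllPairs (λ F G → ¬ All (λ e → val F e ≡ val G e) o) S →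
    (∀ pre {e post} → o ≡ pre ++ e ∷ post → ∀ {F G} → F ∈ S → G ∈ S →
       All (λ d → val F d ≡ val G d) pre → Q F e (val G e) ≡ true) →
    length S ^ length S ≤ ∏ S (λ F → ∏ o (λ e → ∑ (allFin n) (λ w → [ Q F e w ])))
  entropy val Q [] []          _               _ = ≤-refl
  entropy val Q [] (F ∷ [])    _               _ = ≤-refl
  -- Two members that agree on every revealed cell cannot both remain at the end.
  entropy val Q [] (F ∷ G ∷ S) ((¬p ∷ _) ∷ _) _ = contradiction [] ¬p
  entropy {A} {n = n} val Q (e ∷ o) S distinct branch = begin
    length S ^ length S
      ≡⟨ cong₂ _^_ |S| |S| ⟨
    ∑ Ws s ^ ∑ Ws s
      ≤⟨ entropy-split Ws s ⟩
    ∑ Ws (nonzero ∘ s) ^ ∑ Ws s * ∏ Ws (λ w → s w ^ s w)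
      -- The number of nonempty classes is at most `N F e` for each `F` in `S` separately, so its
      -- power with exponent `length S` is at most the product over `S`. Inside a class all values
      -- at `e` agree, which extends the known prefix by `e`.
      ≤⟨ *-mono-≤ parts (∏-mono Ws (λ w → entropy val Q o (class v S w) (distinct′ w) (branch′ w))) ⟩
    ∏ S (λ F → N F e) * ∏ Ws (λ w → ∏ (class v S w) (λ F → ∏ o (N F)))
      ≡⟨ cong (∏ S (λ F → N F e) *_) (∏-classes v S (λ F → ∏ o (N F))) ⟩
    ∏ S (λ F → N F e) * ∏ S (λ F → ∏ o (N F))
      ≡⟨ ∏-distrib-* S (λ F → N F e) (λ F → ∏ o (N F)) ⟨
    ∏ S (λ F → ∏ (e ∷ o) (N F)) ∎
    where
    open ≤-Reasoning
    Ws = allFin n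
    v : A → Fin n
    v F = val F e
    s : Fin n → ℕ
    s w = length (class v S w)
    N : A → _ → ℕ
    N F e = ∑ Ws (λ w → [ Q F e w ])
    |S| : ∑ Ws s ≡ length S
    |S| = ∑-length-classes v S

    nonempty : ∀ {F} → F ∈ S → ∀ w → nonzero (s w) ≤ [ Q F e w ]
    nonempty {F} F∈S w with class v S w in eq
    ... | []    = z≤n
    ... | G ∷ _ with ∈-filter⁻ (λ F → v F Fin.≟ w) {xs = S} (subst (G ∈_) (sym eq) (here refl))
    ... | G∈S , refl rewrite branch [] refl F∈S G∈S [] = ≤-refl

    parts : ∑ Ws (nonzero ∘ s) ^ ∑ Ws s ≤ ∏ S (λ F → N F e)
    parts = begin
      ∑ Ws (nonzero ∘ s) ^ ∑ Ws s        ≡⟨ cong (∑ Ws (nonzero ∘ s) ^_) |S| ⟩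
      ∑ Ws (nonzero ∘ s) ^ length S      ≡⟨ ∏-const S (∑ Ws (nonzero ∘ s)) ⟨
      ∏ S (const (∑ Ws (nonzero ∘ s)))   ≤⟨ ∏-mono-∈ S (λ F∈S → ∑-mono Ws (nonempty F∈S)) ⟩
      ∏ S (λ F → N F e) ∎

    distinct′ : ∀ w → AllPairs (λ F G → ¬ All (λ e → val F e ≡ val G e) o) (class v S w)
    distinct′ w =
      allPairs-map (λ p q ¬a a → ¬a (≡.trans p (sym q) ∷ a)) (AllP.all-filter (λ F → v F Fin.≟ w) S)
        (AllPairs.filter⁺ (λ F → v F Fin.≟ w) distinct)

    branch′ : ∀ w pre {d post} → o ≡ pre ++ d ∷ post → ∀ {F G} → F ∈ class v S w → G ∈ class v S w →
              All (λ d → val F d ≡ val G d) pre → Q F d (val G d) ≡ true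
    branch′ w pre eq F∈ G∈ agree with ∈-filter⁻ (λ F → v F Fin.≟ w) {xs = S} F∈ | ∈-filter⁻ (λ F → v F Fin.≟ w) {xs = S} G∈
    ... | F∈S , p | G∈S , q = branch (e ∷ pre) (cong (e ∷_) eq) F∈S G∈S (≡.trans p (sym q) ∷ agree)

  length-allFin : ∀ n → length (allFin n) ≡ n
  length-allFin n = length-tabulate (λ i → i)

  -- An index `i : Fin k` stands for the level `suc (toℕ i)`, hence the numerators `suc (toℕ i)` in
  -- the counts below.
  _≤ˡ_ : ∀ {k} → Fin k → Fin k → Bool
  v ≤ˡ i = toℕ v <ᵇ suc (toℕ i)

  ∑-≤ˡ : ∀ {k} (i : Fin k) → ∑ (allFin k) (λ v → [ v ≤ˡ i ]) ≡ suc (toℕ i)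
  ∑-≤ˡ {suc k} fzero    =
    ≡.trans (∑-allFin-suc k (λ v → [ v ≤ˡ fzero ]))
      (cong suc (≡.trans (∑-const (allFin k) 0) (*-zeroʳ (length (allFin k)))))
  ∑-≤ˡ {suc k} (fsuc i) = ≡.trans (∑-allFin-suc k (λ v → [ v ≤ˡ fsuc i ])) (cong suc (∑-≤ˡ i))

  allPairs-++ˡ : ∀ {A : Set} {R : A → A → Set} (xs : List A) {ys} → AllPairs R (xs ++ ys) → AllPairs R xs
  allPairs-++ˡ []       _        = []
  allPairs-++ˡ (x ∷ xs) (p ∷ ps) = AllP.++⁻ˡ xs p ∷ allPairs-++ˡ xs ps

  -- Random levels

  module Colorings {C : Set} (_≟_ : DecidableEquality C) {k : ℕ} (o : Fin k) where

    Coloring : Set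
    Coloring = C → Fin k

    _[_↦_] : Coloring → C → Fin k → Coloring
    (c [ e ↦ v ]) d = if does (e ≟ d) then v else c d

    -- Colorings are total functions: cells outside the list keep the default level `o`, whose
    -- existence also shows that `k` is nonzero.
    colorings : List C → List Coloring
    colorings []       = const o ∷ []
    colorings (e ∷ es) = concatMap (λ c → map (c [ e ↦_]) (allFin k)) (colorings es)

    ∑-colorings : ∀ e es (f : Coloring → ℕ) →
      ∑ (colorings (e ∷ es)) f ≡ ∑ (colorings es) (λ c → ∑ (allFin k) (λ v → f (c [ e ↦ v ])))
    ∑-colorings e es f =
      ≡.trans (∑-concatMap (λ c → map (c [ e ↦_]) (allFin k)) (colorings es) f)
        (∑-cong (colorings es) (λ c → ∑-map (c [ e ↦_]) (allFin k) f))

    ∑-levels-const : ∀ a → ∑ (allFin k) (const a) ≡ k * a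
    ∑-levels-const a = ≡.trans (∑-const (allFin k) a) (cong (_* a) (length-allFin k))

    length-colorings : ∀ es → length (colorings es) ≡ k ^ length es
    length-colorings es = begin
      length (colorings es)       ≡⟨ *-identityʳ _ ⟨
      length (colorings es) * 1   ≡⟨ ∑-const (colorings es) 1 ⟨
      ∑ (colorings es) (const 1)  ≡⟨ count es ⟩
      k ^ length es ∎
      where
      open ≡-Reasoning
      count : ∀ es → ∑ (colorings es) (const 1) ≡ k ^ length es
      count []       = refl
      count (e ∷ es) = begin
        ∑ (colorings (e ∷ es)) (const 1)                     ≡⟨ ∑-colorings e es (const 1) ⟩
        ∑ (colorings es) (λ _ → ∑ (allFin k) (const 1))      ≡⟨ ∑-cong (colorings es) (λ _ → ∑-levels-const 1) ⟩
        ∑ (colorings es) (λ _ → k * 1)                       ≡⟨ ∑-distribˡ-* (colorings es) k (const 1) ⟩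
        k * ∑ (colorings es) (const 1)                       ≡⟨ cong (k *_) (count es) ⟩
        k * k ^ length es ∎

    -- The condition asks for pointwise agreement of `c` and `c′` away from `d`, which takes the
    -- place of function extensionality.
    Ignores : C → (Coloring → ℕ) → Set
    Ignores d f = ∀ c c′ → (∀ d′ → d ≢ d′ → c d′ ≡ c′ d′) → f c ≡ f c′

    update-same : ∀ c e v → (c [ e ↦ v ]) e ≡ v
    update-same c e v rewrite dec-true (e ≟ e) refl = refl

    update-other : ∀ c e v {d} → e ≢ d → (c [ e ↦ v ]) d ≡ c d
    update-other c e v {d} e≢d rewrite dec-false (e ≟ d) e≢d = refl

    -- The level of `d` is uniform and independent of whatever ignores `d`. If `d` heads the list,
    -- its level is overwritten by each value in turn; otherwise the level of the head is fixed and
    -- the induction hypothesis is summed over it.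
    independent : ∀ es {d} → d ∈ es → (g : Fin k → ℕ) (f : Coloring → ℕ) → Ignores d f →
      k * ∑ (colorings es) (λ c → g (c d) * f c) ≡ ∑ (allFin k) g * ∑ (colorings es) f
    independent (e ∷ es) {d} d∈ g f ign with e ≟ d
    ... | yes refl = begin
      k * ∑ (colorings (d ∷ es)) (λ c → g (c d) * f c)
        ≡⟨ cong (k *_) (∑-colorings d es _) ⟩
      k * ∑ Cs (λ c → ∑ (allFin k) (λ v → g ((c [ d ↦ v ]) d) * f (c [ d ↦ v ])))
        ≡⟨ cong (k *_) (∑-cong Cs (λ c → ∑-cong (allFin k) (λ v →
             cong₂ _*_ (cong g (update-same c d v)) (ign _ _ (λ d′ → update-other c d v))))) ⟩
      k * ∑ Cs (λ c → ∑ (allFin k) (λ v → g v * f c))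
        ≡⟨ cong (k *_) (∑-cong Cs (λ c → ∑-distribʳ-* (allFin k) (f c) g)) ⟩
      k * ∑ Cs (λ c → ∑ (allFin k) g * f c)
        ≡⟨ ∑-distribˡ-* Cs k _ ⟨
      ∑ Cs (λ c → k * (∑ (allFin k) g * f c))
        ≡⟨ ∑-cong Cs (λ c → exchange k (∑ (allFin k) g) (f c)) ⟩
      ∑ Cs (λ c → ∑ (allFin k) g * (k * f c))
        ≡⟨ ∑-distribˡ-* Cs (∑ (allFin k) g) _ ⟩
      ∑ (allFin k) g * ∑ Cs (λ c → k * f c)
        ≡⟨ cong (∑ (allFin k) g *_) (∑-cong Cs (λ c → ∑-levels-const (f c))) ⟨
      ∑ (allFin k) g * ∑ Cs (λ c → ∑ (allFin k) (λ v → f c))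
        ≡⟨ cong (∑ (allFin k) g *_) (∑-cong Cs (λ c → ∑-cong (allFin k) (λ v →
             ign _ _ (λ d′ → update-other c d v)))) ⟨
      ∑ (allFin k) g * ∑ Cs (λ c → ∑ (allFin k) (λ v → f (c [ d ↦ v ])))
        ≡⟨ cong (∑ (allFin k) g *_) (∑-colorings d es f) ⟨
      ∑ (allFin k) g * ∑ (colorings (d ∷ es)) f ∎
      where
      open ≡-Reasoning
      Cs = colorings es
      exchange : ∀ a b c → a * (b * c) ≡ b * (a * c)
      exchange = solve-∀
    ... | no e≢d = begin
      k * ∑ (colorings (e ∷ es)) (λ c → g (c d) * f c)
        ≡⟨ cong (k *_) (∑-colorings e es _) ⟩
      k * ∑ Cs (λ c → ∑ (allFin k) (λ v → g ((c [ e ↦ v ]) d) * f (c [ e ↦ v ])))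
        ≡⟨ cong (k *_) (∑-cong Cs (λ c → ∑-cong (allFin k) (λ v →
             cong (λ u → g u * f (c [ e ↦ v ])) (update-other c e v e≢d)))) ⟩
      k * ∑ Cs (λ c → ∑ (allFin k) (λ v → g (c d) * f (c [ e ↦ v ])))
        ≡⟨ cong (k *_) (∑-swap Cs (allFin k) _) ⟩
      k * ∑ (allFin k) (λ v → ∑ Cs (λ c → g (c d) * f (c [ e ↦ v ])))
        ≡⟨ ∑-distribˡ-* (allFin k) k _ ⟨
      ∑ (allFin k) (λ v → k * ∑ Cs (λ c → g (c d) * f (c [ e ↦ v ])))
        ≡⟨ ∑-cong (allFin k) (λ v → independent es (tail d∈) g (λ c → f (c [ e ↦ v ])) (ign′ v)) ⟩
      ∑ (allFin k) (λ v → ∑ (allFin k) g * ∑ Cs (λ c → f (c [ e ↦ v ])))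
        ≡⟨ ∑-distribˡ-* (allFin k) (∑ (allFin k) g) _ ⟩
      ∑ (allFin k) g * ∑ (allFin k) (λ v → ∑ Cs (λ c → f (c [ e ↦ v ])))
        ≡⟨ cong (∑ (allFin k) g *_) (∑-swap Cs (allFin k) _) ⟨
      ∑ (allFin k) g * ∑ Cs (λ c → ∑ (allFin k) (λ v → f (c [ e ↦ v ])))
        ≡⟨ cong (∑ (allFin k) g *_) (∑-colorings e es f) ⟨
      ∑ (allFin k) g * ∑ (colorings (e ∷ es)) f ∎
      where
      open ≡-Reasoning
      Cs = colorings es
      tail : d ∈ e ∷ es → d ∈ es
      tail (here d≡e) = contradiction (sym d≡e) e≢d
      tail (there p)  = p
      ign′ : ∀ v → Ignores d (λ c → f (c [ e ↦ v ]))
      ign′ v c c′ h = ign _ _ λ d′ d≢d′ → agree d′ d≢d′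
        where
        agree : ∀ d′ → d ≢ d′ → (c [ e ↦ v ]) d′ ≡ (c′ [ e ↦ v ]) d′
        agree d′ d≢d′ with does (e ≟ d′)
        ... | true  = refl
        ... | false = h d′ d≢d′

    lowProduct : Fin k → List C → Coloring → ℕ
    lowProduct i D c = ∏ D (λ d → [ c d ≤ˡ i ])

    lowProduct-ignores : ∀ i {D d} → All (d ≢_) D → Ignores d (lowProduct i D)
    lowProduct-ignores i []        c c′ h = refl
    lowProduct-ignores i (d≢ ∷ ds) c c′ h =
      cong₂ (λ u v → [ u ≤ˡ i ] * v) (h _ d≢) (lowProduct-ignores i ds c c′ h)

    -- The indicator that `e` has level `i` and no cell of `D` lies above it. When `D` consists of
    -- the other cells of a block, this is the event that `e` is first in its block, ties included.
    weight : Fin k → C → List C → Coloring → ℕ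
    weight i e D c = [ does (c e Fin.≟ i) ] * lowProduct i D c

    module _ {es : List C} (complete : ∀ d → d ∈ es) (i : Fin k) where

      count-low : ∀ {D} → AllPairs _≢_ D →
        k ^ length D * ∑ (colorings es) (lowProduct i D) ≡ suc (toℕ i) ^ length D * length (colorings es)
      count-low []               =
        cong (1 *_) (≡.trans (∑-const (colorings es) 1) (*-identityʳ _))
      count-low {d ∷ D} (d∉ ∷ u) = begin
        k * k ^ length D * ∑ Cs (lowProduct i (d ∷ D))
          ≡⟨ eq k (k ^ length D) _ ⟩
        k ^ length D * (k * ∑ Cs (λ c → [ c d ≤ˡ i ] * lowProduct i D c))
          ≡⟨ cong (k ^ length D *_) (independent es (complete d) (λ v → [ v ≤ˡ i ]) _ (lowProduct-ignores i d∉)) ⟩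
        k ^ length D * (∑ (allFin k) (λ v → [ v ≤ˡ i ]) * ∑ Cs (lowProduct i D))
          ≡⟨ cong (λ z → k ^ length D * (z * ∑ Cs (lowProduct i D))) (∑-≤ˡ i) ⟩
        k ^ length D * (suc (toℕ i) * ∑ Cs (lowProduct i D))
          ≡⟨ eq′ (k ^ length D) (suc (toℕ i)) _ ⟩
        suc (toℕ i) * (k ^ length D * ∑ Cs (lowProduct i D))
          ≡⟨ cong (suc (toℕ i) *_) (count-low u) ⟩
        suc (toℕ i) * (suc (toℕ i) ^ length D * length Cs)
          ≡⟨ *-assoc (suc (toℕ i)) (suc (toℕ i) ^ length D) (length Cs) ⟨
        suc (toℕ i) * suc (toℕ i) ^ length D * length Cs ∎
        where
        open ≡-Reasoning
        Cs = colorings es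
        eq : ∀ a b c → a * b * c ≡ b * (a * c)
        eq = solve-∀
        eq′ : ∀ a b c → a * (b * c) ≡ b * (a * c)
        eq′ = solve-∀

      count-top : ∀ {e D} → AllPairs _≢_ (e ∷ D) →
        k ^ suc (length D) * ∑ (colorings es) (weight i e D) ≡ suc (toℕ i) ^ length D * length (colorings es)
      count-top {e} {D} (e∉ ∷ u) = begin
        k * k ^ length D * ∑ Cs (weight i e D)
          ≡⟨ eq k (k ^ length D) _ ⟩
        k ^ length D * (k * ∑ Cs (weight i e D))
          ≡⟨ cong (k ^ length D *_) (independent es (complete e) (λ v → [ does (v Fin.≟ i) ]) _ (lowProduct-ignores i e∉)) ⟩
        k ^ length D * (∑ (allFin k) (λ v → [ does (v Fin.≟ i) ]) * ∑ Cs (lowProduct i D))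
          ≡⟨ cong (λ z → k ^ length D * (z * ∑ Cs (lowProduct i D))) (≡.trans (∑-cong (allFin k) flip) (∑-delta i)) ⟩
        k ^ length D * (1 * ∑ Cs (lowProduct i D))
          ≡⟨ cong (k ^ length D *_) (*-identityˡ _) ⟩
        k ^ length D * ∑ Cs (lowProduct i D)
          ≡⟨ count-low u ⟩
        suc (toℕ i) ^ length D * length Cs ∎
        where
        open ≡-Reasoning
        Cs = colorings es
        eq : ∀ a b c → a * b * c ≡ b * (a * c)
        eq = solve-∀
        flip : ∀ v → [ does (v Fin.≟ i) ] ≡ [ does (i Fin.≟ v) ]
        flip v with v Fin.≟ i | i Fin.≟ v
        ... | yes _   | yes _   = refl
        ... | no _    | no _    = refl
        ... | yes v≡i | no i≢v  = contradiction (sym v≡i) i≢v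
        ... | no v≢i  | yes i≡v = contradiction (sym i≡v) v≢i

      -- A conditional probability: given the event `weight i e D`, the cells of `D′` lie at or
      -- below `i` with probability `(suc (toℕ i) / k) ^ length D′`. It is the quotient of two
      -- instances of `count-top`, for `D ++ D′` and for `D`.
      count-ratio : ∀ {e D D′} → AllPairs _≢_ (e ∷ D ++ D′) →
        k ^ length D′ * ∑ (colorings es) (λ c → weight i e D c * lowProduct i D′ c)
          ≡ suc (toℕ i) ^ length D′ * ∑ (colorings es) (weight i e D)
      count-ratio {e} {D} {D′} u = *-cancelˡ-≡ _ _ (k ^ suc (length D)) {{m^n≢0 k (suc (length D)) {{Fin.nonZeroIndex o}}}} (begin
        k ^ suc (length D) * (k ^ length D′ * ∑ Cs (λ c → weight i e D c * lowProduct i D′ c))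
          ≡⟨ *-assoc (k ^ suc (length D)) (k ^ length D′) _ ⟨
        k ^ suc (length D) * k ^ length D′ * ∑ Cs (λ c → weight i e D c * lowProduct i D′ c)
          ≡⟨ cong₂ _*_ (sym (^-distribˡ-+-* k (suc (length D)) (length D′))) (∑-cong Cs merge) ⟩
        k ^ suc (length D + length D′) * ∑ Cs (weight i e (D ++ D′))
          ≡⟨ cong (λ l → k ^ suc l * ∑ Cs (weight i e (D ++ D′))) (length-++ D) ⟨
        k ^ suc (length (D ++ D′)) * ∑ Cs (weight i e (D ++ D′))
          ≡⟨ count-top u ⟩
        i′ ^ length (D ++ D′) * length Cs
          ≡⟨ cong (λ l → i′ ^ l * length Cs) (≡.trans (length-++ D) (+-comm (length D) (length D′))) ⟩
        i′ ^ (length D′ + length D) * length Cs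
          ≡⟨ cong (_* length Cs) (^-distribˡ-+-* i′ (length D′) (length D)) ⟩
        i′ ^ length D′ * i′ ^ length D * length Cs
          ≡⟨ *-assoc (i′ ^ length D′) (i′ ^ length D) (length Cs) ⟩
        i′ ^ length D′ * (i′ ^ length D * length Cs)
          ≡⟨ cong (i′ ^ length D′ *_) (count-top (allPairs-++ˡ (e ∷ D) u)) ⟨
        i′ ^ length D′ * (k ^ suc (length D) * ∑ Cs (weight i e D))
          ≡⟨ eq (i′ ^ length D′) (k ^ suc (length D)) _ ⟩
        k ^ suc (length D) * (i′ ^ length D′ * ∑ Cs (weight i e D)) ∎)
        where
        open ≡-Reasoning
        Cs = colorings es
        i′ = suc (toℕ i)
        eq : ∀ a b c → a * (b * c) ≡ b * (a * c)
        eq = solve-∀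
        merge : ∀ c → weight i e D c * lowProduct i D′ c ≡ weight i e (D ++ D′) c
        merge c = ≡.trans (*-assoc [ does (c e Fin.≟ i) ] _ _)
          (cong ([ does (c e Fin.≟ i) ] *_) (sym (∏-++ D D′ (λ d → [ c d ≤ˡ i ]))))

  -- Boolean quantifiers over lists

  allB-∏ : ∀ {A : Set} (p : A → Bool) xs → ∏ xs (λ x → [ p x ]) ≡ [ allB p xs ]
  allB-∏ p []       = refl
  allB-∏ p (x ∷ xs) with p x
  ... | true  = ≡.trans (+-identityʳ _) (allB-∏ p xs)
  ... | false = refl

  allB⁺ : ∀ {A : Set} (p : A → Bool) xs → (∀ {x} → x ∈ xs → p x ≡ true) → allB p xs ≡ true
  allB⁺ p []       h = refl
  allB⁺ p (x ∷ xs) h rewrite h (here refl) = allB⁺ p xs (h ∘ there)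

  allB⁻ : ∀ {A : Set} (p : A → Bool) xs → allB p xs ≡ true → ∀ {x} → x ∈ xs → p x ≡ true
  allB⁻ p (x ∷ xs) h x∈ with p x in eq
  allB⁻ p (x ∷ xs) h (here refl) | true = eq
  allB⁻ p (x ∷ xs) h (there x∈)  | true = allB⁻ p xs h x∈

  allB-false : ∀ {A : Set} (p : A → Bool) xs → allB p xs ≡ false → ∃[ x ] (x ∈ xs × p x ≡ false)
  allB-false p (x ∷ xs) h with p x in eq
  ... | false = x , here refl , eq
  ... | true with allB-false p xs h
  ... | y , y∈ , q = y , there y∈ , q

  -- Steiner quasigroups

  Op : ℕ → Set
  Op n = Fin n → Fin n → Fin n

  Cell : ℕ → Set
  Cell n = Fin n × Fin n

  record IsSteiner {n} (F : Op n) : Set where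
    field
      idem : ∀ x → F x x ≡ x
      comm : ∀ x y → F x y ≡ F y x
      inv  : ∀ x y → F x (F x y) ≡ y

  others block : ∀ {n} → Op n → Fin n → Fin n → List (Cell n)
  others F x y = (y , x) ∷ (x , z) ∷ (z , x) ∷ (y , z) ∷ (z , y) ∷ []
    where z = F x y
  block F x y = (x , y) ∷ others F x y

  module _ {n} {F : Op n} (st : IsSteiner F) where

    open IsSteiner st

    inv′ : ∀ x y → F y (F x y) ≡ x
    inv′ x y = ≡.trans (cong (F y) (comm x y)) (inv y x)

    F≢ˡ : ∀ {x y} → x ≢ y → x ≢ F x y
    F≢ˡ {x} {y} x≢y p = x≢y (≡.trans (sym (idem x)) (≡.trans (cong (F x) p) (inv x y)))

    F≢ʳ : ∀ {x y} → x ≢ y → y ≢ F x y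
    F≢ʳ {x} {y} x≢y p = F≢ˡ (x≢y ∘ sym) (≡.trans p (comm x y))

    OnBlock : Fin n → Fin n → Fin n → Set
    OnBlock x y u = u ≡ x ⊎ u ≡ y ⊎ u ≡ F x y

    block-points : ∀ {x y a b} → (a , b) ∈ block F x y → ∀ {u} → OnBlock a b u → OnBlock x y u
    block-points {x} {y} p (inj₁ refl) = first p
      where
      first : ∀ {a b} → (a , b) ∈ block F x y → OnBlock x y a
      first (here refl)                                 = inj₁ refl
      first (there (here refl))                         = inj₂ (inj₁ refl)
      first (there (there (here refl)))                 = inj₁ refl
      first (there (there (there (here refl))))         = inj₂ (inj₂ refl)
      first (there (there (there (there (here refl))))) = inj₂ (inj₁ refl)
      first (there (there (there (there (there (here refl)))))) = inj₂ (inj₂ refl)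
    block-points {x} {y} p (inj₂ (inj₁ refl)) = second p
      where
      second : ∀ {a b} → (a , b) ∈ block F x y → OnBlock x y b
      second (here refl)                                 = inj₂ (inj₁ refl)
      second (there (here refl))                         = inj₁ refl
      second (there (there (here refl)))                 = inj₂ (inj₂ refl)
      second (there (there (there (here refl))))         = inj₁ refl
      second (there (there (there (there (here refl))))) = inj₂ (inj₂ refl)
      second (there (there (there (there (there (here refl)))))) = inj₂ (inj₁ refl)
    block-points {x} {y} p (inj₂ (inj₂ refl)) = third p
      where
      third : ∀ {a b} → (a , b) ∈ block F x y → OnBlock x y (F a b)
      third (here refl)                                 = inj₂ (inj₂ refl)
      third (there (here refl))                         = inj₂ (inj₂ (comm y x))
      third (there (there (here refl)))                 = inj₂ (inj₁ (inv x y))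
      third (there (there (there (here refl))))         = inj₂ (inj₁ (≡.trans (comm (F x y) x) (inv x y)))
      third (there (there (there (there (here refl))))) = inj₁ (inv′ x y)
      third (there (there (there (there (there (here refl)))))) = inj₁ (≡.trans (comm (F x y) y) (inv′ x y))

    -- A block can be recovered from any of its cells. With `block-points` this says that two blocks
    -- sharing a cell have the same points.
    block-sym : ∀ {x y a b} → (a , b) ∈ block F x y → OnBlock a b x × OnBlock a b y
    block-sym (here refl)                 = inj₁ refl , inj₂ (inj₁ refl)
    block-sym (there (here refl))         = inj₂ (inj₁ refl) , inj₁ refl
    block-sym {x} {y} (there (there (here refl)))         = inj₁ refl , inj₂ (inj₂ (sym (inv x y)))
    block-sym {x} {y} (there (there (there (here refl)))) =
      inj₂ (inj₁ refl) , inj₂ (inj₂ (sym (≡.trans (comm (F x y) x) (inv x y))))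
    block-sym {x} {y} (there (there (there (there (here refl))))) =
      inj₂ (inj₂ (sym (inv′ x y))) , inj₁ refl
    block-sym {x} {y} (there (there (there (there (there (here refl)))))) =
      inj₂ (inj₂ (sym (≡.trans (comm (F x y) y) (inv′ x y)))) , inj₂ (inj₁ refl)

    block-unique : ∀ {x y} → x ≢ y → AllPairs _≢_ (block F x y)
    block-unique {x} {y} x≢y =
        (≢₁ x≢y ∷ ≢₂ y≢z ∷ ≢₁ x≢z ∷ ≢₁ x≢y ∷ ≢₁ x≢z ∷ [])
      ∷ (≢₁ (x≢y ∘ sym) ∷ ≢₁ y≢z ∷ ≢₂ x≢z ∷ ≢₁ y≢z ∷ [])
      ∷ (≢₁ x≢z ∷ ≢₁ x≢y ∷ ≢₁ x≢z ∷ [])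
      ∷ (≢₁ (y≢z ∘ sym) ∷ ≢₂ x≢y ∷ [])
      ∷ (≢₁ y≢z ∷ [])
      ∷ [] ∷ []
      where
      x≢z = F≢ˡ x≢y
      y≢z = F≢ʳ x≢y
      ≢₁ : ∀ {a b c d : Fin n} → a ≢ b → (a , c) ≢ (b , d)
      ≢₁ a≢b p = a≢b (cong proj₁ p)
      ≢₂ : ∀ {a b c d : Fin n} → c ≢ d → (a , c) ≢ (b , d)
      ≢₂ c≢d p = c≢d (cong proj₂ p)

    -- A cell shared by two of the three blocks would identify their points and so put `w` on the
    -- block of `(x , y)` or make `x` and `y` equal. Disjointness is what makes all 18 levels
    -- independent.
    blocks-unique : ∀ {x y w} → x ≢ y → ¬ OnBlock x y w →
      AllPairs _≢_ (block F x y ++ block F x w ++ block F y w)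
    blocks-unique {x} {y} {w} x≢y w∉ =
      AllPairs.++⁺ (block-unique x≢y)
        (AllPairs.++⁺ (block-unique x≢w) (block-unique y≢w) (disjoint 2∥3))
        (disjoint λ p q → 1∥23 p (∈-++⁻ (block F x w) q))
      where
      x≢w : x ≢ w
      x≢w p = w∉ (inj₁ (sym p))
      y≢w : y ≢ w
      y≢w p = w∉ (inj₂ (inj₁ (sym p)))
      disjoint : ∀ {xs ys : List (Cell n)} → (∀ {d} → d ∈ xs → d ∈ ys → ⊥) →
                 All (λ d → All (d ≢_) ys) xs
      disjoint h = All.tabulate λ p → All.tabulate λ { q refl → h p q }
      2∥3 : ∀ {d} → d ∈ block F x w → d ∈ block F y w → ⊥
      2∥3 p q with block-points q (proj₁ (block-sym p))
      ... | inj₁ x≡y = x≢y x≡y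
      ... | inj₂ (inj₁ x≡w) = x≢w x≡w
      ... | inj₂ (inj₂ x≡) = w∉ (inj₂ (inj₂ (sym (≡.trans (comm x y) (≡.trans (cong (F y) x≡) (inv y w))))))
      1∥23 : ∀ {d} → d ∈ block F x y → d ∈ block F x w ⊎ d ∈ block F y w → ⊥
      1∥23 p (inj₁ q) = w∉ (block-points p (proj₂ (block-sym q)))
      1∥23 p (inj₂ q) = w∉ (block-points p (proj₂ (block-sym q)))

    -- For `w = F x y` the blocks of `(x , w)` and `(y , w)` have only cells of the block of
    -- `(x , y)`, so their levels are controlled once `(x , y)` is first in its block.
    block-⊆ˡ : ∀ {x y d} → d ∈ block F x (F x y) → d ∈ block F x y
    block-⊆ˡ {x} {y} p rewrite inv x y = go p
      where
      go : ∀ {d} → d ∈ _ → d ∈ _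
      go (here refl)                                 = there (there (here refl))
      go (there (here refl))                         = there (there (there (here refl)))
      go (there (there (here refl)))                 = here refl
      go (there (there (there (here refl))))         = there (here refl)
      go (there (there (there (there (here refl))))) = there (there (there (there (there (here refl)))))
      go (there (there (there (there (there (here refl)))))) = there (there (there (there (here refl))))

    block-⊆ʳ : ∀ {x y d} → d ∈ block F y (F x y) → d ∈ block F x y
    block-⊆ʳ {x} {y} p rewrite inv′ x y = go p
      where
      go : ∀ {d} → d ∈ _ → d ∈ _
      go (here refl)                                 = there (there (there (there (here refl))))
      go (there (here refl))                         = there (there (there (there (there (here refl)))))
      go (there (there (here refl)))                 = there (here refl)
      go (there (there (there (here refl))))         = here refl
      go (there (there (there (there (here refl))))) = there (there (there (here refl)))
      go (there (there (there (there (there (here refl)))))) = there (there (here refl))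

    -- Knowing one cell of the block reveals the whole triple: `t ↦ G a t` is an involution, so an
    -- equation at any of the six cells can be solved for `G x y`.
    block-determines : ∀ {G} → IsSteiner G → ∀ {x y a b} → (a , b) ∈ block F x y →
      F a b ≡ G a b → F x y ≡ G x y
    block-determines {G} sg {x} {y} = go
      where
      module G = IsSteiner sg
      back : ∀ {a b t} → G a t ≡ b → t ≡ G a b
      back {a} {b} {t} p = ≡.trans (sym (G.inv a t)) (cong (G a) p)
      go : ∀ {a b} → (a , b) ∈ block F x y → F a b ≡ G a b → F x y ≡ G x y
      go (here refl)                         h = h
      go (there (here refl))                 h = ≡.trans (comm x y) (≡.trans h (G.comm y x))
      go (there (there (here refl)))         h = back (≡.trans (sym h) (inv x y))
      go (there (there (there (here refl)))) h =
        back (≡.trans (G.comm x _) (≡.trans (sym h) (≡.trans (comm _ x) (inv x y))))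
      go (there (there (there (there (here refl))))) h =
        ≡.trans (back (≡.trans (sym h) (inv′ x y))) (G.comm y x)
      go (there (there (there (there (there (here refl)))))) h =
        ≡.trans (back (≡.trans (G.comm y _) (≡.trans (sym h) (≡.trans (comm _ y) (inv′ x y))))) (G.comm y x)

  -- Revealing a system in random order

  raise : ∀ {q p m P} a b L → b * m ≡ a * L → q ^ m * P ≤ p ^ m → (q ^ a) ^ L * P ^ b ≤ (p ^ a) ^ L
  raise {q} {p} {m} {P} a b L bm≡aL h = begin
    (q ^ a) ^ L * P ^ b ≡⟨ cong (_* P ^ b) (powers q) ⟨
    (q ^ m) ^ b * P ^ b ≡⟨ ^-distribʳ-* (q ^ m) P b ⟨
    (q ^ m * P) ^ b     ≤⟨ ^-monoˡ-≤ b h ⟩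
    (p ^ m) ^ b         ≡⟨ powers p ⟩
    (p ^ a) ^ L ∎
    where
    open ≤-Reasoning
    powers : ∀ x → (x ^ m) ^ b ≡ (x ^ a) ^ L
    powers x = ≡.trans (^-*-assoc x m b)
      (≡.trans (cong (x ^_) (≡.trans (*-comm m b) bm≡aL)) (sym (^-*-assoc x a L)))

  ∏-bound : ∀ {A : Set} (xs : List A) (u v f : A → ℕ) b → (∀ {x} → x ∈ xs → u x * f x ^ b ≤ v x) →
            ∏ xs u * ∏ xs f ^ b ≤ ∏ xs v
  ∏-bound xs u v f b h = begin
    ∏ xs u * ∏ xs f ^ b            ≡⟨ cong (∏ xs u *_) (∏-^ xs f b) ⟨
    ∏ xs u * ∏ xs (λ x → f x ^ b)  ≡⟨ ∏-distrib-* xs u _ ⟨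
    ∏ xs (λ x → u x * f x ^ b)     ≤⟨ ∏-mono-∈ xs h ⟩
    ∏ xs v ∎
    where open ≤-Reasoning

  -- The quotient `levelsUpper k n / levelsLower k` bounds the `k ^ 6`-th power of the geometric
  -- mean, over all colorings, of the number of candidates at one cell.
  levelsLower : ℕ → ℕ
  levelsLower k = ∏ (allFin k) (λ i → (k ^ 12) ^ (suc (toℕ i) ^ 5))

  levelsUpper : ℕ → ℕ → ℕ
  levelsUpper k n = ∏ (allFin k) (λ i → (suc (toℕ i) ^ 12 * (n + 3 * k ^ 12)) ^ (suc (toℕ i) ^ 5))

  module Reveal {n k : ℕ} (o : Fin k) where

    _≟ᶜ_ : DecidableEquality (Cell n)
    _≟ᶜ_ = ≡-dec Fin._≟_ Fin._≟_

    open Colorings _≟ᶜ_ o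

    cells : List (Cell n)
    cells = cartesianProduct (allFin n) (allFin n)

    cells-complete : ∀ d → d ∈ cells
    cells-complete (x , y) = ∈-cartesianProduct⁺ (∈-allFin x) (∈-allFin y)

    length-cells : length cells ≡ n * n
    length-cells = ≡.trans (lengths (allFin n) (allFin n)) (cong₂ _*_ (length-allFin n) (length-allFin n))
      where
      lengths : ∀ {A B : Set} (xs : List A) (ys : List B) → length (cartesianProduct xs ys) ≡ length xs * length ys
      lengths []       ys = refl
      lengths (x ∷ xs) ys =
        ≡.trans (length-++ (map (x ,_) ys)) (cong₂ _+_ (length-map (x ,_) ys) (lengths xs ys))

    Cs : List Coloring
    Cs = colorings cells

    -- w can still be the value of F at (x , y) when the cells are revealed by decreasing level.
    -- The value is known once a cell of the block of (x , y) has been revealed, and no revealed block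
    -- contains {x , w} or {y , w}; ties are resolved in favour of more candidates.
    available : Coloring → Op n → Cell n → Fin n → Bool
    available c F (x , y) w =
      if not (does (x Fin.≟ y)) ∧ allB (λ d → c d ≤ˡ c (x , y)) (others F x y)
      then allB (λ d → c d ≤ˡ c (x , y)) (block F x w ++ block F y w)
      else does (F x y Fin.≟ w)

    candidates : Coloring → Op n → Cell n → ℕ
    candidates c F e = ∑ (allFin n) (λ w → [ available c F e w ])

    levelOrder : Coloring → DecTotalOrder _ _ _
    levelOrder c = On.decTotalOrder (Flip.decTotalOrder ≤-decTotalOrder) (toℕ ∘ c)

    order : Coloring → List (Cell n)
    order c = Sort.sort (levelOrder c) cells

    order-↭ : ∀ c → order c ↭ cells
    order-↭ c = Sort.sort-↭ (levelOrder c) cells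

    split-sorted : ∀ {A : Set} {R : A → A → Set} pre {e : A} {post} → AllPairs R (pre ++ e ∷ post) → All (R e) post
    split-sorted []        (r ∷ _)  = r
    split-sorted (_ ∷ pre) (_ ∷ rs) = split-sorted pre rs

    ≤ˡ-false : ∀ (u v : Fin k) → (u ≤ˡ v) ≡ false → toℕ v < toℕ u
    ≤ˡ-false u v p = ≰⇒> λ u≤v → contradiction (≡.trans (sym (T-≡.to (<⇒<ᵇ (s≤s u≤v)))) p) λ ()
      where module T-≡ = Equivalence (T-≡ {toℕ u <ᵇ suc (toℕ v)})

    -- Sorting puts higher levels first but may order equal levels either way, so only a strictly
    -- higher level guarantees that a cell is known.
    higher-earlier : ∀ c pre {e post} → order c ≡ pre ++ e ∷ post → ∀ {d} → (c d ≤ˡ c e) ≡ false → d ∈ pre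
    higher-earlier c pre {e} {post} eq {d} p
      with ∈-++⁻ pre (subst (d ∈_) eq (∈-resp-↭ (↭-sym (order-↭ c)) (cells-complete d)))
    ... | inj₁ d∈             = d∈
    ... | inj₂ (here refl)    = contradiction (≤ˡ-false (c e) (c e) p) (<-irrefl refl)
    ... | inj₂ (there d∈post) = contradiction (≤ˡ-false (c d) (c e) p) (≤⇒≯ (All.lookup (split-sorted pre sorted) d∈post))
      where
      sorted : AllPairs (λ a b → toℕ (c b) ≤ toℕ (c a)) (pre ++ e ∷ post)
      sorted = subst (AllPairs _) eq
        (Sorted⇒AllPairs (DecTotalOrder.totalOrder (levelOrder c)) (Sort.sort-↗ (levelOrder c) cells))

    ≤ˡ-refl : ∀ (v : Fin k) → (v ≤ˡ v) ≡ true
    ≤ˡ-refl v = Equivalence.to T-≡ (<⇒<ᵇ (n<1+n (toℕ v)))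

    -- The hypothesis of `entropy`: the value in any `G` that agrees with `F` so far is among the
    -- candidates computed from `F`. On the diagonal, or once another cell of the block is known,
    -- the values of `F` and `G` coincide; otherwise no cell of the blocks through `w = G x y` can
    -- have been revealed at a higher level.
    branching : ∀ c pre {e post} → order c ≡ pre ++ e ∷ post → ∀ {F G} → IsSteiner F → IsSteiner G →
      All (λ (a , b) → F a b ≡ G a b) pre → available c F e (G (proj₁ e) (proj₂ e)) ≡ true
    branching c pre {x , y} eq {F} {G} sf sg agree
      with x Fin.≟ y
    ... | yes refl = dec-true (F x x Fin.≟ G x x) (≡.trans (IsSteiner.idem sf x) (sym (IsSteiner.idem sg x)))
    ... | no x≢y with allB (λ d → c d ≤ˡ c (x , y)) (others F x y) in first
    ... | false with allB-false (λ d → c d ≤ˡ c (x , y)) (others F x y) first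
    ... | d , d∈ , p =
          dec-true (F x y Fin.≟ G x y)
            (block-determines sf sg (there d∈) (All.lookup agree (higher-earlier c pre eq p)))
    branching c pre {x , y} eq {F} {G} sf sg agree | no x≢y | true =
      allB⁺ low (block F x w ++ block F y w) λ {d} d∈ → onBlocks d (∈-++⁻ (block F x w) d∈)
      where
      module F = IsSteiner sf
      module G = IsSteiner sg
      w = G x y
      low : Cell n → Bool
      low d = c d ≤ˡ c (x , y)
      onBlock : ∀ {d} → d ∈ block F x y → low d ≡ true
      onBlock (here refl) = ≤ˡ-refl (c (x , y))
      onBlock (there d∈)  = allB⁻ low (others F x y) first d∈
      onBlocks : ∀ d → d ∈ block F x w ⊎ d ∈ block F y w → low d ≡ true
      onBlocks d d∈ with low d in l
      onBlocks d d∈ | true = refl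
      -- A cell above the current level is known, so `F x w = G x w = y` and hence `w = F x y`. The
      -- cell then belongs to the block of `(x , y)`, where no level is higher: a contradiction.
      onBlocks d (inj₁ d∈) | false =
        ≡.trans (sym l) (onBlock (block-⊆ˡ sf (subst (λ v → d ∈ block F x v) w≡ d∈)))
        where
        w≡ : w ≡ F x y
        w≡ = ≡.trans (sym (F.inv x w)) (cong (F x)
          (≡.trans (block-determines sf sg d∈ (All.lookup agree (higher-earlier c pre eq l))) (G.inv x y)))
      onBlocks d (inj₂ d∈) | false =
        ≡.trans (sym l) (onBlock (block-⊆ʳ sf (subst (λ v → d ∈ block F y v) w≡ d∈)))
        where
        w≡ : w ≡ F x y
        w≡ = ≡.trans (≡.trans (sym (F.inv y w)) (cong (F y)
          (≡.trans (block-determines sf sg d∈ (All.lookup agree (higher-earlier c pre eq l))) (inv′ sg x y)))) (F.comm y x)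

    entropy-order : ∀ c (S : List (Op n)) → All IsSteiner S →
      AllPairs (λ F G → ¬ (∀ x y → F x y ≡ G x y)) S →
      length S ^ length S ≤ ∏ S (λ F → ∏ cells (candidates c F))
    entropy-order c S steiner distinct = ≤-trans
      (entropy (λ F (x , y) → F x y) (available c) (order c) S
        (allPairs-map (λ _ _ ¬agree agree → ¬agree λ x y → All.lookup agree (∈-resp-↭ (↭-sym (order-↭ c)) (cells-complete (x , y))))
          steiner distinct)
        (λ pre eq F∈ G∈ → branching c pre eq (All.lookup steiner F∈) (All.lookup steiner G∈)))
      (≤-reflexive (∏-cong S (λ F → ∏-↭ (candidates c F) (order-↭ c))))

    module CellBound {F : Op n} (sf : IsSteiner F) {x y : Fin n} (x≢y : x ≢ y) where

      e : Cell n
      e = x , y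

      rest : Fin n → List (Cell n)
      rest w = block F x w ++ block F y w

      free : Fin k → Coloring → ℕ
      free i c = ∑ (allFin n) (λ w → lowProduct i (rest w) c)

      wt : Fin k → Coloring → ℕ
      wt i = weight i e (others F x y)

      -- At most one exponent is 1, at the level of `e` and only when `e` is first in its block;
      -- otherwise the product is empty and there is one candidate. This separates the levels, so
      -- that Jensen's inequality can be applied to each with the weight `wt i`.
      candidates-∏ : ∀ c → candidates c F e ≡ ∏ (allFin k) (λ i → free i c ^ wt i c)
      candidates-∏ c = sym (begin
        ∏ (allFin k) (λ i → free i c ^ wt i c)
          ≡⟨ ∏-cong (allFin k) (λ i → ≡.trans (cong (free i c ^_) (*-comm [ does (c e Fin.≟ i) ] _))
               (sym (^-*-assoc (free i c) (lowProduct i (others F x y) c) _))) ⟩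
        ∏ (allFin k) (λ i → (free i c ^ lowProduct i (others F x y) c) ^ [ does (c e Fin.≟ i) ])
          ≡⟨ ∏-delta (c e) (λ i → free i c ^ lowProduct i (others F x y) c) ⟩
        free (c e) c ^ lowProduct (c e) (others F x y) c
          ≡⟨ cong₂ _^_ (∑-cong (allFin n) (λ w → allB-∏ low (rest w))) (allB-∏ low (others F x y)) ⟩
        ∑ (allFin n) (λ w → [ allB low (rest w) ]) ^ [ allB low (others F x y) ]
          ≡⟨ cases ⟩
        candidates c F e ∎)
        where
        open ≡-Reasoning
        low : Cell n → Bool
        low d = c d ≤ˡ c e
        cases : ∑ (allFin n) (λ w → [ allB low (rest w) ]) ^ [ allB low (others F x y) ] ≡ candidates c F e
        cases rewrite dec-false (x Fin.≟ y) x≢y with allB low (others F x y)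
        ... | true  = ^-identityʳ _
        ... | false = sym (∑-delta (F x y))

      lowProduct≤1 : ∀ i D c → lowProduct i D c ≤ 1
      lowProduct≤1 i []      c = ≤-refl
      lowProduct≤1 i (d ∷ D) c with c d ≤ˡ i
      ... | true  = ≤-trans (≤-reflexive (+-identityʳ _)) (lowProduct≤1 i D c)
      ... | false = z≤n

      q : ℕ
      q = k ^ 12

      -- Marks the three points on the block, where `blocks-unique` fails and the probability is
      -- bounded by 1 instead.
      hits : Fin n → ℕ
      hits w = [ does (x Fin.≟ w) ] + ([ does (y Fin.≟ w) ] + [ does (F x y Fin.≟ w) ])

      hit : ∀ {w} → OnBlock sf x y w → 1 ≤ hits w
      hit (inj₁ refl) rewrite dec-true (x Fin.≟ x) refl = s≤s z≤n
      hit (inj₂ (inj₁ refl)) rewrite dec-true (y Fin.≟ y) refl = m≤n+m 1 _ ⟨ ≤-trans ⟩ +-monoʳ-≤ _ (s≤s z≤n)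
      hit (inj₂ (inj₂ refl)) rewrite dec-true (F x y Fin.≟ F x y) refl =
        m≤n+m 1 [ does (y Fin.≟ F x y) ] ⟨ ≤-trans ⟩ m≤n+m _ [ does (x Fin.≟ F x y) ]

      onBlock? : ∀ w → Dec (OnBlock sf x y w)
      onBlock? w = (w Fin.≟ x) ⊎-dec ((w Fin.≟ y) ⊎-dec (w Fin.≟ F x y))

      free-term : ∀ i w →
        q * ∑ Cs (λ c → wt i c * lowProduct i (rest w) c) ≤ (suc (toℕ i) ^ 12 + hits w * q) * ∑ Cs (wt i)
      free-term i w with onBlock? w
      ... | no w∉ = begin
        q * ∑ Cs (λ c → wt i c * lowProduct i (rest w) c)
          ≡⟨ count-ratio {cells} cells-complete i {e} {others F x y} {rest w} (blocks-unique sf x≢y w∉) ⟩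
        suc (toℕ i) ^ 12 * ∑ Cs (wt i)
          ≤⟨ *-monoˡ-≤ (∑ Cs (wt i)) (m≤m+n (suc (toℕ i) ^ 12) (hits w * q)) ⟩
        (suc (toℕ i) ^ 12 + hits w * q) * ∑ Cs (wt i) ∎
        where open ≤-Reasoning
      ... | yes w∈ = begin
        q * ∑ Cs (λ c → wt i c * lowProduct i (rest w) c)
          ≤⟨ *-monoʳ-≤ q (∑-mono Cs (λ c → ≤-trans (*-monoʳ-≤ (wt i c) (lowProduct≤1 i (rest w) c)) (≤-reflexive (*-identityʳ (wt i c))))) ⟩
        q * ∑ Cs (wt i)
          ≤⟨ *-monoˡ-≤ (∑ Cs (wt i)) (≤-trans (≤-trans (≤-reflexive (sym (*-identityˡ q))) (*-monoˡ-≤ q (hit w∈))) (m≤n+m (hits w * q) (suc (toℕ i) ^ 12))) ⟩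
        (suc (toℕ i) ^ 12 + hits w * q) * ∑ Cs (wt i) ∎
        where open ≤-Reasoning

      ∑-hits : ∑ (allFin n) hits ≡ 3
      ∑-hits = begin
        ∑ (allFin n) hits
          ≡⟨ ∑-distrib-+ (allFin n) (λ w → [ does (x Fin.≟ w) ]) _ ⟩
        ∑ (allFin n) (λ w → [ does (x Fin.≟ w) ]) + ∑ (allFin n) (λ w → [ does (y Fin.≟ w) ] + [ does (F x y Fin.≟ w) ])
          ≡⟨ cong₂ _+_ (∑-delta x) (∑-distrib-+ (allFin n) (λ w → [ does (y Fin.≟ w) ]) _) ⟩
        1 + (∑ (allFin n) (λ w → [ does (y Fin.≟ w) ]) + ∑ (allFin n) (λ w → [ does (F x y Fin.≟ w) ]))
          ≡⟨ cong suc (cong₂ _+_ (∑-delta y) (∑-delta (F x y))) ⟩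
        3 ∎
        where open ≡-Reasoning

      free-total : ∀ i → q * ∑ Cs (λ c → wt i c * free i c) ≤ (suc (toℕ i) ^ 12 * (n + 3 * q)) * ∑ Cs (wt i)
      free-total i = begin
        q * ∑ Cs (λ c → wt i c * free i c)
          ≡⟨ cong (q *_) (∑-cong Cs (λ c → sym (∑-distribˡ-* (allFin n) (wt i c) _))) ⟩
        q * ∑ Cs (λ c → ∑ (allFin n) (λ w → wt i c * lowProduct i (rest w) c))
          ≡⟨ cong (q *_) (∑-swap Cs (allFin n) _) ⟩
        q * ∑ (allFin n) (λ w → ∑ Cs (λ c → wt i c * lowProduct i (rest w) c))
          ≡⟨ ∑-distribˡ-* (allFin n) q _ ⟨
        ∑ (allFin n) (λ w → q * ∑ Cs (λ c → wt i c * lowProduct i (rest w) c))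
          ≤⟨ ∑-mono (allFin n) (free-term i) ⟩
        ∑ (allFin n) (λ w → (j + hits w * q) * ∑ Cs (wt i))
          ≡⟨ ∑-distribʳ-* (allFin n) (∑ Cs (wt i)) _ ⟩
        ∑ (allFin n) (λ w → j + hits w * q) * ∑ Cs (wt i)
          ≤⟨ *-monoˡ-≤ (∑ Cs (wt i)) total ⟩
        j * (n + 3 * q) * ∑ Cs (wt i) ∎
        where
        open ≤-Reasoning
        j = suc (toℕ i) ^ 12
        total : ∑ (allFin n) (λ w → j + hits w * q) ≤ j * (n + 3 * q)
        total = begin
          ∑ (allFin n) (λ w → j + hits w * q)
            ≡⟨ ∑-distrib-+ (allFin n) (const j) _ ⟩
          ∑ (allFin n) (const j) + ∑ (allFin n) (λ w → hits w * q)
            ≡⟨ cong₂ _+_ (∑-const (allFin n) j) (∑-distribʳ-* (allFin n) q hits) ⟩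
          length (allFin n) * j + ∑ (allFin n) hits * q
            ≡⟨ cong₂ (λ a b → a * j + b * q) (length-allFin n) ∑-hits ⟩
          n * j + 3 * q
            -- Enlarging `3 * q` by the factor `j` makes `n + 3 * q` a common factor of all levels.
            ≤⟨ +-mono-≤ (≤-reflexive (*-comm n j)) (m≤n*m (3 * q) j {{m^n≢0 (suc (toℕ i)) 12}}) ⟩
          j * n + j * (3 * q)
            ≡⟨ *-distribˡ-+ j n (3 * q) ⟨
          j * (n + 3 * q) ∎

      cell-bound : levelsLower k ^ length Cs * ∏ Cs (λ c → candidates c F e) ^ (k ^ 6) ≤ levelsUpper k n ^ length Cs
      cell-bound = begin
        levelsLower k ^ L * ∏ Cs (λ c → candidates c F e) ^ (k ^ 6)
          ≡⟨ cong₂ (λ a b → a * b ^ (k ^ 6)) (sym (∏-^ (allFin k) _ L))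
               (≡.trans (∏-cong Cs candidates-∏) (∏-swap Cs (allFin k) _)) ⟩
        ∏ (allFin k) (λ i → ((k ^ 12) ^ (suc (toℕ i) ^ 5)) ^ L) * ∏ (allFin k) (λ i → ∏ Cs (λ c → free i c ^ wt i c)) ^ (k ^ 6)
          ≤⟨ ∏-bound (allFin k) _ _ _ (k ^ 6) (λ {i} _ → level i) ⟩
        ∏ (allFin k) (λ i → ((suc (toℕ i) ^ 12 * (n + 3 * k ^ 12)) ^ (suc (toℕ i) ^ 5)) ^ L)
          ≡⟨ ∏-^ (allFin k) _ L ⟩
        levelsUpper k n ^ L ∎
        where
        open ≤-Reasoning
        L = length Cs
        level : ∀ i → ((k ^ 12) ^ (suc (toℕ i) ^ 5)) ^ L * ∏ Cs (λ c → free i c ^ wt i c) ^ (k ^ 6)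
                      ≤ ((suc (toℕ i) ^ 12 * (n + 3 * k ^ 12)) ^ (suc (toℕ i) ^ 5)) ^ L
        -- Jensen's inequality has the total weight as exponent. By `count-top`, `k ^ 6` times this
        -- weight is `suc (toℕ i) ^ 5 * L`, which is how `raise` replaces it by explicit exponents.
        level i = raise {q = k ^ 12} {p = suc (toℕ i) ^ 12 * (n + 3 * k ^ 12)} (suc (toℕ i) ^ 5) (k ^ 6) L
          (count-top {cells} cells-complete i (block-unique sf x≢y))
          (amgm-bound Cs (wt i) (free i) (suc (toℕ i) ^ 12 * (n + 3 * k ^ 12)) (k ^ 12) (free-total i))

    cell-bound : ∀ {F} → IsSteiner F → ∀ d →
      levelsLower k ^ length Cs * ∏ Cs (λ c → candidates c F d) ^ (k ^ 6) ≤ levelsUpper k n ^ length Cs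
    cell-bound {F} sf (x , y) = decide (x Fin.≟ y)
      where
      decide : Dec (x ≡ y) →
        levelsLower k ^ length Cs * ∏ Cs (λ c → candidates c F (x , y)) ^ (k ^ 6) ≤ levelsUpper k n ^ length Cs
      decide (no x≢y)   = CellBound.cell-bound sf x≢y
      -- A diagonal cell is known by idempotence and has one candidate, so it only needs the lower
      -- product not to exceed the upper one.
      decide (yes refl) = begin
        levelsLower k ^ length Cs * ∏ Cs (λ c → candidates c F (x , x)) ^ (k ^ 6)
          ≡⟨ cong (λ a → levelsLower k ^ length Cs * a ^ (k ^ 6))
               (≡.trans (∏-cong Cs one) (≡.trans (∏-const Cs 1) (^-zeroˡ (length Cs)))) ⟩
        levelsLower k ^ length Cs * 1 ^ (k ^ 6)
          ≡⟨ ≡.trans (cong (levelsLower k ^ length Cs *_) (^-zeroˡ (k ^ 6))) (*-identityʳ _) ⟩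
        levelsLower k ^ length Cs
          ≤⟨ ^-monoˡ-≤ (length Cs) (∏-mono (allFin k) λ i → ^-monoˡ-≤ (suc (toℕ i) ^ 5) (lower≤upper i (k ^ 12))) ⟩
        levelsUpper k n ^ length Cs ∎
        where
        open ≤-Reasoning
        one : ∀ c → candidates c F (x , x) ≡ 1
        one c rewrite dec-true (x Fin.≟ x) refl = ∑-delta (F x x)
        lower≤upper : ∀ i q → q ≤ suc (toℕ i) ^ 12 * (n + 3 * q)
        lower≤upper i q = ≤-trans (≤-trans (m≤n*m q 3) (m≤n+m (3 * q) n))
          (m≤n*m (n + 3 * q) (suc (toℕ i) ^ 12) {{m^n≢0 (suc (toℕ i)) 12}})

    -- The entropy inequalities of all colorings are multiplied, and exchanging the products leaves
    -- for each system and each cell a product over colorings, bounded by `cell-bound`. Neither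
    -- bound depends on the system, so the exponents `length S` and `length Cs` cancel.
    counting-bound : ∀ (S : List (Op n)) → All IsSteiner S →
      AllPairs (λ F G → ¬ (∀ x y → F x y ≡ G x y)) S →
      length S ^ (k ^ 6) * levelsLower k ^ (n * n) ≤ levelsUpper k n ^ (n * n)
    -- An empty list is separate because the root with exponent `length S` requires a nonzero
    -- exponent.
    counting-bound [] _ _ = subst (λ z → z * levelsLower k ^ (n * n) ≤ levelsUpper k n ^ (n * n)) (sym (zero-power (k ^ 6) {{m^n≢0 k 6 {{Fin.nonZeroIndex o}}}})) z≤n
      where
      zero-power : ∀ m .{{_ : NonZero m}} → 0 ^ m ≡ 0
      zero-power (suc m) = refl
    counting-bound S@(_ ∷ _) steiner distinct =
      ^-cancelʳ-≤ s (^-cancelʳ-≤ L {{L≢0}} (begin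
        ((s ^ b * U ^ (n * n)) ^ s) ^ L
          ≡⟨ cong (λ E → ((s ^ b * U ^ E) ^ s) ^ L) length-cells ⟨
        ((s ^ b * U ^ E) ^ s) ^ L
          ≡⟨ rearrange s b U E L ⟩
        ((U ^ L) ^ E) ^ s * ((s ^ s) ^ L) ^ b
          ≤⟨ *-monoʳ-≤ (((U ^ L) ^ E) ^ s) (^-monoˡ-≤ b total) ⟩
        ((U ^ L) ^ E) ^ s * ∏ S (λ F → ∏ cells (λ d → ∏ Cs (λ c → candidates c F d))) ^ b
          ≡⟨ cong (_* ∏ S (λ F → ∏ cells (λ d → ∏ Cs (λ c → candidates c F d))) ^ b) (∏-const S ((U ^ L) ^ E)) ⟨
        ∏ S (const ((U ^ L) ^ E)) * ∏ S (λ F → ∏ cells (λ d → ∏ Cs (λ c → candidates c F d))) ^ b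
          ≤⟨ ∏-bound S (const ((U ^ L) ^ E)) (const ((V ^ L) ^ E)) (λ F → ∏ cells (λ d → ∏ Cs (λ c → candidates c F d))) b (λ {F} F∈ → perSystem F (All.lookup steiner F∈)) ⟩
        ∏ S (const ((V ^ L) ^ E))
          ≡⟨ ∏-const S ((V ^ L) ^ E) ⟩
        ((V ^ L) ^ E) ^ s
          ≡⟨ rearrange′ V L E s ⟩
        ((V ^ E) ^ s) ^ L
          ≡⟨ cong (λ E → ((V ^ E) ^ s) ^ L) length-cells ⟩
        ((V ^ (n * n)) ^ s) ^ L ∎))
      where
      open ≤-Reasoning
      s = length S
      b = k ^ 6
      U = levelsLower k
      V = levelsUpper k n
      E = length cells
      L = length Cs
      L≢0 : NonZero L
      L≢0 = subst NonZero (sym (length-colorings cells)) (m^n≢0 k (length cells) {{Fin.nonZeroIndex o}})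
      rearrange′ : ∀ V L E s → ((V ^ L) ^ E) ^ s ≡ ((V ^ E) ^ s) ^ L
      rearrange′ V L E s =
        ≡.trans (^-*-assoc (V ^ L) E s)
          (≡.trans (^-*-assoc V L (E * s))
            (≡.trans (cong (V ^_) (*-comm L (E * s)))
              (≡.trans (sym (^-*-assoc V (E * s) L)) (cong (_^ L) (sym (^-*-assoc V E s))))))
      rearrange : ∀ s b U E L → ((s ^ b * U ^ E) ^ s) ^ L ≡ ((U ^ L) ^ E) ^ s * ((s ^ s) ^ L) ^ b
      rearrange s b U E L =
        ≡.trans (cong (_^ L) (^-distribʳ-* (s ^ b) (U ^ E) s))
          (≡.trans (^-distribʳ-* ((s ^ b) ^ s) ((U ^ E) ^ s) L)
            (≡.trans (*-comm (((s ^ b) ^ s) ^ L) _)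
              (cong₂ _*_ (sym (rearrange′ U L E s)) (sym (rearrange″ s b L)))))
        where
        rearrange″ : ∀ s b L → ((s ^ s) ^ L) ^ b ≡ ((s ^ b) ^ s) ^ L
        rearrange″ s b L =
          ≡.trans (^-*-assoc (s ^ s) L b)
            (≡.trans (cong ((s ^ s) ^_) (*-comm L b))
              (≡.trans (sym (^-*-assoc (s ^ s) b L))
                (cong (_^ L) (≡.trans (^-*-assoc s s b) (≡.trans (cong (s ^_) (*-comm s b)) (sym (^-*-assoc s b s)))))))
      total : (s ^ s) ^ L ≤ ∏ S (λ F → ∏ cells (λ d → ∏ Cs (λ c → candidates c F d)))
      total = begin
        (s ^ s) ^ L
          ≡⟨ ∏-const Cs (s ^ s) ⟨
        ∏ Cs (const (s ^ s))
          ≤⟨ ∏-mono Cs (λ c → entropy-order c S steiner distinct) ⟩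
        ∏ Cs (λ c → ∏ S (λ F → ∏ cells (candidates c F)))
          ≡⟨ ∏-swap Cs S _ ⟩
        ∏ S (λ F → ∏ Cs (λ c → ∏ cells (candidates c F)))
          ≡⟨ ∏-cong S (λ F → ∏-swap Cs cells _) ⟩
        ∏ S (λ F → ∏ cells (λ d → ∏ Cs (λ c → candidates c F d))) ∎
      perSystem : ∀ F → IsSteiner F →
        (U ^ L) ^ E * ∏ cells (λ d → ∏ Cs (λ c → candidates c F d)) ^ b ≤ (V ^ L) ^ E
      perSystem F sf = begin
        (U ^ L) ^ E * ∏ cells (λ d → ∏ Cs (λ c → candidates c F d)) ^ b
          ≡⟨ cong (_* ∏ cells (λ d → ∏ Cs (λ c → candidates c F d)) ^ b) (∏-const cells (U ^ L)) ⟨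
        ∏ cells (const (U ^ L)) * ∏ cells (λ d → ∏ Cs (λ c → candidates c F d)) ^ b
          ≤⟨ ∏-bound cells _ (const (V ^ L)) _ b (λ {d} _ → cell-bound sf d) ⟩
        ∏ cells (const (V ^ L))
          ≡⟨ ∏-const cells (V ^ L) ⟩
        (V ^ L) ^ E ∎

  -- From Steiner triple systems to Steiner quasigroups

  data _∈ₜ_ {n} (w : Fin n) : Triple n → Set where
    is₁ : ∀ {b c} → w ∈ₜ (w , b , c)
    is₂ : ∀ {a c} → w ∈ₜ (a , w , c)
    is₃ : ∀ {a b} → w ∈ₜ (a , b , w)

  Sorted : ∀ {n} → Triple n → Set
  Sorted (a , b , c) = a <ᶠ b × b <ᶠ c

  =ᶠ⇒≡ : ∀ {n} {x y : Fin n} → (x =ᶠ y) ≡ true → x ≡ y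
  =ᶠ⇒≡ {x = x} {y} p = Fin.toℕ-injective (≡ᵇ⇒≡ (toℕ x) (toℕ y) (Equivalence.from T-≡ p))

  =ᶠ-refl : ∀ {n} (x : Fin n) → (x =ᶠ x) ≡ true
  =ᶠ-refl x = Equivalence.to T-≡ (≡⇒≡ᵇ (toℕ x) (toℕ x) refl)

  ∋ᵗ⇒∈ₜ : ∀ {n} {w : Fin n} t → (t ∋ᵗ w) ≡ true → w ∈ₜ t
  ∋ᵗ⇒∈ₜ {w = w} (a , b , c) p with w =ᶠ a in eq₁ | w =ᶠ b in eq₂ | w =ᶠ c in eq₃
  ... | true  | _     | _    with refl ← =ᶠ⇒≡ {x = w} eq₁ = is₁
  ... | false | true  | _    with refl ← =ᶠ⇒≡ {x = w} eq₂ = is₂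
  ... | false | false | true with refl ← =ᶠ⇒≡ {x = w} eq₃ = is₃

  ∈ₜ⇒∋ᵗ : ∀ {n} {w : Fin n} {t} → w ∈ₜ t → (t ∋ᵗ w) ≡ true
  ∈ₜ⇒∋ᵗ {w = w} is₁ rewrite =ᶠ-refl w = refl
  ∈ₜ⇒∋ᵗ {w = w} {a , _ , c} is₂ rewrite =ᶠ-refl w = ∨-zeroʳ (w =ᶠ a)
  ∈ₜ⇒∋ᵗ {w = w} {a , b , _} is₃ rewrite =ᶠ-refl w | ∨-zeroʳ (w =ᶠ b) = ∨-zeroʳ (w =ᶠ a)

  countB-zero : ∀ {A : Set} (p : A → Bool) xs → countB p xs ≡ 0 → ∀ {x} → x ∈ xs → p x ≢ true
  countB-zero p (x ∷ xs) h x∈ px with p x in eq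
  countB-zero p (x ∷ xs) h (here refl) px | false = contradiction (≡.trans (sym px) eq) λ ()
  countB-zero p (x ∷ xs) h (there x∈)  px | false = countB-zero p xs h x∈ px

  countB-exists : ∀ {A : Set} (p : A → Bool) xs → countB p xs ≡ 1 → ∃[ x ] (x ∈ xs × p x ≡ true)
  countB-exists p (x ∷ xs) h with p x in eq
  ... | true  = x , here refl , eq
  ... | false with countB-exists p xs h
  ... | y , y∈ , py = y , there y∈ , py

  countB-unique : ∀ {A : Set} (p : A → Bool) xs → countB p xs ≡ 1 →
    ∀ {x y} → x ∈ xs → y ∈ xs → p x ≡ true → p y ≡ true → x ≡ y
  countB-unique p (x ∷ xs) h x∈ y∈ px py with p x in eq
  countB-unique p (x ∷ xs) h (here refl) (here refl) px py | _    = refl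
  countB-unique p (x ∷ xs) h (here refl) (there y∈)  px py | true = contradiction py (countB-zero p xs (suc-injective h) y∈)
  countB-unique p (x ∷ xs) h (there x∈)  y∈          px py | true = contradiction px (countB-zero p xs (suc-injective h) x∈)
  countB-unique p (x ∷ xs) h (here refl) (there y∈)  px py | false = contradiction (≡.trans (sym px) eq) λ ()
  countB-unique p (x ∷ xs) h (there x∈)  (here refl) px py | false = contradiction (≡.trans (sym py) eq) λ ()
  countB-unique p (x ∷ xs) h (there x∈)  (there y∈)  px py | false = countB-unique p xs h x∈ y∈ px py

  third : ∀ {n} {x y : Fin n} {t} → Sorted t → x ∈ₜ t → y ∈ₜ t → x ≢ y →
    ∃[ z ] (z ∈ₜ t × x ≢ z × y ≢ z × (∀ {w} → w ∈ₜ t → x ≢ w → y ≢ w → w ≡ z))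
  third (a<b , b<c) is₁ is₁ x≢y = contradiction refl x≢y
  third (a<b , b<c) is₂ is₂ x≢y = contradiction refl x≢y
  third (a<b , b<c) is₃ is₃ x≢y = contradiction refl x≢y
  third (a<b , b<c) is₁ is₂ x≢y = _ , is₃ , Fin.<⇒≢ (Fin.<-trans a<b b<c) , Fin.<⇒≢ b<c ,
    λ { is₁ p q → contradiction refl p ; is₂ p q → contradiction refl q ; is₃ _ _ → refl }
  third (a<b , b<c) is₂ is₁ x≢y = _ , is₃ , Fin.<⇒≢ b<c , Fin.<⇒≢ (Fin.<-trans a<b b<c) ,
    λ { is₁ p q → contradiction refl q ; is₂ p q → contradiction refl p ; is₃ _ _ → refl }
  third (a<b , b<c) is₁ is₃ x≢y = _ , is₂ , Fin.<⇒≢ a<b , Fin.<⇒≢ b<c ∘ sym ,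
    λ { is₁ p q → contradiction refl p ; is₃ p q → contradiction refl q ; is₂ _ _ → refl }
  third (a<b , b<c) is₃ is₁ x≢y = _ , is₂ , Fin.<⇒≢ b<c ∘ sym , Fin.<⇒≢ a<b ,
    λ { is₁ p q → contradiction refl q ; is₃ p q → contradiction refl p ; is₂ _ _ → refl }
  third (a<b , b<c) is₂ is₃ x≢y = _ , is₁ , Fin.<⇒≢ a<b ∘ sym , Fin.<⇒≢ (Fin.<-trans a<b b<c) ∘ sym ,
    λ { is₂ p q → contradiction refl p ; is₃ p q → contradiction refl q ; is₁ _ _ → refl }
  third (a<b , b<c) is₃ is₂ x≢y = _ , is₁ , Fin.<⇒≢ (Fin.<-trans a<b b<c) ∘ sym , Fin.<⇒≢ a<b ∘ sym ,
    λ { is₂ p q → contradiction refl q ; is₃ p q → contradiction refl p ; is₁ _ _ → refl }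

  -- Each of the three points occupies some position of `t`; every assignment of positions except
  -- the identity contradicts one of the two orders.
  sorted-determined : ∀ {n} {a b c : Fin n} {t} → Sorted (a , b , c) → Sorted t →
    a ∈ₜ t → b ∈ₜ t → c ∈ₜ t → (a , b , c) ≡ t
  sorted-determined _ _ is₁ is₂ is₃ = refl
  sorted-determined (p , q) _ is₁ is₁ _   = contradiction p (Fin.<-irrefl refl)
  sorted-determined (p , q) _ is₂ is₂ _   = contradiction p (Fin.<-irrefl refl)
  sorted-determined (p , q) _ is₃ is₃ _   = contradiction p (Fin.<-irrefl refl)
  sorted-determined (p , q) _ is₁ is₂ is₁ = contradiction (Fin.<-trans p q) (Fin.<-irrefl refl)
  sorted-determined (p , q) _ is₁ is₂ is₂ = contradiction q (Fin.<-irrefl refl)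
  sorted-determined (p , q) (r , s) is₁ is₃ is₁ = contradiction (Fin.<-trans p q) (Fin.<-irrefl refl)
  sorted-determined (p , q) (r , s) is₁ is₃ is₂ = contradiction q (Fin.<-asym s)
  sorted-determined (p , q) (r , s) is₁ is₃ is₃ = contradiction q (Fin.<-irrefl refl)
  sorted-determined (p , q) (r , s) is₂ is₁ _   = contradiction p (Fin.<-asym r)
  sorted-determined (p , q) (r , s) is₂ is₃ is₁ = contradiction q (Fin.<-asym (Fin.<-trans r s))
  sorted-determined (p , q) (r , s) is₂ is₃ is₂ = contradiction q (Fin.<-asym s)
  sorted-determined (p , q) (r , s) is₂ is₃ is₃ = contradiction q (Fin.<-irrefl refl)
  sorted-determined (p , q) (r , s) is₃ is₁ _   = contradiction p (Fin.<-asym (Fin.<-trans r s))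
  sorted-determined (p , q) (r , s) is₃ is₂ _   = contradiction p (Fin.<-asym s)

  module Quasigroup {n} (T : List (Triple n)) (sorted : ∀ {t} → t ∈ T → Sorted t) (sts : isSTS T ≡ true) where

    private
      count : ∀ {x y} → x <ᶠ y → countB (λ t → (t ∋ᵗ x) ∧ (t ∋ᵗ y)) T ≡ 1
      count {x} {y} x<y
        with allB⁻ _ (allFin n) (allB⁻ _ (allFin n) sts (∈-allFin x)) (∈-allFin y)
      ... | p rewrite Equivalence.to T-≡ (<⇒<ᵇ x<y) = ≡ᵇ⇒≡ _ 1 (Equivalence.from T-≡ p)

      ∧⁺ : ∀ {t : Triple n} {x y} → x ∈ₜ t → y ∈ₜ t → ((t ∋ᵗ x) ∧ (t ∋ᵗ y)) ≡ true
      ∧⁺ p q rewrite ∈ₜ⇒∋ᵗ p = ∈ₜ⇒∋ᵗ q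

      cover< : ∀ {x y} → x <ᶠ y → ∃[ t ] (t ∈ T × x ∈ₜ t × y ∈ₜ t)
      cover< {x} {y} x<y with countB-exists _ T (count x<y)
      ... | t , t∈ , p with t ∋ᵗ x in eq₁ | t ∋ᵗ y in eq₂
      ... | true | true = t , t∈ , ∋ᵗ⇒∈ₜ t eq₁ , ∋ᵗ⇒∈ₜ t eq₂

    cover : ∀ {x y} → x ≢ y → ∃[ t ] (t ∈ T × x ∈ₜ t × y ∈ₜ t)
    cover {x} {y} x≢y with Fin.<-cmp x y
    ... | tri< x<y _ _ = cover< x<y
    ... | tri≈ _ x≡y _ = contradiction x≡y x≢y
    ... | tri> _ _ y<x with cover< y<x
    ... | t , t∈ , p , q = t , t∈ , q , p

    cover-unique : ∀ {x y t t′} → x ≢ y → t ∈ T → t′ ∈ T → x ∈ₜ t → y ∈ₜ t → x ∈ₜ t′ → y ∈ₜ t′ → t ≡ t′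
    cover-unique {x} {y} x≢y t∈ t′∈ p q p′ q′ with Fin.<-cmp x y
    ... | tri< x<y _ _ = countB-unique _ T (count x<y) t∈ t′∈ (∧⁺ p q) (∧⁺ p′ q′)
    ... | tri≈ _ x≡y _ = contradiction x≡y x≢y
    ... | tri> _ _ y<x = countB-unique _ T (count y<x) t∈ t′∈ (∧⁺ q p) (∧⁺ q′ p′)

    _·_ : Op n
    x · y with x Fin.≟ y
    ... | yes _  = x
    ... | no x≢y with cover x≢y
    ... | t , t∈ , p , q = proj₁ (third (sorted t∈) p q x≢y)

    -- Frees later arguments from the choices made by `cover`: the triple through two points is
    -- unique in a Steiner system, and so is its third point.
    ·-char : ∀ {x y z t} → t ∈ T → x ∈ₜ t → y ∈ₜ t → z ∈ₜ t → x ≢ y → x ≢ z → y ≢ z → x · y ≡ z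
    ·-char {x} {y} t∈ px py pz x≢y x≢z y≢z with x Fin.≟ y
    ... | yes x≡y = contradiction x≡y x≢y
    ... | no x≢y′ with cover x≢y′
    ... | t′ , t′∈ , p , q with refl ← cover-unique x≢y t∈ t′∈ px py p q with third (sorted t′∈) p q x≢y′
    ... | z′ , _ , _ , _ , only = sym (only pz x≢z y≢z)

    ·-block : ∀ {x y} → x ≢ y → ∃[ t ] (t ∈ T × x ∈ₜ t × y ∈ₜ t × (x · y) ∈ₜ t × x ≢ x · y × y ≢ x · y)
    ·-block {x} {y} x≢y with x Fin.≟ y
    ... | yes x≡y = contradiction x≡y x≢y
    ... | no x≢y′ with cover x≢y′
    ... | t , t∈ , p , q with third (sorted t∈) p q x≢y′
    ... | z , r , x≢z , y≢z , _ = t , t∈ , p , q , r , x≢z , y≢z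

    ·-idem : ∀ x → x · x ≡ x
    ·-idem x with x Fin.≟ x
    ... | yes _  = refl
    ... | no x≢x = contradiction refl x≢x

    ·-isSteiner : IsSteiner _·_
    ·-isSteiner = record { idem = ·-idem ; comm = comm ; inv = inv }
      where
      comm : ∀ x y → x · y ≡ y · x
      comm x y with x Fin.≟ y
      ... | yes refl = sym (·-idem x)
      ... | no x≢y with cover x≢y
      ... | t , t∈ , p , q with third (sorted t∈) p q x≢y
      ... | z , r , x≢z , y≢z , _ = sym (·-char t∈ q p r (x≢y ∘ sym) y≢z x≢z)
      inv : ∀ x y → x · (x · y) ≡ y
      inv x y = decide (x Fin.≟ y)
        where
        decide : Dec (x ≡ y) → x · (x · y) ≡ y
        decide (yes refl) = ≡.trans (cong (x ·_) (·-idem x)) (·-idem x)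
        decide (no x≢y) with ·-block x≢y
        ... | t , t∈ , p , q , r , x≢z , y≢z = ·-char t∈ p r q x≢z x≢y (y≢z ∘ sym)

  -- Half of the injectivity of passing to quasigroups: for `(a , b , c)` in `T` the common
  -- operation sends `a` and `b` to `c`, so the triple of `T′` through `a` and `b` contains `c` too.
  quasigroup-⊆ : ∀ {n} (T T′ : List (Triple n)) (sorted : ∀ {t} → t ∈ T → Sorted t) (sorted′ : ∀ {t} → t ∈ T′ → Sorted t)
    (sts : isSTS T ≡ true) (sts′ : isSTS T′ ≡ true) →
    (∀ x y → Quasigroup._·_ T sorted sts x y ≡ Quasigroup._·_ T′ sorted′ sts′ x y) → ∀ {t} → t ∈ T → t ∈ T′
  quasigroup-⊆ T T′ sorted sorted′ sts sts′ agree {a , b , c} t∈ =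
    conclude (sorted t∈) (Q′.·-block (Fin.<⇒≢ (proj₁ (sorted t∈))))
    where
    module Q  = Quasigroup T sorted sts
    module Q′ = Quasigroup T′ sorted′ sts′
    conclude : Sorted (a , b , c) →
      ∃[ t ] (t ∈ T′ × a ∈ₜ t × b ∈ₜ t × (a Q′.· b) ∈ₜ t × a ≢ a Q′.· b × b ≢ a Q′.· b) → (a , b , c) ∈ T′
    conclude (a<b , b<c) (t′ , t′∈ , p , q , r , _) =
      subst (_∈ T′) (sym (sorted-determined (a<b , b<c) (sorted′ t′∈) p q (subst (_∈ₜ t′) a·b≡c r))) t′∈
      where
      a·b≡c : a Q′.· b ≡ c
      a·b≡c = ≡.trans (sym (agree a b))
        (Q.·-char t∈ is₁ is₂ is₃ (Fin.<⇒≢ a<b) (Fin.<⇒≢ (Fin.<-trans a<b b<c)) (Fin.<⇒≢ b<c))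

  -- Enumerating the systems

  concatMap-unique : ∀ {A B : Set} (f : A → List B) → (∀ x → Unique (f x)) →
    (∀ {x y t} → t ∈ f x → t ∈ f y → x ≡ y) → ∀ {xs} → Unique xs → Unique (concatMap f xs)
  concatMap-unique f u key {xs} uxs = concat⁺ (AllP.map⁺ (All.tabulate λ {x} _ → u x))
    (AllPairs.map⁺ (allPairs-map {P = λ _ → ⊤} (λ _ _ x≢y (p , q) → x≢y (key p q)) (All.tabulate λ _ → tt) uxs))

  boolLists-unique : ∀ m → Unique (boolLists m)
  boolLists-unique zero    = [] ∷ []
  boolLists-unique (suc m) = concatMap-unique _ (λ bs → ((λ ()) ∷ []) ∷ [] ∷ []) key (boolLists-unique m)
    where
    key : ∀ {bs bs′ : List Bool} {t} → t ∈ (true ∷ bs) ∷ (false ∷ bs) ∷ [] → t ∈ (true ∷ bs′) ∷ (false ∷ bs′) ∷ [] → bs ≡ bs′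
    key (here refl)         (here refl)         = refl
    key (there (here refl)) (there (here refl)) = refl
    key (here refl)         (there (here ()))
    key (there (here refl)) (here ())

  boolLists-length : ∀ m {bs} → bs ∈ boolLists m → length bs ≡ m
  boolLists-length zero    (here refl) = refl
  boolLists-length (suc m) bs∈ with find (∈-concatMap⁻ _ {xs = boolLists m} bs∈)
  ... | bs , bs∈′ , here refl         = cong suc (boolLists-length m bs∈′)
  ... | bs , bs∈′ , there (here refl) = cong suc (boolLists-length m bs∈′)

  module _ (n : ℕ) where

    private
      entry : Fin n → Fin n → Fin n → List (Triple n)
      entry a b c = if (toℕ a <ᵇ toℕ b) ∧ (toℕ b <ᵇ toℕ c) then (a , b , c) ∷ [] else []

      entry⁻ : ∀ {a b c t} → t ∈ entry a b c → t ≡ (a , b , c) × Sorted t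
      entry⁻ {a} {b} {c} t∈ with toℕ a <ᵇ toℕ b in p | toℕ b <ᵇ toℕ c in q
      entry⁻ {a} {b} {c} (here refl) | true | true =
        refl , <ᵇ⇒< (toℕ a) (toℕ b) (Equivalence.from T-≡ p) , <ᵇ⇒< (toℕ b) (toℕ c) (Equivalence.from T-≡ q)

      row⁻ : ∀ {a b t} → t ∈ concatMap (entry a b) (allFin n) → ∃[ c ] (t ≡ (a , b , c) × Sorted t)
      row⁻ {a} {b} t∈ with satisfied (∈-concatMap⁻ (entry a b) {xs = allFin n} t∈)
      ... | c , p = c , entry⁻ p

      plane⁻ : ∀ {a t} → t ∈ concatMap (λ b → concatMap (entry a b) (allFin n)) (allFin n) →
        ∃[ b ] ∃[ c ] (t ≡ (a , b , c) × Sorted t)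
      plane⁻ {a} t∈ with satisfied (∈-concatMap⁻ (λ b → concatMap (entry a b) (allFin n)) {xs = allFin n} t∈)
      ... | b , p = b , row⁻ p

      entry-unique : ∀ a b c → Unique (entry a b c)
      entry-unique a b c with (toℕ a <ᵇ toℕ b) ∧ (toℕ b <ᵇ toℕ c)
      ... | true  = [] ∷ []
      ... | false = []

    triples-sorted : ∀ {t} → t ∈ triples n → Sorted t
    triples-sorted t∈ with satisfied (∈-concatMap⁻ (λ a → concatMap (λ b → concatMap (entry a b) (allFin n)) (allFin n)) {xs = allFin n} t∈)
    ... | a , p with plane⁻ {a} p
    ... | _ , _ , _ , s = s

    triples-unique : Unique (triples n)
    triples-unique =
      concatMap-unique (λ a → concatMap (λ b → concatMap (entry a b) (allFin n)) (allFin n)) (λ a →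
        concatMap-unique (λ b → concatMap (entry a b) (allFin n)) (λ b →
          concatMap-unique (entry a b) (entry-unique a b) key₃ (allFin⁺ n))
          key₂ (allFin⁺ n))
        key₁ (allFin⁺ n)
      where
      key₃ : ∀ {a b c c′ t} → t ∈ entry a b c → t ∈ entry a b c′ → c ≡ c′
      key₃ {a} {b} {c} {c′} p q with refl ← proj₁ (entry⁻ {a} {b} {c} p) | refl ← proj₁ (entry⁻ {a} {b} {c′} q) = refl
      key₂ : ∀ {a b b′ t} → t ∈ concatMap (entry a b) (allFin n) → t ∈ concatMap (entry a b′) (allFin n) → b ≡ b′
      key₂ {a} {b} {b′} p q with row⁻ {a} {b} p | row⁻ {a} {b′} q
      ... | _ , refl , _ | _ , refl , _ = refl
      key₁ : ∀ {a a′ t} → t ∈ concatMap (λ b → concatMap (entry a b) (allFin n)) (allFin n) →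
        t ∈ concatMap (λ b → concatMap (entry a′ b) (allFin n)) (allFin n) → a ≡ a′
      key₁ {a} {a′} p q with plane⁻ {a} p | plane⁻ {a′} q
      ... | _ , _ , refl , _ | _ , _ , refl , _ = refl

  select-⊆ : ∀ {A : Set} (xs : List A) bs {t} → t ∈ select xs bs → t ∈ xs
  select-⊆ (x ∷ xs) (true  ∷ bs) (here refl) = here refl
  select-⊆ (x ∷ xs) (true  ∷ bs) (there p)   = there (select-⊆ xs bs p)
  select-⊆ (x ∷ xs) (false ∷ bs) p           = there (select-⊆ xs bs p)

  -- Selections are compared as sets, which is what `quasigroup-⊆` supplies; as the entries of `xs`
  -- are distinct, membership of each entry gives back its bit.
  select-injective : ∀ {A : Set} (xs : List A) bs bs′ → Unique xs → length bs ≡ length xs → length bs′ ≡ length xs →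
    (∀ {t} → t ∈ select xs bs → t ∈ select xs bs′) → (∀ {t} → t ∈ select xs bs′ → t ∈ select xs bs) → bs ≡ bs′
  select-injective [] [] [] _ _ _ _ _ = refl
  select-injective (x ∷ xs) (b ∷ bs) (b′ ∷ bs′) (x∉ ∷ u) l l′ h h′ = go b b′ h h′
    where
    notin : ∀ {bs} → x ∉ select xs bs
    notin {bs} p = All.lookup x∉ (select-⊆ xs bs p) refl
    strip : ∀ {t bs} → t ∈ select xs bs → ∀ {bs′} → t ∈ x ∷ select xs bs′ → t ∈ select xs bs′
    strip {bs = bs} p (here refl) = contradiction p (notin {bs})
    strip         p (there q)   = q
    rest : (∀ {t} → t ∈ select xs bs → t ∈ select xs bs′) → (∀ {t} → t ∈ select xs bs′ → t ∈ select xs bs) → bs ≡ bs′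
    rest = select-injective xs bs bs′ u (suc-injective l) (suc-injective l′)
    go : ∀ b b′ → (∀ {t} → t ∈ select (x ∷ xs) (b ∷ bs) → t ∈ select (x ∷ xs) (b′ ∷ bs′)) →
         (∀ {t} → t ∈ select (x ∷ xs) (b′ ∷ bs′) → t ∈ select (x ∷ xs) (b ∷ bs)) → b ∷ bs ≡ b′ ∷ bs′
    go true  true  h h′ = cong (true ∷_) (rest (λ p → strip {bs = bs} p {bs′} (h (there p))) (λ p → strip {bs = bs′} p {bs} (h′ (there p))))
    go false false h h′ = cong (false ∷_) (rest h h′)
    go true  false h h′ = contradiction (h (here refl)) (notin {bs′})
    go false true  h h′ = contradiction (h′ (here refl)) (notin {bs})

  module _ {A : Set} (p : A → Bool) where

    -- Passing the Boolean together with its equation stores the proof of `p x ≡ true` that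
    -- `Quasigroup` needs, and lets the lemmas below split on `b` alone.
    keep : ∀ x b → p x ≡ b → List (∃[ x ] p x ≡ true) → List (∃[ x ] p x ≡ true)
    keep x true  eq ws = (x , eq) ∷ ws
    keep x false eq ws = ws

    witnesses : List A → List (∃[ x ] p x ≡ true)
    witnesses []       = []
    witnesses (x ∷ xs) = keep x (p x) refl (witnesses xs)

    length-witnesses : ∀ xs → length (witnesses xs) ≡ countB p xs
    length-witnesses []       = refl
    length-witnesses (x ∷ xs) =
      ≡.trans (length-keep (p x) refl) (cong (λ m → if p x then suc m else m) (length-witnesses xs))
      where
      length-keep : ∀ {ws} b (eq : p x ≡ b) → length (keep x b eq ws) ≡ (if b then suc (length ws) else length ws)
      length-keep true  eq = refl
      length-keep false eq = refl

    witnesses-all : ∀ {P : A → Set} {xs} → All P xs → All (P ∘ proj₁) (witnesses xs)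
    witnesses-all []                     = []
    witnesses-all {P} {x ∷ _} (px ∷ pxs) = all-keep (p x) refl (witnesses-all pxs)
      where
      all-keep : ∀ {ws} b (eq : p x ≡ b) → All (P ∘ proj₁) ws → All (P ∘ proj₁) (keep x b eq ws)
      all-keep true  eq h = px ∷ h
      all-keep false eq h = h

    witnesses-allPairs : ∀ {R : A → A → Set} {xs} → AllPairs R xs →
      AllPairs (λ u v → R (proj₁ u) (proj₁ v)) (witnesses xs)
    witnesses-allPairs []                   = []
    witnesses-allPairs {R} {x ∷ _} (r ∷ rs) =
      allPairs-keep (p x) refl (witnesses-all r) (witnesses-allPairs rs)
      where
      allPairs-keep : ∀ {ws} b (eq : p x ≡ b) → All (R x ∘ proj₁) ws →
        AllPairs (λ u v → R (proj₁ u) (proj₁ v)) ws → AllPairs (λ u v → R (proj₁ u) (proj₁ v)) (keep x b eq ws)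
      allPairs-keep true  eq h hs = h ∷ hs
      allPairs-keep false eq h hs = hs

  countB-map : ∀ {A B : Set} (p : B → Bool) (f : A → B) xs → countB p (map f xs) ≡ countB (p ∘ f) xs
  countB-map p f []       = refl
  countB-map p f (x ∷ xs) with p (f x)
  ... | true  = cong suc (countB-map p f xs)
  ... | false = countB-map p f xs

  module _ (n : ℕ) where

    private
      codes : List (List Bool)
      codes = boolLists (length (triples n))

      Code : Set
      Code = ∃[ bs ] isSTS (select (triples n) bs) ≡ true

      codes-sorted : ∀ (s : Code) {t} → t ∈ select (triples n) (proj₁ s) → Sorted t
      codes-sorted s t∈ = triples-sorted n (select-⊆ (triples n) (proj₁ s) t∈)

      op : Code → Op n
      op s = Quasigroup._·_ (select (triples n) (proj₁ s)) (codes-sorted s) (proj₂ s)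

      op-⊆ : ∀ s s′ → (∀ x y → op s x y ≡ op s′ x y) →
        ∀ {t} → t ∈ select (triples n) (proj₁ s) → t ∈ select (triples n) (proj₁ s′)
      op-⊆ s s′ = quasigroup-⊆ _ _ (codes-sorted s) (codes-sorted s′) (proj₂ s) (proj₂ s′)

    steinerOps : List (Op n)
    steinerOps = map op (witnesses (isSTS ∘ select (triples n)) codes)

    length-steinerOps : length steinerOps ≡ STS n
    length-steinerOps = begin
      length steinerOps                                              ≡⟨ length-map op (witnesses (isSTS ∘ select (triples n)) codes) ⟩
      length (witnesses (isSTS ∘ select (triples n)) codes)          ≡⟨ length-witnesses _ codes ⟩
      countB (isSTS ∘ select (triples n)) codes                      ≡⟨ countB-map isSTS (select (triples n)) codes ⟨
      STS n ∎
      where open ≡-Reasoning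

    steinerOps-steiner : All IsSteiner steinerOps
    steinerOps-steiner = AllP.map⁺ (All.tabulate λ {s} _ → Quasigroup.·-isSteiner _ (codes-sorted s) (proj₂ s))

    steinerOps-distinct : AllPairs (λ F G → ¬ (∀ x y → F x y ≡ G x y)) steinerOps
    steinerOps-distinct = AllPairs.map⁺
      (allPairs-map
        (λ {s} {s′} l l′ s≢s′ agree → s≢s′
          (select-injective (triples n) (proj₁ s) (proj₁ s′) (triples-unique n) l l′
            (op-⊆ s s′ agree) (op-⊆ s′ s (λ x y → sym (agree x y)))))
        (witnesses-all _ {P = λ bs → length bs ≡ length (triples n)} (All.tabulate (boolLists-length (length (triples n)))))
        (witnesses-allPairs _ (boolLists-unique (length (triples n)))))

  -- Bounds for e

  -- The mean value estimate for the power `suc j` between `p` and `p + 1`. With `power-step-≥` it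
  -- replaces calculus, both for e and for comparing sums with integrals.
  power-step-≤ : ∀ p j → suc p ^ suc j ≤ p ^ suc j + suc j * suc p ^ j
  power-step-≤ p zero    = ≤-reflexive (eq p)
    where
    eq : ∀ p → suc p * 1 ≡ p * 1 + 1 * 1
    eq = solve-∀
  power-step-≤ p (suc j) = begin
    suc p * suc p ^ suc j                                 ≡⟨ eq₁ p (suc p ^ suc j) ⟩
    p * suc p ^ suc j + suc p ^ suc j                     ≤⟨ +-monoˡ-≤ _ (*-monoʳ-≤ p (power-step-≤ p j)) ⟩
    p * (p ^ suc j + suc j * suc p ^ j) + suc p ^ suc j   ≡⟨ eq₂ p (p ^ suc j) (suc j) (suc p ^ j) (suc p ^ suc j) ⟩
    p * p ^ suc j + (suc j * (p * suc p ^ j) + suc p ^ suc j)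
      ≤⟨ +-monoʳ-≤ (p * p ^ suc j) (+-monoˡ-≤ (suc p ^ suc j) (*-monoʳ-≤ (suc j) (*-monoˡ-≤ (suc p ^ j) (n≤1+n p)))) ⟩
    p * p ^ suc j + (suc j * suc p ^ suc j + suc p ^ suc j) ≡⟨ cong (p * p ^ suc j +_) (+-comm (suc j * suc p ^ suc j) _) ⟩
    p * p ^ suc j + suc (suc j) * suc p ^ suc j ∎
    where
    open ≤-Reasoning
    eq₁ : ∀ p x → suc p * x ≡ p * x + x
    eq₁ = solve-∀
    eq₂ : ∀ p x j y z → p * (x + j * y) + z ≡ p * x + (j * (p * y) + z)
    eq₂ = solve-∀

  power-step-≥ : ∀ p j → p ^ suc j + suc j * p ^ j ≤ suc p ^ suc j
  power-step-≥ p zero    = ≤-reflexive (eq p)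
    where
    eq : ∀ p → p * 1 + 1 * 1 ≡ suc p * 1
    eq = solve-∀
  power-step-≥ p (suc j) = begin
    p * P + suc (suc j) * P                        ≤⟨ m≤m+n _ (suc j * p ^ j) ⟩
    p * P + suc (suc j) * P + suc j * p ^ j        ≡⟨ eq p (p ^ j) (suc j) ⟩
    suc p * (P + suc j * p ^ j)                    ≤⟨ *-monoʳ-≤ (suc p) (power-step-≥ p j) ⟩
    suc p * suc p ^ suc j ∎
    where
    open ≤-Reasoning
    P = p ^ suc j
    eq : ∀ p x j → p * (p * x) + suc j * (p * x) + j * x ≡ suc p * (p * x + j * x)
    eq = solve-∀

  -- The numerator of eApprox M over the denominator M !.
  eNum : ℕ → ℕ
  eNum zero    = 1
  eNum (suc M) = suc M * eNum M + 1

  -- multichoose p j is the coefficient of x ^ j in (1 - x) ^ (- p).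
  multichoose : ℕ → ℕ → ℕ
  multichoose p       zero    = 1
  multichoose zero    (suc j) = 0
  multichoose (suc p) (suc j) = multichoose p (suc j) + multichoose (suc p) j

  -- d ^ M times the M-th partial sum of the power series of (1 - 1/d) ^ (- p).
  negBinomial : ℕ → ℕ → ℕ → ℕ
  negBinomial d p zero    = 1
  negBinomial d p (suc M) = d * negBinomial d p M + multichoose p (suc M)

  -- The truncation of (1 - x) ^ (- p - 1) = (1 - x) ^ (- p) + x (1 - x) ^ (- p - 1) at x = 1/d.
  negBinomial-suc : ∀ d p M → negBinomial d (suc p) (suc M) ≡ negBinomial d p (suc M) + negBinomial d (suc p) M
  negBinomial-suc d p zero    = sym (+-assoc (d * 1) (multichoose p 1) 1)
  negBinomial-suc d p (suc M) =
    ≡.trans (cong (λ z → d * z + multichoose (suc p) (suc (suc M))) (negBinomial-suc d p M))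
      (eq d (negBinomial d p (suc M)) (negBinomial d (suc p) M) (multichoose p (suc (suc M))) (multichoose (suc p) (suc M)))
    where
    eq : ∀ d a b x y → d * (a + b) + (x + y) ≡ d * a + x + (d * b + y)
    eq = solve-∀

  negBinomial-step : ∀ l p M → l * negBinomial (suc l) (suc p) M ≤ suc l * negBinomial (suc l) p M
  negBinomial-step l p zero    = *-monoˡ-≤ 1 (n≤1+n l)
  negBinomial-step l p (suc M) = +-cancelˡ-≤ B _ _ (begin
    B + l * B                                        ≡⟨ cong (suc l *_) (negBinomial-suc d p M) ⟩
    suc l * (A + negBinomial d (suc p) M)            ≡⟨ *-distribˡ-+ (suc l) A _ ⟩
    suc l * A + suc l * negBinomial d (suc p) M      ≤⟨ +-monoʳ-≤ (suc l * A) (m≤m+n _ (multichoose (suc p) (suc M))) ⟩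
    suc l * A + B                                    ≡⟨ +-comm (suc l * A) B ⟩
    B + suc l * A ∎)
    where
    open ≤-Reasoning
    d = suc l
    A = negBinomial d p (suc M)
    B = negBinomial d (suc p) (suc M)

  -- Partial sums stay below (1 - 1/d) ^ (- p) with `d = suc l`: multiplying a partial sum by 1 -
  -- 1/d lowers `p` by one and drops a nonnegative term.
  negBinomial-bound : ∀ l p M → l ^ p * negBinomial (suc l) p M ≤ suc l ^ p * suc l ^ M
  negBinomial-bound l zero    M = ≤-reflexive (cong (_+ 0) (base M))
    where
    base : ∀ M → negBinomial (suc l) 0 M ≡ suc l ^ M
    base zero    = refl
    base (suc M) = ≡.trans (+-identityʳ _) (cong (suc l *_) (base M))
  negBinomial-bound l (suc p) M = begin
    l * l ^ p * negBinomial (suc l) (suc p) M      ≡⟨ eq l (l ^ p) _ ⟩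
    l ^ p * (l * negBinomial (suc l) (suc p) M)    ≤⟨ *-monoʳ-≤ (l ^ p) (negBinomial-step l p M) ⟩
    l ^ p * (suc l * negBinomial (suc l) p M)      ≡⟨ eq′ (l ^ p) (suc l) _ ⟩
    suc l * (l ^ p * negBinomial (suc l) p M)      ≤⟨ *-monoʳ-≤ (suc l) (negBinomial-bound l p M) ⟩
    suc l * (suc l ^ p * suc l ^ M)                ≡⟨ *-assoc (suc l) (suc l ^ p) (suc l ^ M) ⟨
    suc l * suc l ^ p * suc l ^ M ∎
    where
    open ≤-Reasoning
    eq : ∀ a b c → a * b * c ≡ b * (a * c)
    eq = solve-∀
    eq′ : ∀ a b c → a * (b * c) ≡ b * (a * c)
    eq′ = solve-∀

  power≤multichoose : ∀ p M → p ^ M ≤ M ! * multichoose p M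
  power≤multichoose p       zero    = ≤-refl
  power≤multichoose zero    (suc M) = z≤n
  power≤multichoose (suc p) (suc M) = begin
    suc p ^ suc M                                          ≤⟨ power-step-≤ p M ⟩
    p ^ suc M + suc M * suc p ^ M                          ≤⟨ +-mono-≤ (power≤multichoose p (suc M)) (*-monoʳ-≤ (suc M) (power≤multichoose (suc p) M)) ⟩
    suc M * M ! * X + suc M * (M ! * Y)                    ≡⟨ eq (suc M) (M !) X Y ⟩
    suc M * M ! * (X + Y) ∎
    where
    open ≤-Reasoning
    X = multichoose p (suc M)
    Y = multichoose (suc p) M
    eq : ∀ a b x y → a * b * x + a * (b * y) ≡ a * b * (x + y)
    eq = solve-∀

  eNum≤negBinomial : ∀ d M → d ^ M * eNum M ≤ M ! * negBinomial d d M
  eNum≤negBinomial d zero    = ≤-refl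
  eNum≤negBinomial d (suc M) = begin
    d * d ^ M * (suc M * eNum M + 1)                     ≡⟨ eq₁ d (d ^ M) (suc M) (eNum M) ⟩
    suc M * (d * (d ^ M * eNum M)) + d ^ suc M           ≤⟨ +-mono-≤ (*-monoʳ-≤ (suc M) (*-monoʳ-≤ d (eNum≤negBinomial d M))) (power≤multichoose d (suc M)) ⟩
    suc M * (d * (M ! * X)) + suc M * M ! * Y            ≡⟨ eq₂ (suc M) d (M !) X Y ⟩
    suc M * M ! * (d * X + Y) ∎
    where
    open ≤-Reasoning
    X = negBinomial d d M
    Y = multichoose d (suc M)
    eq₁ : ∀ d x m e → d * x * (m * e + 1) ≡ m * (d * (x * e)) + d * x
    eq₁ = solve-∀
    eq₂ : ∀ m d f x y → m * (d * (f * x)) + m * f * y ≡ m * f * (d * x + y)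
    eq₂ = solve-∀

  -- The estimate e ≤ (1 - 1/d) ^ (- d) for `d = suc l`, that is (1 + 1/l) ^ (l + 1). Termwise, 1/j!
  -- is at most `multichoose d j / d ^ j`.
  e-bound : ∀ M l → eNum M * l ^ suc l ≤ M ! * suc l ^ suc l
  e-bound M l = *-cancelˡ-≤ (d ^ M) {{m^n≢0 d M}} (begin
    d ^ M * (eNum M * l ^ d)        ≡⟨ *-assoc (d ^ M) (eNum M) (l ^ d) ⟨
    d ^ M * eNum M * l ^ d          ≤⟨ *-monoˡ-≤ (l ^ d) (eNum≤negBinomial d M) ⟩
    M ! * negBinomial d d M * l ^ d ≡⟨ eq₁ (M !) (negBinomial d d M) (l ^ d) ⟩
    M ! * (l ^ d * negBinomial d d M) ≤⟨ *-monoʳ-≤ (M !) (negBinomial-bound l d M) ⟩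
    M ! * (d ^ d * d ^ M)           ≡⟨ eq₂ (M !) (d ^ d) (d ^ M) ⟩
    d ^ M * (M ! * d ^ d) ∎)
    where
    open ≤-Reasoning
    d = suc l
    eq₁ : ∀ a b c → a * b * c ≡ a * (c * b)
    eq₁ = solve-∀
    eq₂ : ∀ a b c → a * (b * c) ≡ c * (a * b)
    eq₂ = solve-∀

  !≤eNum : ∀ M → M ! ≤ eNum M
  !≤eNum zero    = ≤-refl
  !≤eNum (suc M) = ≤-trans (*-monoʳ-≤ (suc M) (!≤eNum M)) (m≤m+n _ 1)

  -- The product over the levels

  σ Ψ : ℕ → ℕ
  σ zero    = 0
  σ (suc k) = σ k + suc k ^ 5
  Ψ zero    = 1
  Ψ (suc k) = Ψ k * suc k ^ (suc k ^ 5)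

  -- `allFin` unfolds from the first index, while `σ` and `Ψ` grow at the highest level.
  ∏-allFin-last : ∀ k (g : ℕ → ℕ) → ∏ (allFin (suc k)) (g ∘ toℕ) ≡ ∏ (allFin k) (g ∘ toℕ) * g k
  ∏-allFin-last zero    g = *-comm (g 0) 1
  ∏-allFin-last (suc k) g = begin
    ∏ (allFin (suc (suc k))) (g ∘ toℕ)                      ≡⟨ ∏-allFin-suc (suc k) (g ∘ toℕ) ⟩
    g 0 * ∏ (allFin (suc k)) (g ∘ suc ∘ toℕ)                ≡⟨ cong (g 0 *_) (∏-allFin-last k (g ∘ suc)) ⟩
    g 0 * (∏ (allFin k) (g ∘ suc ∘ toℕ) * g (suc k))        ≡⟨ *-assoc (g 0) _ (g (suc k)) ⟨
    g 0 * ∏ (allFin k) (g ∘ suc ∘ toℕ) * g (suc k)          ≡⟨ cong (_* g (suc k)) (∏-allFin-suc k (g ∘ toℕ)) ⟨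
    ∏ (allFin (suc k)) (g ∘ toℕ) * g (suc k) ∎
    where open ≡-Reasoning

  ∏-σ : ∀ a k → ∏ (allFin k) (λ i → a ^ (suc (toℕ i) ^ 5)) ≡ a ^ σ k
  ∏-σ a zero    = refl
  ∏-σ a (suc k) = begin
    ∏ (allFin (suc k)) (λ i → a ^ (suc (toℕ i) ^ 5))                 ≡⟨ ∏-allFin-last k (λ i → a ^ (suc i ^ 5)) ⟩
    ∏ (allFin k) (λ i → a ^ (suc (toℕ i) ^ 5)) * a ^ (suc k ^ 5)     ≡⟨ cong (_* a ^ (suc k ^ 5)) (∏-σ a k) ⟩
    a ^ σ k * a ^ (suc k ^ 5)                                        ≡⟨ ^-distribˡ-+-* a (σ k) (suc k ^ 5) ⟨
    a ^ σ (suc k) ∎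
    where open ≡-Reasoning

  ^-swap : ∀ x a b → (x ^ a) ^ b ≡ (x ^ b) ^ a
  ^-swap x a b = ≡.trans (^-*-assoc x a b) (≡.trans (cong (x ^_) (*-comm a b)) (sym (^-*-assoc x b a)))

  ∏-Ψ : ∀ k → ∏ (allFin k) (λ i → suc (toℕ i) ^ (suc (toℕ i) ^ 5)) ≡ Ψ k
  ∏-Ψ zero    = refl
  ∏-Ψ (suc k) =
    ≡.trans (∏-allFin-last k (λ i → suc i ^ (suc i ^ 5))) (cong (_* suc k ^ (suc k ^ 5)) (∏-Ψ k))

  levelsLower-closed : ∀ k → levelsLower k ≡ (k ^ 12) ^ σ k
  levelsLower-closed k = ∏-σ (k ^ 12) k

  levelsUpper-closed : ∀ k n → levelsUpper k n ≡ Ψ k ^ 12 * (n + 3 * k ^ 12) ^ σ k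
  levelsUpper-closed k n = begin
    ∏ (allFin k) (λ i → (suc (toℕ i) ^ 12 * n′) ^ (suc (toℕ i) ^ 5))
      ≡⟨ ∏-cong (allFin k) (λ i → ≡.trans (^-distribʳ-* (suc (toℕ i) ^ 12) n′ (suc (toℕ i) ^ 5))
           (cong (_* n′ ^ (suc (toℕ i) ^ 5)) (^-swap (suc (toℕ i)) 12 (suc (toℕ i) ^ 5)))) ⟩
    ∏ (allFin k) (λ i → (suc (toℕ i) ^ (suc (toℕ i) ^ 5)) ^ 12 * n′ ^ (suc (toℕ i) ^ 5))
      ≡⟨ ∏-distrib-* (allFin k) (λ i → (suc (toℕ i) ^ (suc (toℕ i) ^ 5)) ^ 12) _ ⟩
    ∏ (allFin k) (λ i → (suc (toℕ i) ^ (suc (toℕ i) ^ 5)) ^ 12) * ∏ (allFin k) (λ i → n′ ^ (suc (toℕ i) ^ 5))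
      ≡⟨ cong₂ _*_ (≡.trans (∏-^ (allFin k) _ 12) (cong (_^ 12) (∏-Ψ k))) (∏-σ n′ k) ⟩
    Ψ k ^ 12 * n′ ^ σ k ∎
    where
    open ≡-Reasoning
    n′ = n + 3 * k ^ 12

  -- Power sums and the comparison of `Ψ` with e

  6σ-lower : ∀ k → k ^ 6 ≤ 6 * σ k
  6σ-lower zero    = z≤n
  6σ-lower (suc k) = begin
    suc k ^ 6               ≤⟨ power-step-≤ k 5 ⟩
    k ^ 6 + 6 * suc k ^ 5   ≤⟨ +-monoˡ-≤ (6 * suc k ^ 5) (6σ-lower k) ⟩
    6 * σ k + 6 * suc k ^ 5 ≡⟨ *-distribˡ-+ 6 (σ k) (suc k ^ 5) ⟨
    6 * σ (suc k) ∎
    where open ≤-Reasoning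

  6σ-upper : ∀ k → 6 * σ k ≤ k ^ 6 + 6 * k ^ 5
  6σ-upper zero    = z≤n
  6σ-upper (suc k) = begin
    6 * σ (suc k)                       ≡⟨ *-distribˡ-+ 6 (σ k) (suc k ^ 5) ⟩
    6 * σ k + 6 * suc k ^ 5             ≤⟨ +-monoˡ-≤ (6 * suc k ^ 5) (6σ-upper k) ⟩
    k ^ 6 + 6 * k ^ 5 + 6 * suc k ^ 5   ≤⟨ +-monoˡ-≤ (6 * suc k ^ 5) (power-step-≥ k 5) ⟩
    suc k ^ 6 + 6 * suc k ^ 5 ∎
    where open ≤-Reasoning

  -- The slack polynomial has nonnegative coefficients and turns `degree` into a ring identity;
  -- powers are written as the products to which `^` unfolds.
  degree-eq : ∀ t →
    (suc (suc t) * (suc (suc t) * (suc (suc t) * (suc (suc t) * (suc (suc t) * (suc (suc t) * 1)))))) + 5 * (suc t * (suc t * (suc t * (suc t * (suc t * 1)))))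
      + (4 * (t * t * t * t) + 46 * (t * t * t) + 149 * (t * t) + 195 * t + 92)
    ≡ (suc t * (suc t * (suc t * (suc t * (suc t * (suc t * 1)))))) + 6 * ((suc t * (suc t * (suc t * (suc t * 1)))) * t)
      + 5 * (suc (suc t) * (suc (suc t) * (suc (suc t) * (suc (suc t) * (suc (suc t) * 1)))))
  degree-eq = solve-∀

  -- Put k = t + 1 and D = 6k⁴(k - 1). A gain of D in the exponent of `p / q` falls short of the
  -- increment of k⁶ by about 21k⁴, and the correction 5k⁵ in `Ψ-bound`, growing by about 25k⁴,
  -- covers this.
  degree : ∀ t → suc (suc t) ^ 6 + 5 * suc t ^ 5 ≤ suc t ^ 6 + 6 * (suc t ^ 4 * t) + 5 * suc (suc t) ^ 5
  degree t = m+n≤o⇒m≤o (suc (suc t) ^ 6 + 5 * suc t ^ 5) (≤-reflexive (degree-eq t))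

  exponent-eq : ∀ t → suc (suc t) * (6 * ((suc t * (suc t * (suc t * (suc t * 1)))) * t)) + 6 * (suc t * (suc t * (suc t * (suc t * 1))))
    ≡ 6 * (suc t * (suc t * (suc t * (suc t * (suc t * (suc t * 1))))))
  exponent-eq = solve-∀

  -- D = 6k⁴(k - 1) is chosen because (k + 1) D = 6k⁶ - 6k⁴, which is below 6k⁶ and thus below
  -- `36 * σ k`.
  exponent : ∀ t → suc (suc t) * (6 * (suc t ^ 4 * t)) ≤ 36 * σ (suc t)
  exponent t = ≤-trans (m+n≤o⇒m≤o (suc (suc t) * (6 * (suc t ^ 4 * t))) (≤-reflexive (exponent-eq t)))
    (≤-trans (*-monoʳ-≤ 6 (6σ-lower (suc t))) (≤-reflexive (sym (*-assoc 6 6 (σ (suc t))))))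

  module _ {p q : ℕ} .{{_ : NonZero q}} (q≤p : q ≤ p) (e≤ : ∀ l → p * l ^ suc l ≤ q * suc l ^ suc l) where

    exchange : ∀ {x y} → x ≤ y → p ^ x * q ^ y ≤ p ^ y * q ^ x
    exchange {x} {y} x≤y = begin
      p ^ x * q ^ y             ≡⟨ cong (λ z → p ^ x * q ^ z) (m+[n∸m]≡n x≤y) ⟨
      p ^ x * q ^ (x + d)       ≡⟨ cong (p ^ x *_) (^-distribˡ-+-* q x d) ⟩
      p ^ x * (q ^ x * q ^ d)   ≤⟨ *-monoʳ-≤ (p ^ x) (*-monoʳ-≤ (q ^ x) (^-monoˡ-≤ d q≤p)) ⟩
      p ^ x * (q ^ x * p ^ d)   ≡⟨ eq (p ^ x) (q ^ x) (p ^ d) ⟩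
      p ^ x * p ^ d * q ^ x     ≡⟨ cong (_* q ^ x) (^-distribˡ-+-* p x d) ⟨
      p ^ (x + d) * q ^ x       ≡⟨ cong (λ z → p ^ z * q ^ x) (m+[n∸m]≡n x≤y) ⟩
      p ^ y * q ^ x ∎
      where
      open ≤-Reasoning
      d = y ∸ x
      eq : ∀ a b c → a * (b * c) ≡ a * c * b
      eq = solve-∀

    -- Lowering the exponent a - b of p / q.
    lower-exponent : ∀ a b {a′ b′ X Y} → a′ + b ≤ a + b′ →
      p ^ a * q ^ b * X ≤ q ^ a * p ^ b * Y → p ^ a′ * q ^ b′ * X ≤ q ^ a′ * p ^ b′ * Y
    lower-exponent a b {a′} {b′} {X} {Y} le h = *-cancelʳ-≤ _ _ (p ^ a * q ^ b) {{m*n≢0 (p ^ a) (q ^ b) {{m^n≢0 p a {{p≢0}}}} {{m^n≢0 q b}}}} (begin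
      p ^ a′ * q ^ b′ * X * (p ^ a * q ^ b)         ≡⟨ eq₁ (p ^ a′) (q ^ b′) X (p ^ a) (q ^ b) ⟩
      p ^ a′ * q ^ b′ * (p ^ a * q ^ b * X)         ≤⟨ *-monoʳ-≤ (p ^ a′ * q ^ b′) h ⟩
      p ^ a′ * q ^ b′ * (q ^ a * p ^ b * Y)         ≡⟨ eq₂ (p ^ a′) (q ^ b′) (q ^ a) (p ^ b) Y ⟩
      p ^ a′ * p ^ b * (q ^ a * q ^ b′) * Y         ≡⟨ cong₂ (λ u v → u * v * Y) (^-distribˡ-+-* p a′ b) (^-distribˡ-+-* q a b′) ⟨
      p ^ (a′ + b) * q ^ (a + b′) * Y               ≤⟨ *-monoˡ-≤ Y (exchange le) ⟩
      p ^ (a + b′) * q ^ (a′ + b) * Y               ≡⟨ cong₂ (λ u v → u * v * Y) (^-distribˡ-+-* p a b′) (^-distribˡ-+-* q a′ b) ⟩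
      p ^ a * p ^ b′ * (q ^ a′ * q ^ b) * Y         ≡⟨ eq₃ (p ^ a) (p ^ b′) (q ^ a′) (q ^ b) Y ⟩
      q ^ a′ * p ^ b′ * Y * (p ^ a * q ^ b) ∎)
      where
      open ≤-Reasoning
      p≢0 : NonZero p
      p≢0 = >-nonZero (<-≤-trans (>-nonZero⁻¹ q) q≤p)
      eq₁ : ∀ a b x c d → a * b * x * (c * d) ≡ a * b * (c * d * x)
      eq₁ = solve-∀
      eq₂ : ∀ a b c d y → a * b * (c * d * y) ≡ a * d * (c * b) * y
      eq₂ = solve-∀
      eq₃ : ∀ a b c d y → a * b * (c * d) * y ≡ c * b * y * (a * d)
      eq₃ = solve-∀

    -- Each of the `D` factors `p / q` is paid for by k + 1 factors 1 + 1/k; the remaining factors 1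
    -- + 1/k only help.
    raise-base : ∀ k D m → suc k * D ≤ m → p ^ D * k ^ m ≤ q ^ D * suc k ^ m
    raise-base k D m le = begin
      p ^ D * k ^ m                             ≡⟨ cong (λ z → p ^ D * k ^ z) (m+[n∸m]≡n le) ⟨
      p ^ D * k ^ (suc k * D + r)               ≡⟨ cong (p ^ D *_) (split k) ⟩
      p ^ D * ((k ^ suc k) ^ D * k ^ r)         ≡⟨ *-assoc (p ^ D) _ _ ⟨
      p ^ D * (k ^ suc k) ^ D * k ^ r           ≡⟨ cong (_* k ^ r) (^-distribʳ-* p (k ^ suc k) D) ⟨
      (p * k ^ suc k) ^ D * k ^ r               ≤⟨ *-mono-≤ (^-monoˡ-≤ D (e≤ k)) (^-monoˡ-≤ r (n≤1+n k)) ⟩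
      (q * suc k ^ suc k) ^ D * suc k ^ r       ≡⟨ cong (_* suc k ^ r) (^-distribʳ-* q (suc k ^ suc k) D) ⟩
      q ^ D * (suc k ^ suc k) ^ D * suc k ^ r   ≡⟨ *-assoc (q ^ D) _ _ ⟩
      q ^ D * ((suc k ^ suc k) ^ D * suc k ^ r) ≡⟨ cong (q ^ D *_) (split (suc k)) ⟨
      q ^ D * suc k ^ (suc k * D + r)           ≡⟨ cong (λ z → q ^ D * suc k ^ z) (m+[n∸m]≡n le) ⟩
      q ^ D * suc k ^ m ∎
      where
      open ≤-Reasoning
      r = m ∸ suc k * D
      split : ∀ x → x ^ (suc k * D + r) ≡ (x ^ suc k) ^ D * x ^ r
      split x = ≡.trans (^-distribˡ-+-* x (suc k * D) r) (cong (_* x ^ r) (sym (^-*-assoc x (suc k) D)))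

    -- Raising the base from `k` to `suc k` multiplies the right side by (1 + 1/k) ^ m, which
    -- provides `D` further factors `p / q`; the exponent is then lowered from a + D - b to a′ - b′.
    step : ∀ k D a b {a′ b′ m X} → suc k * D ≤ m → a′ + b ≤ a + D + b′ →
      p ^ a * q ^ b * X ≤ q ^ a * p ^ b * k ^ m → p ^ a′ * q ^ b′ * X ≤ q ^ a′ * p ^ b′ * suc k ^ m
    step k D a b {m = m} {X} D≤ degree h = lower-exponent (a + D) b degree (begin
      p ^ (a + D) * q ^ b * X              ≡⟨ cong (λ z → z * q ^ b * X) (^-distribˡ-+-* p a D) ⟩
      p ^ a * p ^ D * q ^ b * X            ≡⟨ eq₁ (p ^ a) (p ^ D) (q ^ b) X ⟩
      p ^ D * (p ^ a * q ^ b * X)          ≤⟨ *-monoʳ-≤ (p ^ D) h ⟩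
      p ^ D * (q ^ a * p ^ b * k ^ m)      ≡⟨ eq₂ (p ^ D) (q ^ a) (p ^ b) (k ^ m) ⟩
      q ^ a * p ^ b * (p ^ D * k ^ m)      ≤⟨ *-monoʳ-≤ (q ^ a * p ^ b) (raise-base k D m D≤) ⟩
      q ^ a * p ^ b * (q ^ D * suc k ^ m)  ≡⟨ eq₃ (q ^ a) (p ^ b) (q ^ D) (suc k ^ m) ⟩
      q ^ a * q ^ D * p ^ b * suc k ^ m    ≡⟨ cong (λ z → z * p ^ b * suc k ^ m) (^-distribˡ-+-* q a D) ⟨
      q ^ (a + D) * p ^ b * suc k ^ m ∎)
      where
      open ≤-Reasoning
      eq₁ : ∀ a b c d → a * b * c * d ≡ b * (a * c * d)
      eq₁ = solve-∀
      eq₂ : ∀ a b c d → a * (b * c * d) ≡ b * c * (a * d)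
      eq₂ = solve-∀
      eq₃ : ∀ a b c d → a * b * (c * d) ≡ a * c * b * d
      eq₃ = solve-∀

    append : ∀ P R Y K w l {s} → P * Y ^ l ≤ R * K ^ (l * s) → P * (Y * K ^ w) ^ l ≤ R * K ^ (l * (s + w))
    append P R Y K w l {s} h = begin
      P * (Y * K ^ w) ^ l                ≡⟨ cong (P *_) (^-distribʳ-* Y (K ^ w) l) ⟩
      P * (Y ^ l * (K ^ w) ^ l)          ≡⟨ *-assoc P _ _ ⟨
      P * Y ^ l * (K ^ w) ^ l            ≤⟨ *-monoˡ-≤ ((K ^ w) ^ l) h ⟩
      R * K ^ (l * s) * (K ^ w) ^ l      ≡⟨ *-assoc R _ _ ⟩
      R * (K ^ (l * s) * (K ^ w) ^ l)    ≡⟨ cong (λ z → R * (K ^ (l * s) * z)) (≡.trans (^-*-assoc K w l) (cong (K ^_) (*-comm w l))) ⟩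
      R * (K ^ (l * s) * K ^ (l * w))    ≡⟨ cong (R *_) (^-distribˡ-+-* K (l * s) (l * w)) ⟨
      R * K ^ (l * s + l * w)            ≡⟨ cong (λ z → R * K ^ z) (*-distribˡ-+ l s w) ⟨
      R * K ^ (l * (s + w)) ∎
      where open ≤-Reasoning

    -- The discrete form of ∫₀¹ 36 u⁵ log u du = - 1.
    Ψ-bound : ∀ k → p ^ (k ^ 6) * q ^ (5 * k ^ 5) * Ψ k ^ 36 ≤ q ^ (k ^ 6) * p ^ (5 * k ^ 5) * k ^ (36 * σ k)
    Ψ-bound zero          = ≤-refl
    -- At k = 1 the exponent k⁶ - 5k⁵ is negative, so `q ≤ p` is enough.
    Ψ-bound (suc zero)    = lower-exponent 0 0 {1} {5} {1} {1} (s≤s z≤n) ≤-refl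
    Ψ-bound (suc (suc t)) =
      append (p ^ (suc (suc t) ^ 6) * q ^ (5 * suc (suc t) ^ 5)) (q ^ (suc (suc t) ^ 6) * p ^ (5 * suc (suc t) ^ 5))
        (Ψ (suc t)) (suc (suc t)) (suc (suc t) ^ 5) 36 {σ (suc t)}
        (step (suc t) (6 * (suc t ^ 4 * t)) (suc t ^ 6) (5 * suc t ^ 5) {suc (suc t) ^ 6} {5 * suc (suc t) ^ 5} {36 * σ (suc t)} {Ψ (suc t) ^ 36}
          (exponent t) (degree t) (Ψ-bound (suc t)))

  -- Asymptotics

  -- The ratio (b + 1)/b is the product of (2b + 2)/(2b + 1) and (2b + 1)/(2b). The powers of the
  -- second ratio absorb one factor `suc k` by `power-step-≥`, and the first is left to the
  -- induction on `d`.
  exponential-beats-power : ∀ d b C → ∃[ K ] (∀ k → K ≤ k → C * suc k ^ d * b ^ k ≤ suc b ^ k)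
  exponential-beats-power zero b C = suc (C * b) , bound
    where
    open ≤-Reasoning
    bound : ∀ k → suc (C * b) ≤ k → C * 1 * b ^ k ≤ suc b ^ k
    bound (suc j) (s≤s Cb≤j) = begin
      C * 1 * (b * b ^ j)            ≡⟨ eq C b (b ^ j) ⟩
      C * b * b ^ j                  ≤⟨ *-monoˡ-≤ (b ^ j) (m≤n⇒m≤1+n Cb≤j) ⟩
      suc j * b ^ j                  ≤⟨ m≤n+m (suc j * b ^ j) (b ^ suc j) ⟩
      b ^ suc j + suc j * b ^ j      ≤⟨ power-step-≥ b j ⟩
      suc b ^ suc j ∎
      where
      eq : ∀ C b x → C * 1 * (b * x) ≡ C * b * x
      eq = solve-∀
  exponential-beats-power (suc d) b C with exponential-beats-power d (suc (2 * b)) (C * suc (2 * b))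
  ... | K , h = K , λ k K≤k → *-cancelʳ-≤ _ _ (2 ^ k) {{m^n≢0 2 k}} (begin
    C * suc k ^ suc d * b ^ k * 2 ^ k                      ≡⟨ eq₁ C (suc k) (suc k ^ d) (b ^ k) (2 ^ k) ⟩
    C * suc k ^ d * (suc k * (2 ^ k * b ^ k))              ≡⟨ cong (λ z → C * suc k ^ d * (suc k * z)) (^-distribʳ-* 2 b k) ⟨
    C * suc k ^ d * (suc k * (2 * b) ^ k)                  ≤⟨ *-monoʳ-≤ (C * suc k ^ d) (≤-trans (m≤n+m _ ((2 * b) ^ suc k)) (power-step-≥ (2 * b) k)) ⟩
    C * suc k ^ d * (suc (2 * b) * suc (2 * b) ^ k)        ≡⟨ eq₂ C (suc k ^ d) (suc (2 * b)) (suc (2 * b) ^ k) ⟩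
    C * suc (2 * b) * suc k ^ d * suc (2 * b) ^ k          ≤⟨ h k K≤k ⟩
    suc (suc (2 * b)) ^ k                                  ≡⟨ cong (_^ k) (eq₃ b) ⟩
    (suc b * 2) ^ k                                        ≡⟨ ^-distribʳ-* (suc b) 2 k ⟩
    suc b ^ k * 2 ^ k ∎)
    where
    open ≤-Reasoning
    eq₁ : ∀ C s x y z → C * (s * x) * y * z ≡ C * x * (s * (z * y))
    eq₁ = solve-∀
    eq₂ : ∀ C x s y → C * x * (s * y) ≡ C * s * x * y
    eq₂ = solve-∀
    eq₃ : ∀ b → suc (suc (2 * b)) ≡ suc b * 2
    eq₃ = solve-∀

  floor-root : ∀ m .{{_ : NonZero m}} n → ∃[ k ] (k ^ m ≤ n × n < suc k ^ m)
  floor-root m@(suc _) zero = 0 , z≤n , m^n>0 1 m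
  floor-root m (suc n) with floor-root m n
  ... | k , k^m≤n , n<K^m with suc n <? suc k ^ m
  ... | yes n′<K^m = k , m≤n⇒m≤1+n k^m≤n , n′<K^m
  ... | no  n′≮K^m = suc k , ≮⇒≥ n′≮K^m , ≤-<-trans n<K^m (^-monoˡ-< m (n<1+n (suc k)))

  -- The slack (t + 1)/t is split as (2t + 2)/(2t + 1) times (2t + 1)/(2t). With `k` the integer
  -- part of the root of `n` of order m + 1, the term `3 * k ^ m` is at most 3n/k, which the second
  -- factor covers; powers of the first exceed `G * n′ ^ r`, a quantity polynomial in `k`.
  enough-levels : ∀ m r G t → ∃[ N ] (∀ n → N ≤ n →
    ∃[ k ] (1 ≤ k × (n + 3 * k ^ m) ^ (k + r) * G * t ^ k ≤ (suc t * n) ^ k))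
  enough-levels m r G t with exponential-beats-power (suc m * r) (suc (2 * t)) (G * 4 ^ r)
  ... | K , h = K′ ^ suc m , large
    where
    open ≤-Reasoning
    -- `K` lets the exponential win, `3 * (2 * t)` serves `main`, and the successor gives `1 ≤ k`.
    K′ = suc (K + 3 * (2 * t))
    large : ∀ n → K′ ^ suc m ≤ n → ∃[ k ] (1 ≤ k × (n + 3 * k ^ m) ^ (k + r) * G * t ^ k ≤ (suc t * n) ^ k)
    large n N≤n with floor-root (suc m) n
    ... | k , k^m≤n , n<K^m = k , 1≤k ,
      *-cancelʳ-≤ _ _ (2 ^ k * b ^ k) {{m*n≢0 (2 ^ k) (b ^ k) {{m^n≢0 2 k}} {{m^n≢0 b k}}}} (begin
        n′ ^ (k + r) * G * t ^ k * (2 ^ k * b ^ k)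
          ≡⟨ cong (λ z → z * G * t ^ k * (2 ^ k * b ^ k)) (^-distribˡ-+-* n′ k r) ⟩
        n′ ^ k * n′ ^ r * G * t ^ k * (2 ^ k * b ^ k)
          ≡⟨ eq₁ (n′ ^ k) (n′ ^ r) G (t ^ k) (2 ^ k) (b ^ k) ⟩
        n′ ^ k * (2 ^ k * t ^ k) * (G * n′ ^ r * b ^ k)
          ≡⟨ cong (_* (G * n′ ^ r * b ^ k)) (≡.trans (cong (n′ ^ k *_) (sym (^-distribʳ-* 2 t k))) (sym (^-distribʳ-* n′ (2 * t) k))) ⟩
        (n′ * (2 * t)) ^ k * (G * n′ ^ r * b ^ k)
          ≤⟨ *-mono-≤ (^-monoˡ-≤ k main) (≤-trans (*-monoˡ-≤ (b ^ k) (*-monoʳ-≤ G crude)) (≤-reflexive (cong (_* b ^ k) (sym (*-assoc G (4 ^ r) _))))) ⟩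
        (b * n) ^ k * (G * 4 ^ r * suc k ^ (suc m * r) * b ^ k)
          ≤⟨ *-monoʳ-≤ ((b * n) ^ k) (h k (≤-trans (m≤m+n K (3 * (2 * t))) (<⇒≤ K′≤k))) ⟩
        (b * n) ^ k * suc b ^ k
          ≡⟨ ≡.trans (cong (_* suc b ^ k) (^-distribʳ-* b n k)) (eq₂ (b ^ k) (n ^ k) (suc b ^ k)) ⟩
        suc b ^ k * n ^ k * b ^ k
          ≡⟨ cong (λ z → z * b ^ k) (≡.trans (sym (^-distribʳ-* (suc b) n k)) (cong (_^ k) (eq₃ t n))) ⟩
        (suc t * n * 2) ^ k * b ^ k
          ≡⟨ ≡.trans (cong (_* b ^ k) (^-distribʳ-* (suc t * n) 2 k)) (*-assoc ((suc t * n) ^ k) (2 ^ k) (b ^ k)) ⟩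
        (suc t * n) ^ k * (2 ^ k * b ^ k) ∎)
      where
      b n′ : ℕ
      b  = suc (2 * t)
      n′ = n + 3 * k ^ m
      K′≤k : K′ ≤ k
      K′≤k with K′ ≤? k
      ... | yes p = p
      ... | no ¬p = contradiction (≤-trans (^-monoˡ-≤ (suc m) (≰⇒> ¬p)) N≤n) (<⇒≱ n<K^m)
      1≤k : 1 ≤ k
      1≤k = ≤-trans (s≤s z≤n) K′≤k
      main : n′ * (2 * t) ≤ b * n
      main = begin
        (n + 3 * k ^ m) * (2 * t)           ≡⟨ eq₄ n (k ^ m) (2 * t) ⟩
        2 * t * n + 3 * (2 * t) * k ^ m     ≤⟨ +-monoʳ-≤ (2 * t * n) (*-monoˡ-≤ (k ^ m) (≤-trans (m≤n+m (3 * (2 * t)) K) (<⇒≤ K′≤k))) ⟩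
        2 * t * n + k * k ^ m               ≤⟨ +-monoʳ-≤ (2 * t * n) k^m≤n ⟩
        2 * t * n + n                        ≡⟨ +-comm (2 * t * n) n ⟩
        b * n ∎
        where
        eq₄ : ∀ n q a → (n + 3 * q) * a ≡ a * n + 3 * a * q
        eq₄ = solve-∀
      crude : n′ ^ r ≤ 4 ^ r * suc k ^ (suc m * r)
      crude = begin
        n′ ^ r                        ≤⟨ ^-monoˡ-≤ r n′≤ ⟩
        (4 * suc k ^ suc m) ^ r          ≡⟨ ^-distribʳ-* 4 (suc k ^ suc m) r ⟩
        4 ^ r * (suc k ^ suc m) ^ r      ≡⟨ cong (4 ^ r *_) (^-*-assoc (suc k) (suc m) r) ⟩
        4 ^ r * suc k ^ (suc m * r) ∎
        where
        n′≤ : n′ ≤ 4 * suc k ^ suc m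
        n′≤ = begin
          n + 3 * k ^ m      ≤⟨ +-monoʳ-≤ n (*-monoʳ-≤ 3 (≤-trans (m≤n*m (k ^ m) k {{>-nonZero 1≤k}}) k^m≤n)) ⟩
          4 * n               ≤⟨ *-monoʳ-≤ 4 (<⇒≤ n<K^m) ⟩
          4 * suc k ^ suc m ∎
      eq₁ : ∀ x y G t z w → x * y * G * t * (z * w) ≡ x * (z * t) * (G * y * w)
      eq₁ = solve-∀
      eq₂ : ∀ x y z → x * y * z ≡ z * y * x
      eq₂ = solve-∀
      eq₃ : ∀ t n → suc (suc (2 * t)) * n ≡ suc t * n * 2
      eq₃ = solve-∀

  -- Collecting the exponents

  cancel-levels : ∀ {s a U ψ ν E X Y} .{{_ : NonZero U}} →
    s ^ a * U ^ E ≤ (ψ * ν) ^ E → X * ψ ^ 6 ≤ Y * U ^ 6 → (s ^ a) ^ 6 * X ^ E ≤ (Y * ν ^ 6) ^ E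
  cancel-levels {s} {a} {U} {ψ} {ν} {E} {X} {Y} h₁ h₂ =
    *-cancelʳ-≤ _ _ ((U ^ 6) ^ E) {{m^n≢0 (U ^ 6) E {{m^n≢0 U 6}}}} (begin
      (s ^ a) ^ 6 * X ^ E * (U ^ 6) ^ E        ≡⟨ eq ((s ^ a) ^ 6) (X ^ E) ((U ^ 6) ^ E) ⟩
      X ^ E * ((s ^ a) ^ 6 * (U ^ 6) ^ E)      ≡⟨ cong (λ z → X ^ E * ((s ^ a) ^ 6 * z)) (^-swap U 6 E) ⟩
      X ^ E * ((s ^ a) ^ 6 * (U ^ E) ^ 6)      ≡⟨ cong (X ^ E *_) (^-distribʳ-* (s ^ a) (U ^ E) 6) ⟨
      X ^ E * (s ^ a * U ^ E) ^ 6              ≤⟨ *-monoʳ-≤ (X ^ E) (^-monoˡ-≤ 6 h₁) ⟩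
      X ^ E * ((ψ * ν) ^ E) ^ 6                ≡⟨ cong (X ^ E *_) (^-swap (ψ * ν) E 6) ⟩
      X ^ E * ((ψ * ν) ^ 6) ^ E                ≡⟨ ^-distribʳ-* X _ E ⟨
      (X * (ψ * ν) ^ 6) ^ E                    ≡⟨ cong (λ z → (X * z) ^ E) (^-distribʳ-* ψ ν 6) ⟩
      (X * (ψ ^ 6 * ν ^ 6)) ^ E                ≡⟨ cong (_^ E) (*-assoc X (ψ ^ 6) (ν ^ 6)) ⟨
      (X * ψ ^ 6 * ν ^ 6) ^ E                  ≤⟨ ^-monoˡ-≤ E (*-monoˡ-≤ (ν ^ 6) h₂) ⟩
      (Y * U ^ 6 * ν ^ 6) ^ E                  ≡⟨ cong (_^ E) (eq′ Y (U ^ 6) (ν ^ 6)) ⟩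
      (Y * ν ^ 6 * U ^ 6) ^ E                  ≡⟨ ^-distribʳ-* (Y * ν ^ 6) (U ^ 6) E ⟩
      (Y * ν ^ 6) ^ E * (U ^ 6) ^ E ∎)
    where
    open ≤-Reasoning
    eq : ∀ x y z → x * y * z ≡ y * (x * z)
    eq = solve-∀
    eq′ : ∀ x y z → x * y * z ≡ x * z * y
    eq′ = solve-∀

  -- With `b = k ^ 5` every exponent is a multiple of `b`: the main ones are `k * b`, the errors are
  -- `6 * b` from `6σ-upper` and `10 * b` from the square of the correction in `Ψ-bound`. The last
  -- hypothesis, raised to the power `b`, absorbs the errors, and the root of order `k * b` removes
  -- the levels.
  collect-powers : ∀ {s n n′ k t p q g σ E} b .{{_ : NonZero (k * b)}} .{{_ : NonZero q}} .{{_ : NonZero n′}} →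
    (s ^ (k * b)) ^ 6 * ((p ^ (k * b) * q ^ (5 * b)) ^ 2) ^ E ≤ ((q ^ (k * b) * p ^ (5 * b)) ^ 2 * (n′ ^ σ) ^ 6) ^ E →
    p ≤ g * q → 6 * σ ≤ k * b + 6 * b → n′ ^ (k + 6) * g ^ 10 * t ^ k ≤ (suc t * n) ^ k →
    s ^ 6 * p ^ (2 * E) * t ^ E ≤ q ^ (2 * E) * (suc t * n) ^ E
  collect-powers {s} {n} {n′} {k} {t} {p} {q} {g} {σ} {E} b h p≤ σ≤ levels = ^-cancelʳ-≤ a
    (*-cancelʳ-≤ _ _ (c ^ E) {{m^n≢0 c E {{m^n≢0 (q ^ (5 * b)) 2 {{m^n≢0 q (5 * b)}}}}}} (begin
      (s ^ 6 * p ^ (2 * E) * t ^ E) ^ a * c ^ E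
        ≡⟨ cong (_* c ^ E) (≡.trans (^-distribʳ-* (s ^ 6 * p ^ (2 * E)) (t ^ E) a)
             (cong₂ _*_ (≡.trans (^-distribʳ-* (s ^ 6) (p ^ (2 * E)) a) (cong₂ _*_ (^-swap s 6 a) (square p))) (^-swap t E a))) ⟩
      (s ^ a) ^ 6 * ((p ^ a) ^ 2) ^ E * (t ^ a) ^ E * c ^ E
        ≡⟨ eq₁ ((s ^ a) ^ 6) (((p ^ a) ^ 2) ^ E) ((t ^ a) ^ E) (c ^ E) ⟩
      (s ^ a) ^ 6 * (((p ^ a) ^ 2) ^ E * c ^ E) * (t ^ a) ^ E
        ≡⟨ cong (λ z → (s ^ a) ^ 6 * z * (t ^ a) ^ E) (≡.trans (sym (^-distribʳ-* ((p ^ a) ^ 2) c E)) (cong (_^ E) (sym (^-distribʳ-* (p ^ a) (q ^ (5 * b)) 2)))) ⟩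
      (s ^ a) ^ 6 * ((p ^ a * q ^ (5 * b)) ^ 2) ^ E * (t ^ a) ^ E
        ≤⟨ *-monoˡ-≤ ((t ^ a) ^ E) h ⟩
      ((q ^ a * p ^ (5 * b)) ^ 2 * (n′ ^ σ) ^ 6) ^ E * (t ^ a) ^ E
        ≡⟨ ^-distribʳ-* _ (t ^ a) E ⟨
      ((q ^ a * p ^ (5 * b)) ^ 2 * (n′ ^ σ) ^ 6 * t ^ a) ^ E
        ≤⟨ ^-monoˡ-≤ E inner ⟩
      ((q ^ a) ^ 2 * (suc t * n) ^ a * c) ^ E
        ≡⟨ ≡.trans (^-distribʳ-* ((q ^ a) ^ 2 * (suc t * n) ^ a) c E) (cong (_* c ^ E) (^-distribʳ-* ((q ^ a) ^ 2) ((suc t * n) ^ a) E)) ⟩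
      ((q ^ a) ^ 2) ^ E * ((suc t * n) ^ a) ^ E * c ^ E
        ≡⟨ cong (_* c ^ E) (≡.trans (cong₂ _*_ (sym (square q)) (^-swap (suc t * n) a E)) (sym (^-distribʳ-* (q ^ (2 * E)) ((suc t * n) ^ E) a))) ⟩
      (q ^ (2 * E) * (suc t * n) ^ E) ^ a * c ^ E ∎))
    where
    open ≤-Reasoning
    a = k * b
    c = (q ^ (5 * b)) ^ 2
    eq₁ : ∀ x y z w → x * y * z * w ≡ x * (y * w) * z
    eq₁ = solve-∀
    eq₂ : ∀ x y c z w → x * (y * c) * z * w ≡ x * (z * y * w) * c
    eq₂ = solve-∀
    square : ∀ x → (x ^ (2 * E)) ^ a ≡ ((x ^ a) ^ 2) ^ E
    square x = ≡.trans (^-swap x (2 * E) a) (sym (^-*-assoc (x ^ a) 2 E))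
    inner : (q ^ a * p ^ (5 * b)) ^ 2 * (n′ ^ σ) ^ 6 * t ^ a ≤ (q ^ a) ^ 2 * (suc t * n) ^ a * c
    inner = begin
      (q ^ a * p ^ (5 * b)) ^ 2 * (n′ ^ σ) ^ 6 * t ^ a
        ≤⟨ *-monoˡ-≤ (t ^ a) (*-mono-≤ (^-monoˡ-≤ 2 (*-monoʳ-≤ (q ^ a) (^-monoˡ-≤ (5 * b) p≤)))
             (≤-trans (≤-reflexive (≡.trans (^-*-assoc n′ σ 6) (cong (n′ ^_) (*-comm σ 6)))) (^-monoʳ-≤ n′ σ≤))) ⟩
      (q ^ a * (g * q) ^ (5 * b)) ^ 2 * n′ ^ (a + 6 * b) * t ^ a
        ≡⟨ cong (λ z → z * n′ ^ (a + 6 * b) * t ^ a) (≡.trans (^-distribʳ-* (q ^ a) _ 2)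
             (cong ((q ^ a) ^ 2 *_) (≡.trans (cong (_^ 2) (^-distribʳ-* g q (5 * b))) (^-distribʳ-* (g ^ (5 * b)) (q ^ (5 * b)) 2)))) ⟩
      (q ^ a) ^ 2 * ((g ^ (5 * b)) ^ 2 * c) * n′ ^ (a + 6 * b) * t ^ a
        ≡⟨ eq₂ ((q ^ a) ^ 2) ((g ^ (5 * b)) ^ 2) c (n′ ^ (a + 6 * b)) (t ^ a) ⟩
      (q ^ a) ^ 2 * (n′ ^ (a + 6 * b) * (g ^ (5 * b)) ^ 2 * t ^ a) * c
        ≡⟨ cong (λ z → (q ^ a) ^ 2 * z * c) gather ⟩
      (q ^ a) ^ 2 * (n′ ^ (k + 6) * g ^ 10 * t ^ k) ^ b * c
        ≤⟨ *-monoˡ-≤ c (*-monoʳ-≤ ((q ^ a) ^ 2) (^-monoˡ-≤ b levels)) ⟩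
      (q ^ a) ^ 2 * ((suc t * n) ^ k) ^ b * c
        ≡⟨ cong (λ z → (q ^ a) ^ 2 * z * c) (^-*-assoc (suc t * n) k b) ⟩
      (q ^ a) ^ 2 * (suc t * n) ^ a * c ∎
      where
      gather : n′ ^ (a + 6 * b) * (g ^ (5 * b)) ^ 2 * t ^ a ≡ (n′ ^ (k + 6) * g ^ 10 * t ^ k) ^ b
      gather = sym (≡.trans (^-distribʳ-* (n′ ^ (k + 6) * g ^ 10) (t ^ k) b)
        (cong₂ _*_ (≡.trans (^-distribʳ-* (n′ ^ (k + 6)) (g ^ 10) b)
          (cong₂ _*_ (≡.trans (^-*-assoc n′ (k + 6) b) (cong (n′ ^_) (*-distribʳ-+ b k 6)))
            (≡.trans (^-*-assoc g 10 b) (≡.trans (cong (g ^_) (ten b)) (sym (^-*-assoc g (5 * b) 2))))))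
          (^-*-assoc t k b)))
        where
        ten : ∀ b → 10 * b ≡ 5 * b * 2
        ten = solve-∀

  -- The sixth power clears the denominator of n²/6. It raises `Ψ k` to the power 72, so `Ψ-bound`,
  -- which concerns the power 36, is squared: this is the origin of the square of e.
  combine : ∀ {s n k t E} g M → 1 ≤ k → (∀ M → eNum M ≤ g * M !) →
    s ^ (k ^ 6) * ((k ^ 12) ^ σ k) ^ E ≤ (Ψ k ^ 12 * (n + 3 * k ^ 12) ^ σ k) ^ E →
    (n + 3 * k ^ 12) ^ (k + 6) * g ^ 10 * t ^ k ≤ (suc t * n) ^ k →
    s ^ 6 * eNum M ^ (2 * E) * t ^ E ≤ (M !) ^ (2 * E) * (suc t * n) ^ E
  combine {s} {n} {k} {t} {E} g M 1≤k e≤g counting levels =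
    collect-powers {s} {n} {n′} {k} {t} {eNum M} {M !} {g} {σ k} {E} (k ^ 5) {{m^n≢0 k 6}} {{M !≢0}} {{n′≢0}}
      (cancel-levels {s} {k ^ 6} {(k ^ 12) ^ σ k} {Ψ k ^ 12} {n′ ^ σ k} {E}
        {(eNum M ^ (k ^ 6) * (M !) ^ (5 * k ^ 5)) ^ 2} {((M !) ^ (k ^ 6) * eNum M ^ (5 * k ^ 5)) ^ 2}
        {{m^n≢0 (k ^ 12) (σ k) {{m^n≢0 k 12}}}} counting product)
      (e≤g M) (6σ-upper k) levels
    where
    instance
      k≢0 : NonZero k
      k≢0 = >-nonZero 1≤k
    n′ = n + 3 * k ^ 12
    n′≢0 : NonZero n′
    n′≢0 = >-nonZero (≤-trans (m^n>0 k 12) (≤-trans (m≤n*m (k ^ 12) 3) (m≤n+m (3 * k ^ 12) n)))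
    regroup : ∀ x → (x ^ 36) ^ 2 ≡ (x ^ 12) ^ 6
    regroup x = ≡.trans (^-*-assoc x 36 2) (sym (^-*-assoc x 12 6))
    product : (eNum M ^ (k ^ 6) * (M !) ^ (5 * k ^ 5)) ^ 2 * (Ψ k ^ 12) ^ 6
              ≤ ((M !) ^ (k ^ 6) * eNum M ^ (5 * k ^ 5)) ^ 2 * ((k ^ 12) ^ σ k) ^ 6
    product = subst₂ _≤_
      (≡.trans (^-distribʳ-* (eNum M ^ (k ^ 6) * (M !) ^ (5 * k ^ 5)) (Ψ k ^ 36) 2)
        (cong ((eNum M ^ (k ^ 6) * (M !) ^ (5 * k ^ 5)) ^ 2 *_) (regroup (Ψ k))))
      (≡.trans (^-distribʳ-* ((M !) ^ (k ^ 6) * eNum M ^ (5 * k ^ 5)) (k ^ (36 * σ k)) 2)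
        (cong (((M !) ^ (k ^ 6) * eNum M ^ (5 * k ^ 5)) ^ 2 *_)
          (≡.trans (cong (_^ 2) (sym (^-*-assoc k 36 (σ k)))) (≡.trans (^-swap (k ^ 36) (σ k) 2)
            (≡.trans (cong (_^ σ k) (regroup k)) (^-swap (k ^ 12) 6 (σ k)))))))
      (^-monoˡ-≤ 2 (Ψ-bound {{M !≢0}} (!≤eNum M) (e-bound M) k))

  counting : ∀ n k → 1 ≤ k →
    STS n ^ (k ^ 6) * ((k ^ 12) ^ σ k) ^ (n * n) ≤ (Ψ k ^ 12 * (n + 3 * k ^ 12) ^ σ k) ^ (n * n)
  counting n k 1≤k = subst₂ _≤_
    (cong₂ (λ s U → s ^ (k ^ 6) * U ^ (n * n)) (length-steinerOps n) (levelsLower-closed k))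
    (cong (_^ (n * n)) (levelsUpper-closed k n))
    (Reveal.counting-bound (fromℕ< 1≤k) (steinerOps n) (steinerOps-steiner n) (steinerOps-distinct n))

  -- The bound g for e is a parameter because g ^ 10 must not be evaluated.
  STS-bound : ∀ t g → (∀ M → eNum M ≤ g * M !) → ∃[ N ] (∀ n → N ≤ n → ∀ M →
    STS n ^ 6 * eNum M ^ (2 * (n * n)) * t ^ (n * n) ≤ (M !) ^ (2 * (n * n)) * (suc t * n) ^ (n * n))
  STS-bound t g e≤g = conclude (enough-levels 12 6 (g ^ 10) t)
    where
    conclude : ∃[ N ] (∀ n → N ≤ n →
        ∃[ k ] (1 ≤ k × (n + 3 * k ^ 12) ^ (k + 6) * g ^ 10 * t ^ k ≤ (suc t * n) ^ k)) →
      ∃[ N ] (∀ n → N ≤ n → ∀ M →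
        STS n ^ 6 * eNum M ^ (2 * (n * n)) * t ^ (n * n) ≤ (M !) ^ (2 * (n * n)) * (suc t * n) ^ (n * n))
    conclude (N , h) = N , λ n N≤n M → let k , 1≤k , levels = h n N≤n in
      combine {STS n} {n} {k} {t} {n * n} g M 1≤k e≤g (counting n k 1≤k) levels

  -- The case l = 1 of `e-bound`, where (1 + 1/1) ^ 2 = 4.
  e≤4 : ∀ M → eNum M ≤ 4 * M !
  e≤4 M = subst₂ _≤_ (*-identityʳ (eNum M)) (*-comm (M !) 4) (e-bound M 1)

open import Defs
open import Data.Nat as ℕ using (ℕ; _*_)
open import Data.Product using (∃-syntax)
open import Data.Rational using (ℚ; 0ℚ; 1ℚ; _<_; _≤_; _+_)
open import Data.Rational as Q using ()
open import Data.Integer as ℤ using (+_; +[1+_]; -[1+_])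
import Data.Integer.Properties as ℤ
open import Data.Nat using (zero; suc; _!)
open import Data.Nat.Properties using (_!≢0)
import Data.Nat.Properties as ℕ
open import Data.Product using (_,_)
open import Data.Rational using (mkℚ; toℚᵘ)
import Data.Rational.Properties as Q
open import Data.Rational.Solver using (module +-*-Solver)
open import Data.Rational.Unnormalised as ℚᵘ using (ℚᵘ; mkℚᵘ; _≃_; *≡*; *≤*)
import Data.Rational.Unnormalised.Properties as ℚᵘ
open import Relation.Binary.PropositionalEquality using (_≡_; refl; sym; trans; cong; cong₂; module ≡-Reasoning)
open Counting using (eNum; STS-bound; e≤4)

-- Transfer to the rationals

-- Identities are checked on unnormalised fractions, where no gcd blocks computation.
natᵘ : ℕ → ℚᵘ
natᵘ a = mkℚᵘ (+ a) 0

toℚᵘ-nat : ∀ a → toℚᵘ (ℕ→ℚ a) ≃ natᵘ a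
toℚᵘ-nat a = Q.toℚᵘ-fromℚᵘ (natᵘ a)

ℕ→ℚ-* : ∀ a b → ℕ→ℚ (a * b) ≡ ℕ→ℚ a Q.* ℕ→ℚ b
ℕ→ℚ-* a b = Q.toℚᵘ-injective (begin
  toℚᵘ (ℕ→ℚ (a * b))                  ≈⟨ toℚᵘ-nat (a * b) ⟩
  natᵘ (a * b)                        ≈⟨ *≡* (cong (ℤ._* + 1) (ℤ.pos-* a b)) ⟩
  natᵘ a ℚᵘ.* natᵘ b                  ≈⟨ ℚᵘ.*-cong (toℚᵘ-nat a) (toℚᵘ-nat b) ⟨
  toℚᵘ (ℕ→ℚ a) ℚᵘ.* toℚᵘ (ℕ→ℚ b)      ≈⟨ Q.toℚᵘ-homo-* (ℕ→ℚ a) (ℕ→ℚ b) ⟨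
  toℚᵘ (ℕ→ℚ a Q.* ℕ→ℚ b) ∎)
  where open ℚᵘ.≃-Reasoning

ℕ→ℚ-+ : ∀ a b → ℕ→ℚ (a ℕ.+ b) ≡ ℕ→ℚ a + ℕ→ℚ b
ℕ→ℚ-+ a b = Q.toℚᵘ-injective (begin
  toℚᵘ (ℕ→ℚ (a ℕ.+ b))                ≈⟨ toℚᵘ-nat (a ℕ.+ b) ⟩
  natᵘ (a ℕ.+ b)                      ≈⟨ *≡* (cong (ℤ._* + 1) (cong₂ ℤ._+_ (ℤ.*-identityʳ (+ a)) (ℤ.*-identityʳ (+ b)))) ⟨
  natᵘ a ℚᵘ.+ natᵘ b                  ≈⟨ ℚᵘ.+-cong (toℚᵘ-nat a) (toℚᵘ-nat b) ⟨
  toℚᵘ (ℕ→ℚ a) ℚᵘ.+ toℚᵘ (ℕ→ℚ b)      ≈⟨ Q.toℚᵘ-homo-+ (ℕ→ℚ a) (ℕ→ℚ b) ⟨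
  toℚᵘ (ℕ→ℚ a + ℕ→ℚ b) ∎)
  where open ℚᵘ.≃-Reasoning

ℕ→ℚ-mono : ∀ {a b} → a ℕ.≤ b → ℕ→ℚ a ≤ ℕ→ℚ b
ℕ→ℚ-mono {a} {b} a≤b = Q.toℚᵘ-cancel-≤ (begin
  toℚᵘ (ℕ→ℚ a)  ≃⟨ toℚᵘ-nat a ⟩
  natᵘ a        ≤⟨ *≤* (ℤ.*-monoʳ-≤-nonNeg (+ 1) (ℤ.+≤+ a≤b)) ⟩
  natᵘ b        ≃⟨ toℚᵘ-nat b ⟨
  toℚᵘ (ℕ→ℚ b) ∎)
  where open ℚᵘ.≤-Reasoning

ℕ→ℚ-nonNeg : ∀ a → Q.NonNegative (ℕ→ℚ a)
ℕ→ℚ-nonNeg a = Q.nonNegative (ℕ→ℚ-mono {0} {a} ℕ.z≤n)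

ℕ→ℚ-pos : ∀ a .{{_ : ℕ.NonZero a}} → Q.Positive (ℕ→ℚ a)
ℕ→ℚ-pos a = Q.normalize-pos a 1

ℕ→ℚ-^ : ∀ a m → ℕ→ℚ (a ℕ.^ m) ≡ ℕ→ℚ a ^ℚ m
ℕ→ℚ-^ a zero    = refl
ℕ→ℚ-^ a (suc m) = trans (ℕ→ℚ-* a (a ℕ.^ m)) (cong (ℕ→ℚ a Q.*_) (ℕ→ℚ-^ a m))

interchange : ∀ a b c d → (a Q.* b) Q.* (c Q.* d) ≡ (a Q.* c) Q.* (b Q.* d)
interchange = solve 4 (λ a b c d → (a :* b) :* (c :* d) := (a :* c) :* (b :* d)) refl
  where open +-*-Solver

^ℚ-distribʳ-* : ∀ x y m → (x Q.* y) ^ℚ m ≡ x ^ℚ m Q.* y ^ℚ m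
^ℚ-distribʳ-* x y zero    = refl
^ℚ-distribʳ-* x y (suc m) =
  trans (cong ((x Q.* y) Q.*_) (^ℚ-distribʳ-* x y m)) (interchange x y (x ^ℚ m) (y ^ℚ m))

^ℚ-nonNeg : ∀ x m .{{_ : Q.NonNegative x}} → Q.NonNegative (x ^ℚ m)
^ℚ-nonNeg x zero    = _
^ℚ-nonNeg x (suc m) = Q.nonNeg*nonNeg⇒nonNeg x (x ^ℚ m) {{^ℚ-nonNeg x m}}

^ℚ-pos : ∀ x m .{{_ : Q.Positive x}} → Q.Positive (x ^ℚ m)
^ℚ-pos x zero    = _
^ℚ-pos x (suc m) = Q.pos*pos⇒pos x (x ^ℚ m) {{^ℚ-pos x m}}

^ℚ-mono : ∀ {x y} m .{{_ : Q.NonNegative x}} → x ≤ y → x ^ℚ m ≤ y ^ℚ m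
^ℚ-mono zero    x≤y = Q.≤-refl
^ℚ-mono {x} {y} (suc m) x≤y = begin
  x Q.* x ^ℚ m ≤⟨ Q.*-monoʳ-≤-nonNeg (x ^ℚ m) {{^ℚ-nonNeg x m}} x≤y ⟩
  y Q.* x ^ℚ m ≤⟨ Q.*-monoˡ-≤-nonNeg y {{Q.nonNegative (Q.≤-trans (Q.nonNegative⁻¹ x) x≤y)}} (^ℚ-mono m x≤y) ⟩
  y Q.* y ^ℚ m ∎
  where open Q.≤-Reasoning

invFact-cancel : ∀ j → invFact j Q.* ℕ→ℚ (j !) ≡ 1ℚ
invFact-cancel j = cancel (j !) {{j !≢0}}
  where
  cancel : ∀ f .{{_ : ℕ.NonZero f}} → (+ 1 Q./ f) Q.* ℕ→ℚ f ≡ 1ℚ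
  cancel f@(suc f-1) = Q.toℚᵘ-injective (begin
    toℚᵘ ((+ 1 Q./ f) Q.* ℕ→ℚ f)              ≈⟨ Q.toℚᵘ-homo-* (+ 1 Q./ f) (ℕ→ℚ f) ⟩
    toℚᵘ (+ 1 Q./ f) ℚᵘ.* toℚᵘ (ℕ→ℚ f)        ≈⟨ ℚᵘ.*-cong (Q.toℚᵘ-fromℚᵘ (mkℚᵘ (+ 1) f-1)) (toℚᵘ-nat f) ⟩
    mkℚᵘ (+ 1) f-1 ℚᵘ.* natᵘ f                ≈⟨ *≡* (trans (ℤ.*-identityʳ _) (trans (cong +_ (trans (ℕ.+-identityʳ f) (sym (ℕ.*-identityʳ f)))) (sym (ℤ.*-identityˡ _)))) ⟩
    ℚᵘ.1ℚᵘ ∎)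
    where open ℚᵘ.≃-Reasoning

eApprox-eNum : ∀ M → eApprox M Q.* ℕ→ℚ (M !) ≡ ℕ→ℚ (eNum M)
eApprox-eNum zero    = refl
eApprox-eNum (suc M) = begin
  (eApprox M + invFact (suc M)) Q.* ℕ→ℚ (suc M !)
    ≡⟨ Q.*-distribʳ-+ (ℕ→ℚ (suc M !)) (eApprox M) (invFact (suc M)) ⟩
  eApprox M Q.* ℕ→ℚ (suc M !) + invFact (suc M) Q.* ℕ→ℚ (suc M !)
    ≡⟨ cong₂ _+_ (cong (eApprox M Q.*_) (ℕ→ℚ-* (suc M) (M !))) (invFact-cancel (suc M)) ⟩
  eApprox M Q.* (ℕ→ℚ (suc M) Q.* ℕ→ℚ (M !)) + 1ℚ
    ≡⟨ cong (_+ 1ℚ) (exchange′ (eApprox M) (ℕ→ℚ (suc M)) (ℕ→ℚ (M !))) ⟩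
  ℕ→ℚ (suc M) Q.* (eApprox M Q.* ℕ→ℚ (M !)) + 1ℚ
    ≡⟨ cong (λ z → ℕ→ℚ (suc M) Q.* z + 1ℚ) (eApprox-eNum M) ⟩
  ℕ→ℚ (suc M) Q.* ℕ→ℚ (eNum M) + 1ℚ
    ≡⟨ cong (_+ 1ℚ) (ℕ→ℚ-* (suc M) (eNum M)) ⟨
  ℕ→ℚ (suc M * eNum M) + 1ℚ
    ≡⟨ ℕ→ℚ-+ (suc M * eNum M) 1 ⟨
  ℕ→ℚ (suc M * eNum M ℕ.+ 1) ∎
  where
  open ≡-Reasoning
  exchange′ : ∀ a b c → a Q.* (b Q.* c) ≡ b Q.* (a Q.* c)
  exchange′ = solve 3 (λ a b c → a :* (b :* c) := b :* (a :* c)) refl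
    where open +-*-Solver

archimedean : ∀ ε → 0ℚ < ε → ∃[ t ] 1ℚ ≤ ℕ→ℚ (suc t) Q.* ε
-- Here ε = (m + 1)/(d + 1), so its denominator is a large enough multiplier.
archimedean ε@(mkℚ +[1+ m ] d _) _ = d , Q.toℚᵘ-cancel-≤ (begin
  ℚᵘ.1ℚᵘ                                ≤⟨ *≤* (ℤ.+≤+ (ℕ.≤-trans (ℕ.≤-reflexive (trans (ℕ.+-identityʳ _) (cong suc (ℕ.+-identityʳ d)))) (ℕ.≤-trans (ℕ.m≤m*n (suc d) (suc m)) (ℕ.≤-reflexive (sym (ℕ.*-identityʳ _)))))) ⟩
  natᵘ (suc d) ℚᵘ.* toℚᵘ ε              ≃⟨ ℚᵘ.*-cong (toℚᵘ-nat (suc d)) (ℚᵘ.≃-refl {toℚᵘ ε}) ⟨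
  toℚᵘ (ℕ→ℚ (suc d)) ℚᵘ.* toℚᵘ ε        ≃⟨ Q.toℚᵘ-homo-* (ℕ→ℚ (suc d)) ε ⟨
  toℚᵘ (ℕ→ℚ (suc d) Q.* ε) ∎)
  where open ℚᵘ.≤-Reasoning
archimedean (mkℚ (+ 0)    d _) (Q.*<* (ℤ.+<+ ()))
archimedean (mkℚ -[1+ m ] d _) (Q.*<* ())

transfer : ∀ ε t s n M E → 1ℚ ≤ ℕ→ℚ (suc t) Q.* ε →
  s ℕ.^ 6 * eNum M ℕ.^ (2 * E) * suc t ℕ.^ E ℕ.≤ (M !) ℕ.^ (2 * E) * (suc (suc t) * n) ℕ.^ E →
  (ℕ→ℚ s ^ℚ 6) Q.* (eApprox M ^ℚ (2 * E)) ≤ ((1ℚ + ε) Q.* ℕ→ℚ n) ^ℚ E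
-- The factor cancelled collects the denominators of the powers of `eApprox M` and of 1 + 1/(t + 1).
transfer ε t s n M E 1≤tε h = Q.*-cancelʳ-≤-pos (q ^ℚ F Q.* T ^ℚ E) {{positive}} (begin
  (S ^ℚ 6 Q.* e ^ℚ F) Q.* (q ^ℚ F Q.* T ^ℚ E)
    ≡⟨ regroup (S ^ℚ 6) (e ^ℚ F) (q ^ℚ F) (T ^ℚ E) ⟩
  (S ^ℚ 6 Q.* (e ^ℚ F Q.* q ^ℚ F)) Q.* T ^ℚ E
    ≡⟨ cong (λ z → (S ^ℚ 6 Q.* z) Q.* T ^ℚ E) (^ℚ-distribʳ-* e q F) ⟨
  (S ^ℚ 6 Q.* (e Q.* q) ^ℚ F) Q.* T ^ℚ E
    ≡⟨ cong (λ z → (S ^ℚ 6 Q.* z ^ℚ F) Q.* T ^ℚ E) (eApprox-eNum M) ⟩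
  (S ^ℚ 6 Q.* ℕ→ℚ (eNum M) ^ℚ F) Q.* T ^ℚ E
    ≡⟨ cong₂ Q._*_ (cong₂ Q._*_ (ℕ→ℚ-^ s 6) (ℕ→ℚ-^ (eNum M) F)) (ℕ→ℚ-^ (suc t) E) ⟨
  (ℕ→ℚ (s ℕ.^ 6) Q.* ℕ→ℚ (eNum M ℕ.^ F)) Q.* ℕ→ℚ (suc t ℕ.^ E)
    ≡⟨ trans (ℕ→ℚ-* (s ℕ.^ 6 * eNum M ℕ.^ F) (suc t ℕ.^ E)) (cong (Q._* ℕ→ℚ (suc t ℕ.^ E)) (ℕ→ℚ-* (s ℕ.^ 6) (eNum M ℕ.^ F))) ⟨
  ℕ→ℚ (s ℕ.^ 6 * eNum M ℕ.^ F * suc t ℕ.^ E)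
    ≤⟨ ℕ→ℚ-mono h ⟩
  ℕ→ℚ ((M !) ℕ.^ F * (suc (suc t) * n) ℕ.^ E)
    ≡⟨ trans (ℕ→ℚ-* ((M !) ℕ.^ F) _) (cong₂ Q._*_ (ℕ→ℚ-^ (M !) F) (ℕ→ℚ-^ (suc (suc t) * n) E)) ⟩
  q ^ℚ F Q.* ℕ→ℚ (suc (suc t) * n) ^ℚ E
    ≤⟨ Q.*-monoˡ-≤-nonNeg (q ^ℚ F) {{^ℚ-nonNeg q F {{ℕ→ℚ-nonNeg (M !)}}}} (^ℚ-mono E {{ℕ→ℚ-nonNeg (suc (suc t) * n)}} base) ⟩
  q ^ℚ F Q.* (T Q.* ((1ℚ + ε) Q.* ν)) ^ℚ E
    ≡⟨ cong (q ^ℚ F Q.*_) (^ℚ-distribʳ-* T ((1ℚ + ε) Q.* ν) E) ⟩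
  q ^ℚ F Q.* (T ^ℚ E Q.* ((1ℚ + ε) Q.* ν) ^ℚ E)
    ≡⟨ regroup′ (q ^ℚ F) (T ^ℚ E) _ ⟩
  ((1ℚ + ε) Q.* ν) ^ℚ E Q.* (q ^ℚ F Q.* T ^ℚ E) ∎)
  where
  open Q.≤-Reasoning
  F = 2 * E
  S = ℕ→ℚ s
  e = eApprox M
  q = ℕ→ℚ (M !)
  T = ℕ→ℚ (suc t)
  ν = ℕ→ℚ n
  positive : Q.Positive (q ^ℚ F Q.* T ^ℚ E)
  positive = Q.pos*pos⇒pos (q ^ℚ F) {{^ℚ-pos q F {{ℕ→ℚ-pos (M !) {{M !≢0}}}}}} (T ^ℚ E) {{^ℚ-pos T E {{ℕ→ℚ-pos (suc t)}}}}
  regroup : ∀ a b c d → (a Q.* b) Q.* (c Q.* d) ≡ (a Q.* (b Q.* c)) Q.* d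
  regroup = solve 4 (λ a b c d → (a :* b) :* (c :* d) := (a :* (b :* c)) :* d) refl
    where open +-*-Solver
  regroup′ : ∀ a b c → a Q.* (b Q.* c) ≡ c Q.* (a Q.* b)
  regroup′ = solve 3 (λ a b c → a :* (b :* c) := c :* (a :* b)) refl
    where open +-*-Solver
  base : ℕ→ℚ (suc (suc t) * n) ≤ T Q.* ((1ℚ + ε) Q.* ν)
  base = begin
    ℕ→ℚ (suc (suc t) * n)          ≡⟨ ℕ→ℚ-* (suc (suc t)) n ⟩
    ℕ→ℚ (suc (suc t)) Q.* ν        ≡⟨ cong (Q._* ν) (ℕ→ℚ-+ 1 (suc t)) ⟩
    (1ℚ + T) Q.* ν                 ≤⟨ Q.*-monoʳ-≤-nonNeg ν {{ℕ→ℚ-nonNeg n}} (Q.+-monoˡ-≤ T 1≤tε) ⟩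
    (T Q.* ε + T) Q.* ν            ≡⟨ factor T ε ν ⟩
    T Q.* ((1ℚ + ε) Q.* ν) ∎
    where
    factor : ∀ T ε ν → (T Q.* ε + T) Q.* ν ≡ T Q.* ((1ℚ + ε) Q.* ν)
    factor = solve 3 (λ T ε ν → (T :* ε :+ T) :* ν := T :* ((con 1ℚ :+ ε) :* ν)) refl
      where open +-*-Solver

theorem1 : (ε : ℚ) → 0ℚ < ε →
    ∃[ N ] ((n : ℕ) → N ℕ.≤ n → (M : ℕ) →
    (ℕ→ℚ (STS n) ^ℚ 6) Q.* (eApprox M ^ℚ (2 * (n * n)))
    ≤ ((1ℚ + ε) Q.* ℕ→ℚ n) ^ℚ (n * n))
theorem1 ε 0<ε =
  let t , 1≤tε = archimedean ε 0<ε
      -- At `suc t` the slack is 1 + 1/(t + 1), which is at most 1 + ε by the choice of `t`.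
      N , bound = STS-bound (suc t) 4 e≤4
  in N , λ n N≤n M → transfer ε t (STS n) n M (n * n) 1≤tε (bound n N≤n M)
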